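{- The model repair problem for CTL is NP-complete. That is, the following decision problem is NP-complete: given a finite Kripke structure $M=(s_0,S,R,L)$ and a CTL formula $\eta$, decide whether $M$ is repairable with respect to $\eta$, i.e. whether there exists a total Kripke structure $M'=(s_0',S',R',L')$ with $M'\subseteq M$ and $M',s_0\models\eta$.
   Context: Let $\mathcal{AP}$ be a set of atomic propositions. A Kripke structure is a tuple $M=(s_0,S,R,L)$ with $S$ a finite set of states, $s_0\in S$ the initial state, $R\subseteq S\times S$ the transition relation, and $L:S\to 2^{\mathcal{AP}}$ the labeling function. It is total if every state has at least one outgoing transition; Kripke structures $M$ are assumed total. A fullpath is an infinite sequence $s_0,s_1,\dots$ of states with $(s_i,s_{i+1})\in R$ for all $i\ge 0$. CTL syntax: $\varphi ::= \mathsf{true}\mid\mathsf{false}\mid p\mid\neg\varphi\mid\varphi\land\varphi\mid\varphi\lor\varphi\mid \mathsf{AX}\varphi\mid\mathsf{EX}\varphi\mid\mathsf{A}[\varphi\,\mathsf{V}\,\varphi]\mid\mathsf{E}[\varphi\,\mathsf{V}\,\varphi]$ with $p\in\mathcal{AP}$. Semantics: $M,s\models\mathsf{true}$ always, $M,s\models\mathsf{false}$ never; $M,s\models p$ iff $p\in L(s)$; boolean connectives as usual; $M,s\models\mathsf{AX}\varphi$ (resp. $\mathsf{EX}\varphi$) iff $M,t\models\varphi$ for all (resp. some) $t$ with $(s,t)\in R$; $M,s\models\mathsf{A}[\varphi\,\mathsf{V}\,\psi]$ (resp. $\mathsf{E}[\varphi\,\mathsf{V}\,\psi]$) iff for all (resp.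 some) fullpaths $s=s_0,s_1,\dots$ starting from $s$: for all $k\ge0$, if $M,s_j\not\models\varphi$ for all $j<k$ then $M,s_k\models\psi$. Abbreviations: $\mathsf{A}[\varphi\,\mathsf{U}\,\psi]$ for $\neg\mathsf{E}[\neg\varphi\,\mathsf{V}\,\neg\psi]$, $\mathsf{E}[\varphi\,\mathsf{U}\,\psi]$ for $\neg\mathsf{A}[\neg\varphi\,\mathsf{V}\,\neg\psi]$, $\mathsf{AF}\varphi=\mathsf{A}[\mathsf{true}\,\mathsf{U}\,\varphi]$, $\mathsf{EF}\varphi=\mathsf{E}[\mathsf{true}\,\mathsf{U}\,\varphi]$, $\mathsf{AG}\varphi=\mathsf{A}[\mathsf{false}\,\mathsf{V}\,\varphi]$, $\mathsf{EG}\varphi=\mathsf{E}[\mathsf{false}\,\mathsf{V}\,\varphi]$. Substructure: for $M=(s_0,S,R,L)$ and $M'=(s_0',S',R',L')$, $M'\subseteq M$ means $S'\subseteq S$, $s_0'=s_0$, $R'\subseteq R$ and $L'=L\upharpoonright S'$. -}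

module Defs where

open import Data.Bool using (Bool; true; false)
open import Data.Fin using (Fin; zero; suc; toℕ)
open import Data.Fin.Subset using (Subset; _∈_; _⊆_)
open import Data.List using (List; []; _∷_; _++_; map; replicate; length; concatMap; allFin)
open import Data.Maybe using (Maybe; just; nothing)
open import Data.Nat using (ℕ; zero; suc; _+_; _*_; _≤_; _<_)
open import Data.Product using (Σ; ∃; _×_; _,_)
open import Data.Sum using (_⊎_)
open import Data.Unit using (⊤)
open import Data.Empty using (⊥)
open import Data.Vec as Vec using (Vec; _∷_)
open import Function using (_∘_; _↔_; _⇔_)
open import Relation.Binary.PropositionalEquality using (_≡_)
open import Relation.Nullary using (¬_)

-- The state set S is an arbitrary subset of an ambient n-element set, so
-- that substructures live over the same ambient set and S' ⊆ S is literal
-- inclusion.  R s is the set of successors of s.  The values of L outside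
-- S are irrelevant.  There are a atomic propositions.

record Kripke (n a : ℕ) : Set where
  field
    s₀   : Fin n
    S    : Subset n
    R    : Fin n → Subset n
    L    : Fin n → Subset a
    s₀∈S : s₀ ∈ S
    R⊆S² : ∀ {s t} → t ∈ R s → s ∈ S × t ∈ S

open Kripke public

Total : ∀ {n a} → Kripke n a → Set
Total M = ∀ {s} → s ∈ S M → ∃ λ t → t ∈ R M s

record _⊑_ {n a : ℕ} (M′ M : Kripke n a) : Set where
  field
    S⊆ : S M′ ⊆ S M
    s₀≡ : s₀ M′ ≡ s₀ M
    R⊆ : ∀ s → R M′ s ⊆ R M s
    L≡ : ∀ {s} → s ∈ S M′ → L M′ s ≡ L M s

infix 4 _⊑_

record Fullpath {n a : ℕ} (M : Kripke n a) (s : Fin n) : Set where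
  field
    at     : ℕ → Fin n
    starts : at 0 ≡ s
    steps  : ∀ i → at (suc i) ∈ R M (at i)

open Fullpath public

data CTL (a : ℕ) : Set where
  tt ff     : CTL a
  atom      : Fin a → CTL a
  neg       : CTL a → CTL a
  _and_     : CTL a → CTL a → CTL a
  _or_      : CTL a → CTL a → CTL a
  AX EX     : CTL a → CTL a
  A[_V_]    : CTL a → CTL a → CTL a
  E[_V_]    : CTL a → CTL a → CTL a

infix 4 _,_⊨_

_,_⊨_ : ∀ {n a} → Kripke n a → Fin n → CTL a → Set
M , s ⊨ tt         = ⊤
M , s ⊨ ff         = ⊥
M , s ⊨ atom p     = p ∈ L M s
M , s ⊨ neg φ      = ¬ (M , s ⊨ φ)
M , s ⊨ (φ and ψ)  = (M , s ⊨ φ) × (M , s ⊨ ψ)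
M , s ⊨ (φ or ψ)   = (M , s ⊨ φ) ⊎ (M , s ⊨ ψ)
M , s ⊨ AX φ       = ∀ t → t ∈ R M s → M , t ⊨ φ
M , s ⊨ EX φ       = ∃ λ t → t ∈ R M s × (M , t ⊨ φ)
M , s ⊨ A[ φ V ψ ] =
  (π : Fullpath M s) → ∀ k →
  (∀ j → j < k → ¬ (M , at π j ⊨ φ)) → M , at π k ⊨ ψ
M , s ⊨ E[ φ V ψ ] =
  Σ (Fullpath M s) λ π → ∀ k →
  (∀ j → j < k → ¬ (M , at π j ⊨ φ)) → M , at π k ⊨ ψ

Repairable : ∀ {n a} → Kripke n a → CTL a → Set
Repairable {n} {a} M η =
  Σ (Kripke n a) λ M′ → Total M′ × M′ ⊑ M × (M′ , s₀ M ⊨ η)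

Finite : Set → Set
Finite A = ∃ λ n → A ↔ Fin n

data Symbol (W : Set) : Set where
  □    : Symbol W
  bit  : Bool → Symbol W
  work : W → Symbol W

data Move : Set where
  left right stay : Move

-- A two-way infinite tape.  The first list holds the cells to the left of
-- the head, nearest first, the second those to its right; all cells beyond
-- either list are blank.

record Tape (W : Set) : Set where
  constructor tape
  field
    lefts  : List (Symbol W)
    head   : Symbol W
    rights : List (Symbol W)

open Tape public

module _ {W : Set} where

  shift : Move → Tape W → Tape W
  shift stay  t                   = t
  shift left  (tape []       x r) = tape [] □ (x ∷ r)
  shift left  (tape (y ∷ l)  x r) = tape l y (x ∷ r)
  shift right (tape l x []      ) = tape (x ∷ l) □ []
  shift right (tape l x (y ∷ r) ) = tape (x ∷ l) y r

  act : Symbol W × Move → Tape W → Tape W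
  act (x , m) t = shift m (record t { head = x })

  load : List Bool → Tape W
  load []       = tape [] □ []
  load (b ∷ bs) = tape [] (bit b) (map bit bs)

  leadingBits : List (Symbol W) → List Bool
  leadingBits (bit b ∷ xs) = b ∷ leadingBits xs
  leadingBits _            = []

  -- The maximal bit string starting under the head and extending rightwards.
  readOut : Tape W → List Bool
  readOut t = leadingBits (head t ∷ rights t)

-- Tape 0 holds the input; tape 1 holds a second input (a certificate, or
-- nothing) at the start and the output, if any, at the end.  A state q is
-- halting iff verdict q ≡ just b, accepting if b is true and rejecting if
-- b is false.

record TM : Set₁ where
  field
    extraTapes  : ℕ
    State       : Set
    Work        : Set
    finiteState : Finite State
    finiteWork  : Finite Work
    start       : State
    verdict     : State → Maybe Bool

  tapeCount : ℕ
  tapeCount = 2 + extraTapes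

  field
    δ : State → Vec (Symbol Work) tapeCount →
        State × Vec (Symbol Work × Move) tapeCount

  record Config : Set where
    constructor config
    field
      state : State
      tapes : Vec (Tape Work) tapeCount

  open Config public

  init : List Bool → List Bool → Config
  init w u = config start (load w ∷ load u ∷ Vec.replicate extraTapes (load []))

  advance : Config → Config
  advance c =
    let q , actions = δ (state c) (Vec.map head (tapes c))
    in  config q (Vec.zipWith act actions (tapes c))

  step : Config → Config
  step c with verdict (state c)
  ... | just _  = c
  ... | nothing = advance c

  run : ℕ → Config → Config
  run zero    c = c
  run (suc t) c = run t (step c)

  Halted : Config → Set
  Halted c = ∃ λ b → verdict (state c) ≡ just b

  Accepting : Config → Set
  Accepting c = verdict (state c) ≡ just true

  output : Config → List Bool
  output c = readOut (Vec.lookup (tapes c) (suc zero))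

-- Polynomials with natural coefficients, constant term first.

Polynomial : Set
Polynomial = List ℕ

⟦_⟧ : Polynomial → ℕ → ℕ
⟦ []     ⟧ n = 0
⟦ c ∷ cs ⟧ n = c + n * ⟦ cs ⟧ n

Language : Set₁
Language = List Bool → Set

record InNP (A : Language) : Set₁ where
  field
    verifier : TM

  open TM verifier

  field
    time       : Polynomial
    certLength : Polynomial
    halts      : ∀ w u → Halted (run (⟦ time ⟧ (length w + length u)) (init w u))
    verifies   : ∀ w → A w ⇔ ∃ λ u →
                 length u ≤ ⟦ certLength ⟧ (length w) ×
                 Accepting (run (⟦ time ⟧ (length w + length u)) (init w u))

record PolyTimeComputable (f : List Bool → List Bool) : Set₁ where
  field
    machine : TM

  open TM machine

  field
    time     : Polynomial
    halts    : ∀ w → Halted (run (⟦ time ⟧ (length w)) (init w []))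
    computes : ∀ w → output (run (⟦ time ⟧ (length w)) (init w [])) ≡ f w

record _≤ₚ_ (A B : Language) : Set₁ where
  field
    reduction  : List Bool → List Bool
    computable : PolyTimeComputable reduction
    correct    : ∀ w → A w ⇔ B (reduction w)

NPHard : Language → Set₁
NPHard B = ∀ A → InNP A → A ≤ₚ B

NPComplete : Language → Set₁
NPComplete A = InNP A × NPHard A

record Instance : Set where
  field
    {n a} : ℕ
    M     : Kripke n a
    total : Total M
    η     : CTL a

-- Every piece below is self-delimiting, once n and a are known: numbers
-- are written in unary as 1ⁱ0, subsets as characteristic vectors, R and L
-- as matrices row by row, and formulas in prefix notation.  Unary costs
-- nothing here up to a polynomial, since the matrices are already of
-- size n² and n·a, and n and a are at least as large as the indices.

unary : ℕ → List Bool
unary i = replicate i true ++ false ∷ []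

matrix : ∀ {m k} → (Fin m → Subset k) → List Bool
matrix f = concatMap (Vec.toList ∘ f) (allFin _)

encodeCTL : ∀ {a} → CTL a → List Bool
encodeCTL tt         = unary 0
encodeCTL ff         = unary 1
encodeCTL (atom p)   = unary 2 ++ unary (toℕ p)
encodeCTL (neg φ)    = unary 3 ++ encodeCTL φ
encodeCTL (φ and ψ)  = unary 4 ++ encodeCTL φ ++ encodeCTL ψ
encodeCTL (φ or ψ)   = unary 5 ++ encodeCTL φ ++ encodeCTL ψ
encodeCTL (AX φ)     = unary 6 ++ encodeCTL φ
encodeCTL (EX φ)     = unary 7 ++ encodeCTL φ
encodeCTL A[ φ V ψ ] = unary 8 ++ encodeCTL φ ++ encodeCTL ψ
encodeCTL E[ φ V ψ ] = unary 9 ++ encodeCTL φ ++ encodeCTL ψ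

encode : Instance → List Bool
encode I = unary n ++ unary a ++ unary (toℕ (s₀ M)) ++ Vec.toList (S M) ++
           matrix (R M) ++ matrix (L M) ++ encodeCTL η
  where open Instance I

-- Strings that encode no instance are not in the language.

ModelRepair : Language
ModelRepair w = Σ Instance λ I →
  encode I ≡ w × Repairable (Instance.M I) (Instance.η I)

{-# OPTIONS --safe #-}

module Submission where

-- Membership in NP follows the idea of Fagin's theorem.  A certificate encodes
-- four relations on the positions of the input, and a first-order formula with
-- bounded quantifiers and arithmetic checks that they describe the syntax tree
-- of η, a total substructure M′, and the sets of states of M′ that satisfy the
-- subformulas of η.  The set of a release formula is a greatest fixpoint, whose
-- n-th approximant is stable, n being the number of states; all approximants
-- are part of the certificate.
--
-- Hardness is a Cook–Levin argument.  Tape cells are numbered relative to the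
-- head, so that a row of the tableau depends on the previous one through the
-- state, the scanned symbols and the neighbouring cells only.  The tableau is a
-- propositional formula; its variables become formulas EX p, one atom p for
-- each leaf of a star, since repairing a star at its root amounts to choosing
-- the leaves that remain visible.
--
-- Both the formula of the first part and the reduction of the second are terms
-- of an arithmetic language whose only loops are bounded sums and
-- concatenations.  Such terms translate to Turing machines that use tapes as
-- unary counters, and the running time is polynomial for every term.

open import Data.Bool as Bool using (Bool; true; false; if_then_else_; _∧_; _∨_)
open import Data.Empty using (⊥)
open import Data.Fin using (Fin; zero; suc; toℕ; fromℕ<; #_)
open import Data.Fin.Properties using (toℕ<n; toℕ-fromℕ<; fromℕ<-toℕ; toℕ-injective; nonZeroIndex; all?; any?; ¬∀⟶∃¬;
                                       +↔⊎; *↔×; 1↔⊤; 2↔Bool) renaming (_≟_ to _≟ᶠ_)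
open import Data.Fin.Subset using (Subset; _∈_; _⊂_; ∣_∣)
open import Data.Fin.Subset.Properties using (_∈?_; p⊂q⇒∣p∣<∣q∣; ∣p∣≤n)
open import Data.List as List
  using (List; []; _∷_; _++_; map; length; replicate; concatMap; allFin; cartesianProductWith)
open import Data.List.Membership.Propositional using () renaming (_∈_ to _∈ˡ_)
open import Data.List.Membership.Propositional.Properties
  using (∈-++⁺ˡ; ∈-++⁺ʳ; ∈-++⁻; ∈-map⁺; ∈-allFin; ∈-cartesianProductWith⁺)
open import Data.List.Properties using (length-++; ++-assoc; ++-identityʳ; ∷-injectiveʳ)
open import Data.List.Relation.Unary.Any using (here; there)
open import Data.Maybe using (Maybe; just; nothing; maybe)
open import Data.Nat
open import Data.Nat.DivMod using (_/_; _%_; m%n<n; m<n⇒m%n≡m; m<n⇒m/n≡0; m*n%n≡0; m*n/n≡m; [m+kn]%n≡m%n; +-distrib-/)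
open import Data.Nat.Properties
open import Data.Nat.Solver using (module +-*-Solver)
open import Data.Product using (∃; ∃₂; Σ; _×_; _,_; proj₁; proj₂; map₁)
open import Data.Product.Function.NonDependent.Propositional using (_×-↔_; _×-⇔_)
open import Data.Sum using (_⊎_; inj₁; inj₂; [_,_]′)
open import Data.Sum.Function.Propositional using (_⊎-↔_; _⊎-⇔_)
open import Data.Unit using (⊤) renaming (tt to unit)
open import Data.Vec as Vec using (Vec; []; _∷_; lookup; tabulate; toList)
open import Data.Vec.Properties using (lookup-map; lookup-zipWith; lookup-replicate; lookup∘tabulate; lookup⇒[]=;
                                      []=⇒lookup; length-toList; tabulate∘lookup; tabulate-cong)
open import Function using (_∘_; id; const; _⇔_; mk⇔; Equivalence; mk↔ₛ′; Inverse)
open import Function.Construct.Composition using (_↔-∘_; _⇔-∘_)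
open import Function.Construct.Symmetry using (↔-sym; ⇔-sym)
open import Function.Related.TypeIsomorphisms using (¬-cong-⇔)
open import Relation.Binary.Definitions using (tri<; tri≈; tri>)
open import Relation.Binary.PropositionalEquality hiding (J)
open import Relation.Nullary using (Dec; yes; no; ¬_; does; contradiction; decidable-stable)
open import Relation.Nullary.Decidable using (True; map′; _×-dec_; _⊎-dec_; _→-dec_; ¬?)
open import Defs

open +-*-Solver using (solve; _:+_; _:*_; _:=_; con)
open Equivalence using (to; from)

-- Polynomials

-- The path quantifiers of `_,_⊨_` range over infinite sequences and are not decidable as they
-- stand, while a certificate consists of bits; what it records are decidable approximants, and
-- totality of the structure ties these to paths.
--
-- The verifier need not parse. A certificate names the nodes of the syntax tree and the positions
-- of their codes, and only local conditions are checked. Such a description might be circular; it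
-- is not, because the code of a child starts strictly after that of its parent. Local conditions
-- also keep the nesting of quantifiers fixed, so one term and one machine serve all inputs.
--
-- `ModelRepair` asks for some instance with the given code. Hardness therefore needs that a code
-- determines its instance up to repairability.
--
-- The verifier may run longer on longer certificates, whereas one tableau must serve them all; its
-- height is the time allowed for the longest admissible certificate.

IsPoly : (ℕ → ℕ) → Set
IsPoly f = ∃ λ p → ∀ n → f n ≡ ⟦ p ⟧ n

⟦⟧-mono : ∀ p {m n} → m ≤ n → ⟦ p ⟧ m ≤ ⟦ p ⟧ n
⟦⟧-mono []       m≤n = z≤n
⟦⟧-mono (c ∷ cs) m≤n = +-monoʳ-≤ c (*-mono-≤ m≤n (⟦⟧-mono cs m≤n))

_⊞_ : Polynomial → Polynomial → Polynomial
[]       ⊞ q        = q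
(c ∷ p)  ⊞ []       = c ∷ p
(c ∷ p)  ⊞ (d ∷ q)  = c + d ∷ p ⊞ q

⟦⊞⟧ : ∀ p q n → ⟦ p ⊞ q ⟧ n ≡ ⟦ p ⟧ n + ⟦ q ⟧ n
⟦⊞⟧ []       q        n = refl
⟦⊞⟧ (c ∷ p)  []       n = sym (+-identityʳ _)
⟦⊞⟧ (c ∷ p)  (d ∷ q)  n rewrite ⟦⊞⟧ p q n =
  solve 5 (λ c d n x y → c :+ d :+ n :* (x :+ y) := c :+ n :* x :+ (d :+ n :* y))
    refl c d n (⟦ p ⟧ n) (⟦ q ⟧ n)

poly-const : ∀ c → IsPoly (λ _ → c)
poly-const c = c ∷ [] , λ n → solve 2 (λ c n → c := c :+ n :* con 0) refl c n

poly-id : IsPoly id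
poly-id = 0 ∷ 1 ∷ [] , λ n → solve 1 (λ n → n := n :* (con 1 :+ n :* con 0)) refl n

poly-+ : ∀ {f g} → IsPoly f → IsPoly g → IsPoly (λ n → f n + g n)
poly-+ (p , f≡p) (q , g≡q) = p ⊞ q , λ n →
  trans (cong₂ _+_ (f≡p n) (g≡q n)) (sym (⟦⊞⟧ p q n))

poly-shift : ∀ {f} → IsPoly f → IsPoly (λ n → n * f n)
poly-shift (p , f≡p) = 0 ∷ p , λ n → cong (n *_) (f≡p n)

poly-scale : ∀ {f} c → IsPoly f → IsPoly (λ n → c * f n)
poly-scale zero    f-poly = [] , λ _ → refl
poly-scale (suc c) f-poly = poly-+ f-poly (poly-scale c f-poly)

poly-≗ : ∀ {f g} → (∀ n → g n ≡ f n) → IsPoly f → IsPoly g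
poly-≗ g≡f (p , f≡p) = p , λ n → trans (g≡f n) (f≡p n)

poly-* : ∀ {f g} → IsPoly f → IsPoly g → IsPoly (λ n → f n * g n)
poly-* {f} {g} (p , f≡p) g-poly = poly-≗ (λ n → cong (_* g n) (f≡p n)) (go p)
  where
  go : ∀ p → IsPoly (λ n → ⟦ p ⟧ n * g n)
  go []      = [] , λ _ → refl
  go (c ∷ p) = poly-≗
    (λ n → solve 4 (λ c n x y → (c :+ n :* x) :* y := c :* y :+ n :* (x :* y))
             refl c n (⟦ p ⟧ n) (g n))
    (poly-+ (poly-scale c g-poly) (poly-shift (go p)))

-- Horner evaluation at `g n`. As `IsPoly` asks for equality and not for an upper bound, composition
-- involves no monotonicity.
poly-∘ : ∀ {f g} → IsPoly f → IsPoly g → IsPoly (f ∘ g)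
poly-∘ {f} {g} (p , f≡p) g-poly = poly-≗ (f≡p ∘ g) (go p)
  where
  go : ∀ p → IsPoly (⟦ p ⟧ ∘ g)
  go []      = [] , λ _ → refl
  go (c ∷ p) = poly-+ (poly-const c) (poly-* g-poly (go p))

-- Structured programs for Turing machines

cellAt : ∀ {W} → List (Symbol W) → ℕ → Symbol W
cellAt []       _       = □
cellAt (x ∷ xs) zero    = x
cellAt (x ∷ xs) (suc i) = cellAt xs i

-- The symbol of cell number k, when cells are numbered so that the head
-- stands on cell number v.
look : ∀ {W} → Tape W → ℕ → ℕ → Symbol W
look t zero    zero    = head t
look t (suc k) zero    = cellAt (rights t) k
look t zero    (suc v) = cellAt (lefts t) v
look t (suc k) (suc v) = look t k v

module _ {W : Set} where

  -- Two accounts of a head move are needed. Here and in `look-left-suc` the head keeps its number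
  -- and the tape slides beneath it, as in the tableau; in `look-right` and `look-left` the cells
  -- keep their numbers and that of the head changes, as for the counters.
  look-right-suc : ∀ (t : Tape W) k v → look (shift right t) k v ≡ look t (suc k) v
  look-right-suc (tape l x [])      zero    zero    = refl
  look-right-suc (tape l x (_ ∷ _)) zero    zero    = refl
  look-right-suc (tape l x [])      (suc k) zero    = refl
  look-right-suc (tape l x (_ ∷ _)) (suc k) zero    = refl
  look-right-suc (tape l x [])      zero    (suc zero)    = refl
  look-right-suc (tape l x (_ ∷ _)) zero    (suc zero)    = refl
  look-right-suc (tape l x [])      zero    (suc (suc v)) = refl
  look-right-suc (tape l x (_ ∷ _)) zero    (suc (suc v)) = refl
  look-right-suc t                  (suc k) (suc v) = look-right-suc t k v

  look-right : ∀ (t : Tape W) k v → look (shift right t) k (suc v) ≡ look t k v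
  look-right t                  (suc k) v       = look-right-suc t k v
  look-right (tape l x [])      zero    zero    = refl
  look-right (tape l x (_ ∷ _)) zero    zero    = refl
  look-right (tape l x [])      zero    (suc v) = refl
  look-right (tape l x (_ ∷ _)) zero    (suc v) = refl

  look-left : ∀ (t : Tape W) k v → look (shift left t) k v ≡ look t k (suc v)
  look-left (tape [] x r)      zero          zero    = refl
  look-left (tape (_ ∷ l) x r) zero          zero    = refl
  look-left (tape [] x r)      zero          (suc v) = refl
  look-left (tape (_ ∷ l) x r) zero          (suc v) = refl
  look-left (tape [] x r)      (suc zero)    zero    = refl
  look-left (tape (_ ∷ l) x r) (suc zero)    zero    = refl
  look-left (tape [] x r)      (suc (suc k)) zero    = refl
  look-left (tape (_ ∷ l) x r) (suc (suc k)) zero    = refl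
  look-left t                  (suc k)       (suc v) = look-left t k v

  look-left-suc : ∀ (t : Tape W) k v → look (shift left t) (suc k) v ≡ look t k v
  look-left-suc (tape [] x r)      zero    zero    = refl
  look-left-suc (tape (_ ∷ l) x r) zero    zero    = refl
  look-left-suc (tape [] x r)      (suc k) zero    = refl
  look-left-suc (tape (_ ∷ l) x r) (suc k) zero    = refl
  look-left-suc t                  k       (suc v) = look-left t k v

  write : Symbol W → Tape W → Tape W
  write x t = record t { head = x }

  look-write-≡ : ∀ x (t : Tape W) v → look (write x t) v v ≡ x
  look-write-≡ x t zero    = refl
  look-write-≡ x t (suc v) = look-write-≡ x t v

  look-write-≢ : ∀ x (t : Tape W) {k v} → k ≢ v → look (write x t) k v ≡ look t k v
  look-write-≢ x t {zero}  {zero}  k≢v = contradiction refl k≢v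
  look-write-≢ x t {zero}  {suc v} k≢v = refl
  look-write-≢ x t {suc k} {zero}  k≢v = refl
  look-write-≢ x t {suc k} {suc v} k≢v = look-write-≢ x t (k≢v ∘ cong suc)

  look-head : ∀ (t : Tape W) v → look t v v ≡ head t
  look-head t zero    = refl
  look-head t (suc v) = look-head t v

  stay-all : ∀ {n} (ts : Vec (Tape W) n) →
             Vec.zipWith act (Vec.map (_, stay) (Vec.map head ts)) ts ≡ ts
  stay-all []       = refl
  stay-all (t ∷ ts) = cong (t ∷_) (stay-all ts)

module _ (M : TM) where
  open TM M

  run-+ : ∀ m n c → run (m + n) c ≡ run n (run m c)
  run-+ zero    n c = refl
  run-+ (suc m) n c = run-+ m n (step c)

  step-advance : ∀ c → verdict (state c) ≡ nothing → step c ≡ advance c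
  step-advance c v rewrite v = refl

  step-halted : ∀ c {b} → verdict (state c) ≡ just b → step c ≡ c
  step-halted c v rewrite v = refl

  run-halted : ∀ n c {b} → verdict (state c) ≡ just b → run n c ≡ c
  run-halted zero    c v = refl
  run-halted (suc n) c v rewrite step-halted c v = run-halted n c v

  run-stable : ∀ {m n} c → m ≤ n → Halted (run m c) → run n c ≡ run m c
  run-stable {m} {n} c m≤n (b , v) = begin
    run n c                ≡⟨ cong (λ n → run n c) (m+[n∸m]≡n m≤n) ⟨
    run (m + (n ∸ m)) c    ≡⟨ run-+ m (n ∸ m) c ⟩
    run (n ∸ m) (run m c)  ≡⟨ run-halted (n ∸ m) (run m c) v ⟩
    run m c                ∎
    where open ≡-Reasoning

⊤-finite : Finite ⊤
⊤-finite = 1 , ↔-sym 1↔⊤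

⊎-finite : ∀ {A B} → Finite A → Finite B → Finite (A ⊎ B)
⊎-finite (m , f) (n , g) = m + n , (↔-sym +↔⊎ ↔-∘ (f ⊎-↔ g))

verdicts-finite : Finite (Maybe Bool)
verdicts-finite = 3 , mk↔ₛ′ enum denum enum-denum denum-enum
  where
  enum : Maybe Bool → Fin 3
  enum nothing      = zero
  enum (just false) = suc zero
  enum (just true)  = suc (suc zero)
  denum : Fin 3 → Maybe Bool
  denum zero             = nothing
  denum (suc zero)       = just false
  denum (suc (suc zero)) = just true
  enum-denum : ∀ i → enum (denum i) ≡ i
  enum-denum zero             = refl
  enum-denum (suc zero)       = refl
  enum-denum (suc (suc zero)) = refl
  denum-enum : ∀ x → denum (enum x) ≡ x
  denum-enum nothing      = refl
  denum-enum (just false) = refl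
  denum-enum (just true)  = refl

Sym : Set
Sym = Symbol ⊤

module Programs (extra : ℕ) where

  K : ℕ
  K = 2 + extra

  Tapes Syms Actions : Set
  Tapes   = Vec (Tape ⊤) K
  Syms    = Vec Sym K
  Actions = Vec (Sym × Move) K

  heads : Tapes → Syms
  heads = Vec.map head

  infixr 5 _⨾_
  infix 4 _⊢_⇓[_]_

  data Prog : Set where
    prim  : (Syms → Actions) → Prog
    _⨾_   : Prog → Prog → Prog
    while : (Syms → Bool) → Prog → Prog

  data _⊢_⇓[_]_ : Prog → Tapes → ℕ → Tapes → Set where
    ⇓-prim : ∀ {a ts} → prim a ⊢ ts ⇓[ 1 ] Vec.zipWith act (a (heads ts)) ts
    ⇓-⨾    : ∀ {P Q ts₀ ts₁ ts₂ m n} →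
             P ⊢ ts₀ ⇓[ m ] ts₁ → Q ⊢ ts₁ ⇓[ n ] ts₂ → P ⨾ Q ⊢ ts₀ ⇓[ m + n ] ts₂
    ⇓-done : ∀ {g P ts} → g (heads ts) ≡ false → while g P ⊢ ts ⇓[ 1 ] ts
    ⇓-loop : ∀ {g P ts₀ ts₁ ts₂ m n} → g (heads ts₀) ≡ true →
             P ⊢ ts₀ ⇓[ m ] ts₁ → while g P ⊢ ts₁ ⇓[ n ] ts₂ →
             while g P ⊢ ts₀ ⇓[ suc (m + n) ] ts₂

  -- The control points, which become machine states: one for each primitive action and one for each
  -- loop test.
  Points : Prog → Set
  Points (prim a)    = ⊤
  Points (P ⨾ Q)     = Points P ⊎ Points Q
  Points (while g P) = ⊤ ⊎ Points P

  entry : ∀ P → Points P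
  entry (prim a)    = unit
  entry (P ⨾ Q)     = inj₁ (entry P)
  entry (while g P) = inj₁ unit

  points-finite : ∀ P → Finite (Points P)
  points-finite (prim a)    = ⊤-finite
  points-finite (P ⨾ Q)     = ⊎-finite (points-finite P) (points-finite Q)
  points-finite (while g P) = ⊎-finite ⊤-finite (points-finite P)

  idle : Syms → Actions
  idle = Vec.map (_, stay)

  -- The result `nothing` means that control leaves the program; the surrounding construct replaces
  -- it by the entry of what follows.
  next : ∀ P → Points P → Syms → Maybe (Points P) × Actions
  next (prim a)    _        ss = nothing , a ss
  next (P ⨾ Q)     (inj₁ p) ss = map₁ (just ∘ maybe inj₁ (inj₂ (entry Q))) (next P p ss)
  next (P ⨾ Q)     (inj₂ q) ss = map₁ (maybe (just ∘ inj₂) nothing) (next Q q ss)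
  next (while g P) (inj₁ _) ss = (if g ss then just (inj₂ (entry P)) else nothing) , idle ss
  next (while g P) (inj₂ p) ss = map₁ (just ∘ maybe inj₂ (inj₁ unit)) (next P p ss)

  -- State `inj₂ nothing` comes after the last action of the program. It spends one more step on
  -- inspecting the scanned symbols, since the verdict of a state cannot depend on the tapes.
  machine : Prog → (Syms → Bool) → TM
  machine P accept = record
    { extraTapes  = extra
    ; State       = Points P ⊎ Maybe Bool
    ; Work        = ⊤
    ; finiteState = ⊎-finite (points-finite P) verdicts-finite
    ; finiteWork  = ⊤-finite
    ; start       = inj₁ (entry P)
    ; verdict     = [ const nothing , id ]′
    ; δ           = λ
      { (inj₁ p) ss → map₁ (maybe inj₁ (inj₂ nothing)) (next P p ss)
      ; (inj₂ _) ss → inj₂ (just (accept ss)) , idle ss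
      }
    }

  module _ (P₀ : Prog) (accept : Syms → Bool) where
    open TM (machine P₀ accept) hiding (finiteWork)

    -- A subprogram sits inside the machine with its control points renamed by `ι` and with `x` as
    -- its continuation. Both vary in the induction over programs.
    record Embeds (P : Prog) (ι : Points P → State) (x : State) : Set where
      field
        δ-ι       : ∀ p ss → δ (ι p) ss ≡ map₁ (maybe ι x) (next P p ss)
        verdict-ι : ∀ p → verdict (ι p) ≡ nothing
    open Embeds

    step-ι : ∀ {P ι x} → Embeds P ι x → ∀ p ts →
             step (config (ι p) ts) ≡
             config (maybe ι x (proj₁ (next P p (heads ts))))
                    (Vec.zipWith act (proj₂ (next P p (heads ts))) ts)
    step-ι {ι = ι} emb p ts = trans
      (step-advance (machine P₀ accept) (config (ι p) ts) (verdict-ι emb p))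
      (cong (λ (q , as) → config q (Vec.zipWith act as ts)) (δ-ι emb p (heads ts)))

    embeds-⨾₁ : ∀ {P Q ι x} → Embeds (P ⨾ Q) ι x → Embeds P (ι ∘ inj₁) (ι (inj₂ (entry Q)))
    δ-ι (embeds-⨾₁ {P} emb) p ss with next P p ss | δ-ι emb (inj₁ p) ss
    ... | just _  , _ | eq = eq
    ... | nothing , _ | eq = eq
    verdict-ι (embeds-⨾₁ emb) p = verdict-ι emb (inj₁ p)

    embeds-⨾₂ : ∀ {P Q ι x} → Embeds (P ⨾ Q) ι x → Embeds Q (ι ∘ inj₂) x
    δ-ι (embeds-⨾₂ {P} {Q} emb) q ss with next Q q ss | δ-ι emb (inj₂ q) ss
    ... | just _  , _ | eq = eq
    ... | nothing , _ | eq = eq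
    verdict-ι (embeds-⨾₂ emb) q = verdict-ι emb (inj₂ q)

    embeds-while : ∀ {g P ι x} → Embeds (while g P) ι x → Embeds P (ι ∘ inj₂) (ι (inj₁ unit))
    δ-ι (embeds-while {g} {P} emb) p ss with next P p ss | δ-ι emb (inj₂ p) ss
    ... | just _  , _ | eq = eq
    ... | nothing , _ | eq = eq
    verdict-ι (embeds-while emb) p = verdict-ι emb (inj₂ p)

    simulate : ∀ {P ι x ts n ts′} → Embeds P ι x → P ⊢ ts ⇓[ n ] ts′ →
               run n (config (ι (entry P)) ts) ≡ config x ts′
    simulate emb ⇓-prim = step-ι emb unit _
    simulate {ι = ι} emb (⇓-⨾ {P} {Q} {ts₀} {ts₁} {m = m} {n} P⇓ Q⇓) = begin
      run (m + n) (config (ι (inj₁ (entry P))) ts₀)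
        ≡⟨ run-+ (machine P₀ accept) m n _ ⟩
      run n (run m (config (ι (inj₁ (entry P))) ts₀))
        ≡⟨ cong (run n) (simulate (embeds-⨾₁ emb) P⇓) ⟩
      run n (config (ι (inj₂ (entry Q))) ts₁)
        ≡⟨ simulate (embeds-⨾₂ emb) Q⇓ ⟩
      config _ _ ∎
      where open ≡-Reasoning
    simulate emb (⇓-done {g} {P} {ts} g≡false)
      rewrite step-ι emb (inj₁ unit) ts | g≡false | stay-all ts = refl
    simulate {ι = ι} emb (⇓-loop {g} {P} {ts₀} {ts₁} {m = m} {n} g≡true P⇓ W⇓)
      rewrite step-ι emb (inj₁ unit) ts₀ | g≡true | stay-all ts₀ = begin
      run (m + n) (config (ι (inj₂ (entry P))) ts₀)
        ≡⟨ run-+ (machine P₀ accept) m n _ ⟩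
      run n (run m (config (ι (inj₂ (entry P))) ts₀))
        ≡⟨ cong (run n) (simulate (embeds-while emb) P⇓) ⟩
      run n (config (ι (inj₁ unit)) ts₁)
        ≡⟨ simulate emb W⇓ ⟩
      config _ _ ∎
      where open ≡-Reasoning

    -- The strict inequality pays for the step from `inj₂ nothing` to the verdict; afterwards the
    -- machine has halted and nothing changes.
    run-machine : ∀ {ts n ts′ t} → P₀ ⊢ ts ⇓[ n ] ts′ → n < t →
                  run t (config start ts) ≡ config (inj₂ (just (accept (heads ts′)))) ts′
    run-machine {ts} {n} {ts′} {t} P⇓ n<t = begin
      run t (config start ts)
        ≡⟨ run-stable (machine P₀ accept) {suc n} (config start ts) n<t (_ , cong (verdict ∘ state) end) ⟩
      run (suc n) (config start ts)
        ≡⟨ end ⟩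
      config (inj₂ (just (accept (heads ts′)))) ts′ ∎
      where
      open ≡-Reasoning
      top : Embeds P₀ inj₁ (inj₂ nothing)
      top = record { δ-ι = λ _ _ → refl ; verdict-ι = λ _ → refl }
      last : step (config (inj₂ nothing) ts′) ≡ config (inj₂ (just (accept (heads ts′)))) ts′
      last = cong (config _) (stay-all ts′)
      end : run (suc n) (config start ts) ≡ config (inj₂ (just (accept (heads ts′)))) ts′
      end = begin
        run (suc n) (config start ts)           ≡⟨ cong (λ n → run n (config start ts)) (+-comm 1 n) ⟩
        run (n + 1) (config start ts)           ≡⟨ run-+ (machine P₀ accept) n 1 _ ⟩
        step (run n (config start ts))          ≡⟨ cong step (simulate top P⇓) ⟩
        step (config (inj₂ nothing) ts′)        ≡⟨ last ⟩
        config (inj₂ (just (accept (heads ts′)))) ts′ ∎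

-- Registers

-- Work tapes carry a mark on cell 0; the position of the head is the value
-- of a counter, and a word stored on the tape occupies the cells from 1 on.
cellOf : List Bool → ℕ → Sym
cellOf w zero    = work unit
cellOf w (suc i) = cellAt (map bit w) i

RepTape : List Bool → ℕ → Tape ⊤ → Set
RepTape w v t = ∀ k → look t k v ≡ cellOf w k

Moved : Move → ℕ → ℕ → Set
Moved left  v v′ = v ≡ suc v′
Moved right v v′ = v′ ≡ suc v
Moved stay  v v′ = v′ ≡ v

rep-act : ∀ {w v v′ t} m → Moved m v v′ → RepTape w v t → RepTape w v′ (act (head t , m) t)
rep-act {v′ = v′} {t} left  refl r k = trans (look-left t k v′) (r k)
rep-act {v = v} {t = t} right refl r k = trans (look-right t k v) (r k)
rep-act stay  refl r   = r

-- Registers are numbered by all of ℕ, though only the tapes below `K` exist; addresses such as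
-- `2 + s` then need no bound until they are accessed.
record Store : Set where
  constructor store
  field
    word : ℕ → List Bool
    pos  : ℕ → ℕ
open Store public

infix 4 _≈_
record _≈_ (S S′ : Store) : Set where
  constructor _,_
  field
    word-≈ : ∀ j → word S j ≡ word S′ j
    pos-≈  : ∀ j → pos S j ≡ pos S′ j
open _≈_

≈-refl : ∀ {S} → S ≈ S
≈-refl = (λ _ → refl) , (λ _ → refl)

≈-sym : ∀ {S S′} → S ≈ S′ → S′ ≈ S
≈-sym (p , q) = sym ∘ p , sym ∘ q

≈-trans : ∀ {S S′ S″} → S ≈ S′ → S′ ≈ S″ → S ≈ S″
≈-trans (p , q) (p′ , q′) = (λ j → trans (p j) (p′ j)) , (λ j → trans (q j) (q′ j))

infixl 8 _[_≔_]
_[_≔_] : Store → ℕ → ℕ → Store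
S [ x ≔ v ] = store (word S) (λ j → if j ≡ᵇ x then v else pos S j)

≡ᵇ-refl : ∀ x → (x ≡ᵇ x) ≡ true
≡ᵇ-refl zero    = refl
≡ᵇ-refl (suc x) = ≡ᵇ-refl x

≢⇒≡ᵇ : ∀ {j x} → j ≢ x → (j ≡ᵇ x) ≡ false
≢⇒≡ᵇ {zero}  {zero}  j≢x = contradiction refl j≢x
≢⇒≡ᵇ {zero}  {suc x} j≢x = refl
≢⇒≡ᵇ {suc j} {zero}  j≢x = refl
≢⇒≡ᵇ {suc j} {suc x} j≢x = ≢⇒≡ᵇ (j≢x ∘ cong suc)

≡ᵇ-true : ∀ j x → (j ≡ᵇ x) ≡ true → j ≡ x
≡ᵇ-true j x eq = ≡ᵇ⇒≡ j x (subst Bool.T (sym eq) unit)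

≡ᵇ-false : ∀ {j x} → (j ≡ᵇ x) ≡ false → j ≢ x
≡ᵇ-false {j} eq refl with () ← trans (sym eq) (≡ᵇ-refl j)

pos-≡ : ∀ S x v → pos (S [ x ≔ v ]) x ≡ v
pos-≡ S x v rewrite ≡ᵇ-refl x = refl

pos-≢ : ∀ S {x j} v → j ≢ x → pos (S [ x ≔ v ]) j ≡ pos S j
pos-≢ S v j≢x rewrite ≢⇒≡ᵇ j≢x = refl

≔-cong : ∀ {S S′} x {v v′} → v ≡ v′ → S ≈ S′ → S [ x ≔ v ] ≈ S′ [ x ≔ v′ ]
≔-cong x refl (p , q) = p , λ j → cong (if j ≡ᵇ x then _ else_) (q j)

≔-id : ∀ {S x v} → pos S x ≡ v → S [ x ≔ v ] ≈ S
≔-id {S} {x} eq = (λ _ → refl) , go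
  where
  go : ∀ j → pos (S [ x ≔ _ ]) j ≡ pos S j
  go j with j ≡ᵇ x in j≡x
  ... | true  rewrite ≡ᵇ-true j x j≡x = sym eq
  ... | false = refl

≔-≔ : ∀ S x v v′ → S [ x ≔ v ] [ x ≔ v′ ] ≈ S [ x ≔ v′ ]
≔-≔ S x v v′ = (λ _ → refl) , go
  where
  go : ∀ j → pos (S [ x ≔ v ] [ x ≔ v′ ]) j ≡ pos (S [ x ≔ v′ ]) j
  go j with j ≡ᵇ x
  ... | true  = refl
  ... | false = refl

≔-comm : ∀ S {x y} v v′ → x ≢ y → S [ x ≔ v ] [ y ≔ v′ ] ≈ S [ y ≔ v′ ] [ x ≔ v ]
≔-comm S {x} {y} v v′ x≢y = (λ _ → refl) , go
  where
  go : ∀ j → pos (S [ x ≔ v ] [ y ≔ v′ ]) j ≡ pos (S [ y ≔ v′ ] [ x ≔ v ]) j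
  go j with j ≡ᵇ x in j≡x | j ≡ᵇ y in j≡y
  ... | true  | true  = contradiction (trans (sym (≡ᵇ-true j x j≡x)) (≡ᵇ-true j y j≡y)) x≢y
  ... | true  | false = refl
  ... | false | true  = refl
  ... | false | false = refl

bump : ℕ → ℕ → Store → Store
bump r v S = S [ r ≔ v + pos S r ]

bump-bump : ∀ S r v v′ → bump r v′ (bump r v S) ≈ bump r (v + v′) S
bump-bump S r v v′ = ≈-trans (≔-≔ S r _ _) (≔-cong r eq ≈-refl)
  where
  eq : v′ + pos (bump r v S) r ≡ (v + v′) + pos S r
  eq = trans (cong (v′ +_) (pos-≡ S r _))
       (trans (sym (+-assoc v′ v _)) (cong (_+ pos S r) (+-comm v′ v)))

bump-≔ : ∀ S {r x} v v′ → r ≢ x → bump r v (S [ x ≔ v′ ]) ≈ bump r v S [ x ≔ v′ ]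
bump-≔ S {r} {x} v v′ r≢x = ≈-trans
  (≔-cong r (cong (v +_) (pos-≢ S v′ r≢x)) ≈-refl)
  (≔-comm S v′ (v + pos S r) (r≢x ∘ sym))

isSuc : ℕ → Bool
isSuc zero    = false
isSuc (suc _) = true

notMark isBit isTrue : Sym → Bool
notMark (work _) = false
notMark _        = true
isBit (bit _) = true
isBit _       = false
isTrue (bit true) = true
isTrue _          = false

symAt : ∀ {n} → Vec Sym n → ℕ → Sym
symAt []       _       = □
symAt (x ∷ xs) zero    = x
symAt (x ∷ xs) (suc j) = symAt xs j

symAt-lookup : ∀ {n} (xs : Vec Sym n) i → symAt xs (toℕ i) ≡ lookup xs i
symAt-lookup (x ∷ xs) zero    = refl
symAt-lookup (x ∷ xs) (suc i) = symAt-lookup xs i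

notMark-cellOf : ∀ w v → notMark (cellOf w v) ≡ isSuc v
notMark-cellOf w        zero          = refl
notMark-cellOf []       (suc v)       = refl
notMark-cellOf (_ ∷ w)  (suc zero)    = refl
notMark-cellOf (_ ∷ w)  (suc (suc v)) = notMark-cellOf w (suc v)

-- Here k is the number of bits still ahead; this is the loop guard by which `len` counts up to the
-- first blank.
isBit-cellOf : ∀ w {k v} → k + v ≡ length w → isBit (cellOf w (suc v)) ≡ isSuc k
isBit-cellOf []      {zero} {zero} eq = refl
isBit-cellOf (_ ∷ w) {zero}  {suc v} eq = isBit-cellOf w {zero} (suc-injective eq)
isBit-cellOf (_ ∷ w) {suc k} {zero}  eq = refl
isBit-cellOf (_ ∷ w) {suc k} {suc v} eq =
  isBit-cellOf w {suc k} {v} (suc-injective (trans (cong suc (sym (+-suc k v))) eq))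

-- nth w i is false when i ≥ length w
nth : List Bool → ℕ → Bool
nth []      _       = false
nth (b ∷ w) zero    = b
nth (b ∷ w) (suc i) = nth w i

isTrue-cellOf : ∀ w i → isTrue (cellOf w (suc i)) ≡ nth w i
isTrue-cellOf []          i       = refl
isTrue-cellOf (true ∷ w)  zero    = refl
isTrue-cellOf (false ∷ w) zero    = refl
isTrue-cellOf (_ ∷ w)     (suc i) = isTrue-cellOf w i

lookupMove : List (ℕ × Move) → ℕ → Move
lookupMove []            j = stay
lookupMove ((x , m) ∷ l) j = if j ≡ᵇ x then m else lookupMove l j

record Entry : Set where
  constructor move
  field
    reg     : ℕ
    dir     : Move
    {old new} : ℕ
    moved   : Moved dir old new
open Entry

entryMoves : List Entry → List (ℕ × Move)
entryMoves = map (λ e → reg e , dir e)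

before after : Store → List Entry → Store
before S []      = S
before S (e ∷ l) = before S l [ reg e ≔ old e ]
after  S []      = S
after  S (e ∷ l) = after S l [ reg e ≔ new e ]

moved-entries : ∀ S l j → Moved (lookupMove (entryMoves l) j) (pos (before S l) j) (pos (after S l) j)
moved-entries S []      j = refl
moved-entries S (e ∷ l) j with j ≡ᵇ reg e
... | true  = moved e
... | false = moved-entries S l j

word-entries : ∀ S l j → word (after S l) j ≡ word (before S l) j
word-entries S []      j = refl
word-entries S (e ∷ l) j = word-entries S l j

lookup-act : ∀ {n} (f : Fin n → Sym × Move) ts i →
             lookup (Vec.zipWith act (tabulate f) ts) i ≡ act (f i) (lookup ts i)
lookup-act f ts i = trans (lookup-zipWith act i (tabulate f) ts)
                          (cong (λ a → act a (lookup ts i)) (lookup∘tabulate f i))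

module Execution (extra : ℕ) where
  open Programs extra

  record Rep (S : Store) (ts : Tapes) : Set where
    constructor rep
    field
      tapeRep : ∀ (i : Fin K) → RepTape (word S (toℕ i)) (pos S (toℕ i)) (lookup ts i)
  open Rep

  record Runs (P : Prog) (S : Store) (b : ℕ) (S′ : Store) : Set where
    constructor runs
    field
      execute : ∀ {ts} → Rep S ts → ∃₂ λ n ts′ → n ≤ b × P ⊢ ts ⇓[ n ] ts′ × Rep S′ ts′
  open Runs public

  Rep-resp : ∀ {S S′ ts} → S ≈ S′ → Rep S ts → Rep S′ ts
  Rep-resp (p , q) (rep r) = rep λ i → subst₂ (λ w v → RepTape w v _) (p (toℕ i)) (q (toℕ i)) (r i)

  runs-resp : ∀ {P S₁ S₁′ S₂ S₂′ b} → S₁′ ≈ S₁ → S₂ ≈ S₂′ → Runs P S₁ b S₂ → Runs P S₁′ b S₂′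
  execute (runs-resp eq₁ eq₂ R) r with n , ts′ , n≤b , P⇓ , r′ ← execute R (Rep-resp eq₁ r) =
    n , ts′ , n≤b , P⇓ , Rep-resp eq₂ r′

  runs-weaken : ∀ {P S S′ b c} → b ≤ c → Runs P S b S′ → Runs P S c S′
  execute (runs-weaken b≤c R) r with n , ts′ , n≤b , P⇓ , r′ ← execute R r =
    n , ts′ , ≤-trans n≤b b≤c , P⇓ , r′

  runs-⨾ : ∀ {P Q S₁ S₂ S₃ b c} → Runs P S₁ b S₂ → Runs Q S₂ c S₃ → Runs (P ⨾ Q) S₁ (b + c) S₃
  execute (runs-⨾ R₁ R₂) r
    with n₁ , ts₁ , ≤₁ , P⇓ , r₁ ← execute R₁ r
    with n₂ , ts₂ , ≤₂ , Q⇓ , r₂ ← execute R₂ r₁ =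
    n₁ + n₂ , ts₂ , +-mono-≤ ≤₁ ≤₂ , ⇓-⨾ P⇓ Q⇓ , r₂

  symAt-heads : ∀ {S ts j} → j < K → Rep S ts → symAt (heads ts) j ≡ cellOf (word S j) (pos S j)
  symAt-heads {S} {ts} {j} j<K r = begin
    symAt (heads ts) j                    ≡⟨ cong (symAt (heads ts)) (toℕ-fromℕ< j<K) ⟨
    symAt (heads ts) (toℕ i)              ≡⟨ symAt-lookup (heads ts) i ⟩
    lookup (heads ts) i                   ≡⟨ lookup-map i head ts ⟩
    head (lookup ts i)                    ≡⟨ look-head (lookup ts i) (pos S (toℕ i)) ⟨
    look (lookup ts i) (pos S (toℕ i)) (pos S (toℕ i)) ≡⟨ tapeRep r i (pos S (toℕ i)) ⟩
    cellOf (word S (toℕ i)) (pos S (toℕ i)) ≡⟨ cong (λ j → cellOf (word S j) (pos S j)) (toℕ-fromℕ< j<K) ⟩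
    cellOf (word S j) (pos S j)           ∎
    where
    open ≡-Reasoning
    open import Data.Fin using (fromℕ<)
    open import Data.Fin.Properties using (toℕ-fromℕ<)
    i = fromℕ< j<K

  nonzero : ℕ → Syms → Bool
  nonzero x ss = notMark (symAt ss x)

  nonzero-pos : ∀ {S ts x} → x < K → Rep S ts → nonzero x (heads ts) ≡ isSuc (pos S x)
  nonzero-pos {S} {x = x} x<K r =
    trans (cong notMark (symAt-heads x<K r)) (notMark-cellOf (word S x) (pos S x))

  moves : (Syms → List (ℕ × Move)) → Prog
  moves f = prim (λ ss → tabulate (λ i → lookup ss i , lookupMove (f ss) (toℕ i)))

  runs-moves-if : ∀ {S} f l → (∀ {ts} → Rep (before S l) ts → f (heads ts) ≡ entryMoves l) →
                  Runs (moves f) (before S l) 1 (after S l)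
  execute (runs-moves-if {S} f l f≡) {ts} r = 1 , Vec.zipWith act (tabulate action) ts , ≤-refl , ⇓-prim , rep go
    where
    action : Fin K → Sym × Move
    action i = lookup (heads ts) i , lookupMove (f (heads ts)) (toℕ i)
    action-≡ : ∀ i → action i ≡ (head (lookup ts i) , lookupMove (entryMoves l) (toℕ i))
    action-≡ i = cong₂ _,_ (lookup-map i head ts) (cong (λ l → lookupMove l (toℕ i)) (f≡ r))
    go : ∀ i → RepTape (word (after S l) (toℕ i)) (pos (after S l) (toℕ i))
      (lookup (Vec.zipWith act (tabulate action) ts) i)
    go i = subst₂ (λ w t → RepTape w (pos (after S l) (toℕ i)) t)
      (sym (word-entries S l (toℕ i)))
      (sym (trans (lookup-act action ts i) (cong (λ a → act a (lookup ts i)) (action-≡ i))))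
      (rep-act (lookupMove (entryMoves l) (toℕ i)) (moved-entries S l (toℕ i)) (tapeRep r i))

  runs-moves : ∀ {S} l → Runs (moves (const (entryMoves l))) (before S l) 1 (after S l)
  runs-moves l = runs-moves-if _ l (λ _ → refl)

  -- J k l is the store with k iterations left and l done.
  runs-while : ∀ {g P b} (J : ℕ → ℕ → Store) n →
    (∀ k l → k + l ≡ n → ∀ {ts} → Rep (J k l) ts → g (heads ts) ≡ isSuc k) →
    (∀ k l → suc k + l ≡ n → Runs P (J (suc k) l) b (J k (suc l))) →
    Runs (while g P) (J n 0) (suc (n * suc b)) (J 0 n)
  runs-while {g} {P} {b} J n guard body = runs (go n 0 (+-identityʳ n))
    where
    go : ∀ k l → k + l ≡ n → ∀ {ts} → Rep (J k l) ts →
         ∃₂ λ m ts′ → m ≤ suc (k * suc b) × while g P ⊢ ts ⇓[ m ] ts′ × Rep (J 0 n) ts′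
    go zero    l refl r = 1 , _ , s≤s z≤n , ⇓-done (guard 0 l refl r) , r
    go (suc k) l eq   r
      with n₁ , ts₁ , ≤₁ , P⇓ , r₁ ← execute (body k l eq) r
      with n₂ , ts₂ , ≤₂ , W⇓ , r₂ ← go k (suc l) (trans (+-suc k l) eq) r₁ =
      suc (n₁ + n₂) , ts₂ ,
      s≤s (≤-trans (+-mono-≤ ≤₁ ≤₂) (≤-reflexive (+-suc b (k * suc b)))) ,
      ⇓-loop (guard (suc k) l eq r) P⇓ W⇓ , r₂

  inc : ℕ → Prog
  inc x = moves (const ((x , right) ∷ []))

  clear : ℕ → Prog
  clear x = while (nonzero x) (moves (const ((x , left) ∷ [])))

  runs-clear : ∀ S x v → x < K → Runs (clear x) (S [ x ≔ v ]) (suc (v * 2)) (S [ x ≔ 0 ])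
  runs-clear S x v x<K = runs-while (λ k _ → S [ x ≔ k ]) v
    (λ k _ _ r → trans (nonzero-pos x<K r) (cong isSuc (pos-≡ S x k)))
    (λ k _ _ → runs-moves (move x left refl ∷ []))

  -- Register s holds the number of iterations left, register suc s the number done.
  iterate : ℕ → Prog → Prog
  iterate s P = while (nonzero s) (P ⨾ moves (const ((s , left) ∷ (suc s , right) ∷ []))) ⨾ clear (suc s)

  -- `T l` is the store after l rounds with the two loop registers left out of account; the body
  -- must preserve whatever these contain. The equations on `T 0` and `T n` say that they are free
  -- at both ends.
  runs-iterate : ∀ {s P b} n (T : ℕ → Store) → suc s < K →
    pos (T 0) (suc s) ≡ 0 → pos (T n) s ≡ 0 → pos (T n) (suc s) ≡ 0 →
    (∀ l → l < n → ∀ k → Runs P (T l [ suc s ≔ l ] [ s ≔ k ]) b (T (suc l) [ suc s ≔ l ] [ s ≔ k ])) →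
    Runs (iterate s P) (T 0 [ s ≔ n ]) (suc (n * suc (b + 1)) + suc (n * 2)) (T n)
  runs-iterate {s} {P} {b} n T s<K T₀ Tₙ Tₙ′ body = runs-⨾ loop (runs-resp ≈-refl final (runs-clear _ (suc s) n s<K))
    where
    J : ℕ → ℕ → Store
    J k l = T l [ suc s ≔ l ] [ s ≔ k ]
    loop : Runs _ (T 0 [ s ≔ n ]) _ (T n [ s ≔ 0 ] [ suc s ≔ n ])
    loop = runs-resp (≔-cong s refl (≈-sym (≔-id T₀))) (≔-comm _ _ _ (λ ())) (runs-while J n
      (λ k l _ r → trans (nonzero-pos (<-trans (n<1+n s) s<K) r) (cong isSuc (pos-≡ (T l [ suc s ≔ l ]) s k)))
      (λ k l k+l≡n → runs-⨾ (body l (≤-trans (s≤s (m≤n+m l k)) (≤-reflexive k+l≡n)) (suc k))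
                        (runs-moves (move s left refl ∷ move (suc s) right refl ∷ []))))
    final : T n [ s ≔ 0 ] [ suc s ≔ 0 ] ≈ T n
    final = ≈-trans (≔-id (trans (pos-≢ (T n) {s} {suc s} 0 (λ ())) Tₙ′)) (≔-id Tₙ)

-- Compilation of terms to register programs

-- Arithmetic terms with d variables over m input words.
data Exp (m : ℕ) : ℕ → Set where
  var       : ∀ {d} → Fin d → Exp m d
  lit       : ∀ {d} → ℕ → Exp m d
  _∔_ _∙_ _∸̇_ : ∀ {d} → Exp m d → Exp m d → Exp m d
  sum       : ∀ {d} → Exp m d → Exp m (suc d) → Exp m d
  bitAt     : ∀ {d} → Fin m → Exp m d → Exp m d
  len       : ∀ {d} → Fin m → Exp m d
  wk        : ∀ {d} → Exp m d → Exp m (suc d)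

infixl 6 _∔_ _∸̇_
infixl 7 _∙_

Σ< : ℕ → (ℕ → ℕ) → ℕ
Σ< zero    f = 0
Σ< (suc n) f = Σ< n f + f n

bool→ℕ : Bool → ℕ
bool→ℕ false = 0
bool→ℕ true  = 1

eval : ∀ {m d} → (Fin m → List Bool) → Exp m d → Vec ℕ d → ℕ
eval ws (var i)     ρ       = lookup ρ i
eval ws (lit n)     ρ       = n
eval ws (a ∔ b)     ρ       = eval ws a ρ + eval ws b ρ
eval ws (a ∙ b)     ρ       = eval ws a ρ * eval ws b ρ
eval ws (a ∸̇ b)     ρ       = eval ws a ρ ∸ eval ws b ρ
eval ws (sum a b)   ρ       = Σ< (eval ws a ρ) (λ i → eval ws b (i ∷ ρ))
eval ws (bitAt j a) ρ       = bool→ℕ (nth (ws j) (eval ws a ρ))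
eval ws (len j)     ρ       = length (ws j)
-- Weakening is a constructor, evaluated by dropping the innermost variable; this replaces a
-- renaming function and its correctness proof.
eval ws (wk a)      (i ∷ ρ) = eval ws a ρ

Σ<-cong : ∀ n {f g} → (∀ i → f i ≡ g i) → Σ< n f ≡ Σ< n g
Σ<-cong zero    f≡g = refl
Σ<-cong (suc n) f≡g = cong₂ _+_ (Σ<-cong n f≡g) (f≡g n)

Σ<-const : ∀ n c → Σ< n (λ _ → c) ≡ n * c
Σ<-const zero    c = refl
Σ<-const (suc n) c = trans (cong (_+ c) (Σ<-const n c)) (+-comm (n * c) c)

Σ<-≤ : ∀ n {f b} → (∀ i → i < n → f i ≤ b) → Σ< n f ≤ n * b
Σ<-≤ zero            f≤b = z≤n
Σ<-≤ (suc n) {f} {b} f≤b = ≤-trans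
  (+-mono-≤ (Σ<-≤ n (λ i i<n → f≤b i (m<n⇒m<1+n i<n))) (f≤b n (n<1+n n)))
  (≤-reflexive (+-comm (n * b) b))

-- B bounds all variables and all word lengths. The index of a `sum` may come close to `bound a B`,
-- hence the enlarged argument under the binder. Nesting thus composes polynomials, to a depth that
-- the term fixes.
bound : ∀ {m d} → Exp m d → ℕ → ℕ
bound (var i)     B = B
bound (lit n)     B = n
bound (a ∔ b)     B = bound a B + bound b B
bound (a ∙ b)     B = bound a B * bound b B
bound (a ∸̇ b)     B = bound a B
bound (sum a b)   B = bound a B * bound b (B + bound a B)
bound (bitAt j a) B = 1
bound (len j)     B = B
bound (wk a)      B = bound a B

bound-poly : ∀ {m d} (a : Exp m d) → IsPoly (bound a)
bound-poly (var i)     = poly-id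
bound-poly (lit n)     = poly-const n
bound-poly (a ∔ b)     = poly-+ (bound-poly a) (bound-poly b)
bound-poly (a ∙ b)     = poly-* (bound-poly a) (bound-poly b)
bound-poly (a ∸̇ b)     = bound-poly a
bound-poly (sum a b)   = poly-* (bound-poly a) (poly-∘ (bound-poly b) (poly-+ poly-id (bound-poly a)))
bound-poly (bitAt j a) = poly-const 1
bound-poly (len j)     = poly-id
bound-poly (wk a)      = bound-poly a

record Bounded {m d} (ws : Fin m → List Bool) (ρ : Vec ℕ d) (B : ℕ) : Set where
  constructor bounded
  field
    var-≤ : ∀ i → lookup ρ i ≤ B
    len-≤ : ∀ j → length (ws j) ≤ B
open Bounded

bounded-wk : ∀ {m d} {ws : Fin m → List Bool} {ρ : Vec ℕ d} {i B} → Bounded ws (i ∷ ρ) B → Bounded ws ρ B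
bounded-wk (bounded v l) = bounded (v ∘ suc) l

bounded-∷ : ∀ {m d} {ws : Fin m → List Bool} {ρ : Vec ℕ d} {i B n} →
            Bounded ws ρ B → i < n → Bounded ws (i ∷ ρ) (B + n)
bounded-∷ {B = B} {n} (bounded v l) i<n = bounded
  (λ { zero → ≤-trans (<⇒≤ i<n) (m≤n+m n B) ; (suc i) → ≤-trans (v i) (m≤m+n B n) })
  (λ j → ≤-trans (l j) (m≤m+n B n))

eval-≤ : ∀ {m d} {ws : Fin m → List Bool} (a : Exp m d) {ρ B} → Bounded ws ρ B → eval ws a ρ ≤ bound a B
eval-≤ (var i)     b = var-≤ b i
eval-≤ (lit n)     b = ≤-refl
eval-≤ (a ∔ a′)    b = +-mono-≤ (eval-≤ a b) (eval-≤ a′ b)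
eval-≤ (a ∙ a′)    b = *-mono-≤ (eval-≤ a b) (eval-≤ a′ b)
eval-≤ {ws = ws} (a ∸̇ a′) {ρ} b = ≤-trans (m∸n≤m (eval ws a ρ) (eval ws a′ ρ)) (eval-≤ a b)
eval-≤ (sum a a′)  b = ≤-trans
  (Σ<-≤ _ (λ i i<n → eval-≤ a′ (bounded-∷ b (≤-trans i<n (eval-≤ a b)))))
  (*-monoˡ-≤ _ (eval-≤ a b))
eval-≤ {ws = ws} (bitAt j a) {ρ} b with nth (ws j) (eval ws a ρ)
... | false = z≤n
... | true  = ≤-refl
eval-≤ (len j)     b = len-≤ b j
eval-≤ (wk a) {i ∷ ρ} b = eval-≤ a (bounded-wk b)

-- The number of scratch tapes needed.
height : ∀ {m d} → Exp m d → ℕ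
height (var i)     = 1
height (lit n)     = 0
height (a ∔ b)     = height a + height b
height (a ∙ b)     = 2 + (height a + height b)
height (a ∸̇ b)     = 2 + (height a + height b)
height (sum a b)   = 2 + (height a + height b)
height (bitAt j a) = 1 + height a
height (len j)     = 0
height (wk a)      = height a

cost : ∀ {m d} → Exp m d → ℕ → ℕ
cost (var i)     B = suc (B * 2) + suc (B * 2)
cost (lit n)     B = suc n
cost (a ∔ b)     B = cost a B + cost b B
cost (a ∙ b)     B = cost a B + (suc (bound a B * suc (cost b B + 1)) + suc (bound a B * 2))
cost (a ∸̇ b)     B = cost a B + (cost b B + (suc (bound b B * 2) + suc (bound a B * 2)))
cost (sum a b)   B = cost a B + (suc (bound a B * suc (cost b (B + bound a B) + 1)) + suc (bound a B * 2))
cost (bitAt j a) B = cost a B + (1 + (suc (bound a B * 2) + (1 + suc (suc (bound a B) * 2))))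
cost (len j)     B = 1 + (suc (B * 2) + suc (suc B * 2))
cost (wk a)      B = cost a B


cost-poly : ∀ {m d} (a : Exp m d) → IsPoly (cost a)
cost-poly (var i)     = poly-+ 1+2n 1+2n
  where 1+2n = poly-+ (poly-const 1) (poly-* poly-id (poly-const 2))
cost-poly (lit n)     = poly-const (suc n)
cost-poly (a ∔ b)     = poly-+ (cost-poly a) (cost-poly b)
cost-poly (a ∙ b)     = poly-+ (cost-poly a) (poly-+
  (poly-+ (poly-const 1) (poly-* (bound-poly a) (poly-+ (poly-const 1) (poly-+ (cost-poly b) (poly-const 1)))))
  (poly-+ (poly-const 1) (poly-* (bound-poly a) (poly-const 2))))
cost-poly (a ∸̇ b)     = poly-+ (cost-poly a) (poly-+ (cost-poly b) (poly-+
  (poly-+ (poly-const 1) (poly-* (bound-poly b) (poly-const 2)))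
  (poly-+ (poly-const 1) (poly-* (bound-poly a) (poly-const 2)))))
cost-poly (sum a b)   = poly-+ (cost-poly a) (poly-+
  (poly-+ (poly-const 1) (poly-* (bound-poly a) (poly-+ (poly-const 1)
    (poly-+ (poly-∘ (cost-poly b) (poly-+ poly-id (bound-poly a))) (poly-const 1)))))
  (poly-+ (poly-const 1) (poly-* (bound-poly a) (poly-const 2))))
cost-poly (bitAt j a) = poly-+ (cost-poly a) (poly-+ (poly-const 1) (poly-+
  (poly-+ (poly-const 1) (poly-* (bound-poly a) (poly-const 2)))
  (poly-+ (poly-const 1) (poly-+ (poly-const 1) (poly-* (poly-+ (poly-const 1) (bound-poly a)) (poly-const 2))))))
cost-poly (len j)     = poly-+ (poly-const 1) (poly-+
  (poly-+ (poly-const 1) (poly-* poly-id (poly-const 2)))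
  (poly-+ (poly-const 1) (poly-* (poly-+ (poly-const 1) poly-id) (poly-const 2))))
cost-poly (wk a)      = cost-poly a

module Compilation (extra : ℕ) where
  open Programs extra
  open Execution extra

  incs : ℕ → ℕ → Prog
  incs r zero    = moves (const [])
  incs r (suc n) = incs r n ⨾ inc r

  transfer : ℕ → ℕ → Prog
  transfer x y = while (nonzero x) (moves (const ((x , left) ∷ (y , right) ∷ [])))

  -- compile a regs s r adds the value of a to register r, with variable i in
  -- register lookup regs i and all registers from s on free.
  compile : ∀ {m d} → Exp m d → Vec ℕ d → ℕ → ℕ → Prog
  compile (var i)     regs s r =
    transfer x s ⨾ while (nonzero s) (moves (const ((s , left) ∷ (x , right) ∷ (r , right) ∷ [])))
    where x = lookup regs i
  compile (lit n)     regs s r = incs r n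
  compile (a ∔ b)     regs s r = compile a regs s r ⨾ compile b regs s r
  compile (a ∙ b)     regs s r = compile a regs (2 + s) s ⨾ iterate s (compile b regs (2 + s) r)
  compile (a ∸̇ b)     regs s r =
    compile a regs (2 + s) s ⨾ compile b regs (2 + s) (suc s) ⨾
    while (nonzero (suc s)) (moves λ ss →
      (suc s , left) ∷ (s , (if nonzero s ss then left else stay)) ∷ []) ⨾
    transfer s r
  compile (sum a b)   regs s r = compile a regs (2 + s) s ⨾ iterate s (compile b (suc s ∷ regs) (2 + s) r)
  compile (bitAt j a) regs s r =
    compile a regs (suc s) s ⨾ inc t ⨾ transfer s t ⨾
    moves (λ ss → (r , (if isTrue (symAt ss t) then right else stay)) ∷ []) ⨾ clear t
    where t = toℕ j
  compile (len j)     regs s r =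
    inc t ⨾ while (λ ss → isBit (symAt ss t)) (moves (const ((t , right) ∷ (r , right) ∷ []))) ⨾ clear t
    where t = toℕ j
  compile (wk a)      (_ ∷ regs) s r = compile a regs s r

  record Ready {m d} (ws : Fin m → List Bool) (ρ regs : Vec ℕ d) (s : ℕ) (S : Store) : Set where
    field
      vars  : ∀ i → pos S (lookup regs i) ≡ lookup ρ i
      low   : ∀ i → lookup regs i < s
      free  : ∀ j → s ≤ j → pos S j ≡ 0
      input : ∀ (j : Fin m) → word S (toℕ j) ≡ ws j
      home  : ∀ (j : Fin m) → pos S (toℕ j) ≡ 0
      m≤s   : m ≤ s
  open Ready

  record Target {d} (m : ℕ) (regs : Vec ℕ d) (s r : ℕ) : Set where
    field
      r<s    : r < s
      r≢var  : ∀ i → lookup regs i ≢ r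
      m≤r    : m ≤ r
  open Target

  j≢ : ∀ {m x} (j : Fin m) → m ≤ x → toℕ j ≢ x
  j≢ j m≤x refl = <⇒≱ (toℕ<n j) m≤x

  ready-≔ : ∀ {m d ws} {ρ regs : Vec ℕ d} {s S} x {v} → m ≤ x → x < s → (∀ i → lookup regs i ≢ x) →
            Ready {m} ws ρ regs s S → Ready ws ρ regs s (S [ x ≔ v ])
  ready-≔ {S = S} x {v} m≤x x<s fresh R = record
    { vars  = λ i → trans (pos-≢ S v (fresh i)) (vars R i)
    ; low   = low R
    ; free  = λ j s≤j → trans (pos-≢ S v (λ { refl → <⇒≱ x<s s≤j })) (free R j s≤j)
    ; input = input R
    ; home  = λ j → trans (pos-≢ S v (j≢ j m≤x)) (home R j)
    ; m≤s   = m≤s R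
    }

  ready-≤ : ∀ {m d ws} {ρ regs : Vec ℕ d} {s s′ S} → s ≤ s′ → Ready {m} ws ρ regs s S → Ready ws ρ regs s′ S
  ready-≤ s≤s′ R = record
    { vars  = vars R
    ; low   = λ i → ≤-trans (low R i) s≤s′
    ; free  = λ j s′≤j → free R j (≤-trans s≤s′ s′≤j)
    ; input = input R
    ; home  = home R
    ; m≤s   = ≤-trans (m≤s R) s≤s′
    }

  ready-∷ : ∀ {m d ws} {ρ regs : Vec ℕ d} {s S x v} → pos S x ≡ v → x < s →
            Ready {m} ws ρ regs s S → Ready ws (v ∷ ρ) (x ∷ regs) s S
  ready-∷ eq x<s R = record
    { vars  = λ { zero → eq ; (suc i) → vars R i }
    ; low   = λ { zero → x<s ; (suc i) → low R i }
    ; free  = free R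
    ; input = input R
    ; home  = home R
    ; m≤s   = m≤s R
    }

  ready-wk : ∀ {m d ws} {ρ regs : Vec ℕ d} {s S x v} →
             Ready {m} ws (v ∷ ρ) (x ∷ regs) s S → Ready ws ρ regs s S
  ready-wk R = record
    { vars = vars R ∘ suc ; low = low R ∘ suc ; free = free R ; input = input R ; home = home R ; m≤s = m≤s R }

  ready-bump : ∀ {m d ws} {ρ regs : Vec ℕ d} {s r S v} → Target m regs s r →
               Ready {m} ws ρ regs s S → Ready ws ρ regs s (bump r v S)
  ready-bump T = ready-≔ _ (m≤r T) (r<s T) (r≢var T)

  target-∷ : ∀ {m d} {regs : Vec ℕ d} {s r x} → x ≢ r → Target m regs s r → Target m (x ∷ regs) s r
  target-∷ x≢r T = record { r<s = r<s T ; r≢var = λ { zero → x≢r ; (suc i) → r≢var T i } ; m≤r = m≤r T }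

  target-wk : ∀ {m d} {regs : Vec ℕ d} {s r x} → Target m (x ∷ regs) s r → Target m regs s r
  target-wk T = record { r<s = r<s T ; r≢var = r≢var T ∘ suc ; m≤r = m≤r T }

  target-≤ : ∀ {m d} {regs : Vec ℕ d} {s s′ r} → s ≤ s′ → Target m regs s r → Target m regs s′ r
  target-≤ s≤s′ T = record { r<s = ≤-trans (r<s T) s≤s′ ; r≢var = r≢var T ; m≤r = m≤r T }

  target-scratch : ∀ {m d ws} {ρ regs : Vec ℕ d} {s S x s′} → s ≤ x → x < s′ →
                   Ready {m} ws ρ regs s S → Target m regs s′ x
  target-scratch s≤x x<s′ R = record
    { r<s   = x<s′
    ; r≢var = λ i → λ { refl → <⇒≱ (low R i) s≤x }
    ; m≤r   = ≤-trans (m≤s R) s≤x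
    }

  runs-incs : ∀ r n S → Runs (incs r n) S (suc n) (bump r n S)
  runs-incs r zero    S = runs-resp ≈-refl (≈-sym (≔-id refl)) (runs-moves [])
  runs-incs r (suc n) S = runs-weaken (≤-reflexive (+-comm (suc n) 1))
    (runs-⨾ (runs-incs r n S) (runs-resp (≈-refl) (≔-≔ S r _ _)
      (runs-resp (≈-sym (≈-trans (≔-≔ S r _ _) ≈-refl)) ≈-refl
        (runs-moves {S [ r ≔ n + pos S r ]} (move r right refl ∷ [])))))

  runs-transfer : ∀ S x y n v → x < K → x ≢ y →
                  Runs (transfer x y) (S [ y ≔ v ] [ x ≔ n ]) (suc (n * 2)) (S [ y ≔ n + v ] [ x ≔ 0 ])
  runs-transfer S x y n v x<K x≢y = runs-while (λ k l → S [ y ≔ l + v ] [ x ≔ k ]) n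
    (λ k l _ r → trans (nonzero-pos x<K r) (cong isSuc (pos-≡ (S [ y ≔ l + v ]) x k)))
    (λ k l _ → runs-moves (move x left refl ∷ move y right refl ∷ []))

  -- All registers other than r end as they began, scratch included; this makes compiled terms
  -- usable one after the other and as loop bodies.
  Correct : ∀ {m d} → (Fin m → List Bool) → Exp m d → Set
  Correct {m} {d} ws a = ∀ {ρ regs s r S B} →
    Ready ws ρ regs s S → Target m regs s r → s + height a ≤ K → Bounded ws ρ B →
    Runs (compile a regs s r) S (cost a B) (bump r (eval ws a ρ) S)

  module _ {m} (ws : Fin m → List Bool) where

    -- A counter can be read only by emptying it. The value goes to the scratch register first, and
    -- from there to its own register and to r simultaneously.
    correct-var : ∀ {d} (i : Fin d) → Correct ws (var i)
    correct-var i {ρ} {regs} {s} {r} {S} {B} R T s≤K b =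
      runs-weaken (+-mono-≤ x≤B x≤B) (runs-resp eq₁ eq₃ (runs-⨾ loop₁ loop₂))
      where
      x = lookup regs i
      n = pos S x
      x≤B : suc (n * 2) ≤ suc (B * 2)
      x≤B = s≤s (*-monoˡ-≤ 2 (≤-trans (≤-reflexive (vars R i)) (var-≤ b i)))
      s<K : s < K
      s<K = ≤-trans (≤-reflexive (+-comm 1 s)) s≤K
      x≢s : x ≢ s
      x≢s = <⇒≢ (low R i)
      r≢s : r ≢ s
      r≢s = <⇒≢ (r<s T)
      J₂ : ℕ → ℕ → Store
      J₂ k l = S [ r ≔ l + pos S r ] [ x ≔ l ] [ s ≔ k ]
      loop₁ = runs-transfer S x s n 0 (<-trans (low R i) s<K) x≢s
      eq₁ : S ≈ S [ s ≔ 0 ] [ x ≔ n ]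
      eq₁ = ≈-sym (≈-trans (≔-id (pos-≢ S 0 x≢s)) (≔-id (free R s ≤-refl)))
      eq₂ : S [ s ≔ n + 0 ] [ x ≔ 0 ] ≈ J₂ n 0
      eq₂ = ≈-trans (≔-comm S _ _ (x≢s ∘ sym)) (≔-cong s (+-identityʳ n) (≔-cong x refl (≈-sym (≔-id refl))))
      loop₂ = runs-resp {S₁ = J₂ n 0} eq₂ ≈-refl (runs-while J₂ n
        (λ k l _ rp → trans (nonzero-pos s<K rp) (cong isSuc (pos-≡ (S [ r ≔ l + pos S r ] [ x ≔ l ]) s k)))
        (λ k l _ → runs-moves (move s left refl ∷ move x right refl ∷ move r right refl ∷ [])))
      eq₃ : J₂ 0 n ≈ bump r (lookup ρ i) S
      eq₃ = ≈-trans (≔-id (trans (pos-≢ (S [ r ≔ n + pos S r ]) n (x≢s ∘ sym))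
        (trans (pos-≢ S (n + pos S r) (r≢s ∘ sym)) (free R s ≤-refl))))
            (≈-trans (≔-id (pos-≢ S _ (r≢var T i))) (≔-cong r (cong (_+ pos S r) (vars R i)) ≈-refl))

    -- Serves `sum` and `∙` alike, a product being a sum with constant summand.
    correct-sum : ∀ {d a} {P : Prog} {f : ℕ → ℕ} {ρ regs : Vec ℕ d} {s r S B c} → Correct {m} {d} ws a →
      Ready ws ρ regs s S → Target m regs s r → 2 + s + height a ≤ K → Bounded ws ρ B →
      (∀ l → l < eval ws a ρ → ∀ {S′} → Ready ws (l ∷ ρ) (suc s ∷ regs) (2 + s) S′ → Runs P S′ c (bump r (f l) S′)) →
      Runs (compile a regs (2 + s) s ⨾ iterate s P) S
           (cost a B + (suc (bound a B * suc (c + 1)) + suc (bound a B * 2)))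
           (bump r (Σ< (eval ws a ρ) f) S)
    correct-sum {a = a} {P} {f} {ρ} {regs} {s} {r} {S} {B} {c} correct-a R T s≤K b body =
      runs-⨾ (correct-a (ready-≤ (m≤n+m s 2) R) (target-scratch ≤-refl (m<n+m s (s≤s z≤n)) R) s≤K b)
             (runs-weaken (+-mono-≤ (s≤s (*-monoˡ-≤ _ (eval-≤ a b))) (s≤s (*-monoˡ-≤ _ (eval-≤ a b))))
               (runs-resp eq₀ ≈-refl loop))
      where
      n = eval ws a ρ
      r≢s : r ≢ s
      r≢s = <⇒≢ (r<s T)
      r≢s′ : r ≢ suc s
      r≢s′ = <⇒≢ (m<n⇒m<1+n (r<s T))
      St : ℕ → Store
      St l = bump r (Σ< l f) S
      eq₀ : bump s n S ≈ St 0 [ s ≔ n ]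
      eq₀ = ≔-cong s (trans (cong (n +_) (free R s ≤-refl)) (+-identityʳ n)) (≈-sym (≔-id refl))
      St-zero : ∀ l j → s ≤ j → pos (St l) j ≡ 0
      St-zero l j s≤j = free (ready-bump T R) j s≤j
      step : ∀ l → l < n → ∀ k → Runs P (St l [ suc s ≔ l ] [ s ≔ k ]) c (St (suc l) [ suc s ≔ l ] [ s ≔ k ])
      step l l<n k = runs-resp ≈-refl
        (≈-trans (bump-≔ _ _ _ r≢s) (≔-cong s refl
          (≈-trans (bump-≔ _ _ _ r≢s′) (≔-cong (suc s) refl (bump-bump S r _ _)))))
        (body l l<n (ready-∷ {v = l} (trans (pos-≢ (St l [ suc s ≔ l ]) {s} {suc s} k (λ ()))
          (pos-≡ (St l) (suc s) l)) ≤-refl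
          (ready-≔ s (m≤s R) (m<n+m s (s≤s z≤n)) (λ i → <⇒≢ (low R i))
            (ready-≔ (suc s) (m≤n⇒m≤1+n (m≤s R)) ≤-refl (λ i → <⇒≢ (m<n⇒m<1+n (low R i)))
              (ready-≤ (m≤n+m s 2) (ready-bump T R))))))
      loop = runs-iterate {s} {P} {c} n St (≤-trans (m≤m+n (2 + s) (height a)) s≤K)
        (St-zero 0 (suc s) (n≤1+n s)) (St-zero n s ≤-refl) (St-zero n (suc s) (n≤1+n s)) step

    -- Each unit of the subtrahend lowers the minuend unless that is zero already, where its head
    -- stays; this is the truncation of `∸`.
    correct-∸ : ∀ {d} {a b : Exp m d} → Correct ws a → Correct ws b → Correct ws (a ∸̇ b)
    correct-∸ {d} {a} {b} correct-a correct-b {ρ} {regs} {s} {r} {S} {B} R T s≤K bd =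
      runs-⨾ (correct-a R₂ (target-scratch ≤-refl s<s+2 R) (≤-trans (+-monoʳ-≤ (2 + s) (m≤m+n (height a) _)) K₂) bd)
      (runs-⨾ (runs-resp eq₁ ≈-refl
        (correct-b (ready-≔ s (m≤s R) s<s+2 (λ i → <⇒≢ (low R i)) R₂)
          (target-scratch (n≤1+n s) ≤-refl R) (≤-trans (+-monoʳ-≤ (2 + s) (m≤n+m (height b) _)) K₂) bd))
      (runs-weaken (+-mono-≤ (s≤s (*-monoˡ-≤ 2 (eval-≤ b bd)))
        (s≤s (*-monoˡ-≤ 2 (≤-trans (m∸n≤m x y) (eval-≤ a bd)))))
      (runs-⨾ (runs-resp eq₂ ≈-refl loop)
        (runs-resp eq₃ eq₄ (runs-transfer (S [ suc s ≔ 0 ]) s r (x ∸ y) (pos S r) s<K s≢r)))))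
      where
      x = eval ws a ρ
      y = eval ws b ρ
      s<s+2 : s < 2 + s
      s<s+2 = m<n+m s (s≤s z≤n)
      R₂ = ready-≤ (m≤n+m s 2) R
      K₂ : 2 + s + (height a + height b) ≤ K
      K₂ = ≤-trans (≤-reflexive (trans (sym (+-suc (suc s) _)) (sym (+-suc s _)))) s≤K
      s′<K : suc s < K
      s′<K = ≤-trans (m≤m+n (2 + s) _) K₂
      s<K : s < K
      s<K = <-trans (n<1+n s) s′<K
      s≢r : s ≢ r
      s≢r eq = <⇒≢ (r<s T) (sym eq)
      J : ℕ → ℕ → Store
      J k l = S [ s ≔ x ∸ l ] [ suc s ≔ k ]
      eq₁ : bump s x S ≈ S [ s ≔ x ]
      eq₁ = ≔-cong s (trans (cong (x +_) (free R s ≤-refl)) (+-identityʳ x)) ≈-refl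
      eq₂ : bump (suc s) y (S [ s ≔ x ]) ≈ J y 0
      eq₂ = ≔-cong (suc s) (trans (cong (y +_) (trans (pos-≢ S {s} {suc s} x (λ ())) (free R (suc s) (n≤1+n s))))
        (+-identityʳ y)) ≈-refl
      pred-moved : ∀ l → Moved (if isSuc (x ∸ l) then left else stay) (x ∸ l) (x ∸ suc l)
      pred-moved l rewrite sym (pred[m∸n]≡m∸[1+n] x l) with x ∸ l
      ... | zero  = refl
      ... | suc _ = refl
      pos-s : ∀ k l → pos (J k l) s ≡ x ∸ l
      pos-s k l = trans (pos-≢ (S [ s ≔ x ∸ l ]) {suc s} {s} k (λ ())) (pos-≡ S s (x ∸ l))
      loop = runs-while J y
        (λ k l _ r → trans (nonzero-pos s′<K r) (cong isSuc (pos-≡ (S [ s ≔ x ∸ l ]) (suc s) k)))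
        (λ k l _ → runs-moves-if _ (move (suc s) left refl ∷ move s
          (if isSuc (x ∸ l) then left else stay) {x ∸ l} {x ∸ suc l} (pred-moved l) ∷ [])
          (λ r → cong (λ b → (suc s , left) ∷ (s , (if b then left else stay)) ∷ [])
                   (trans (nonzero-pos s<K r) (cong isSuc (pos-s (suc k) l)))))
      eq₃ : J 0 y ≈ S [ suc s ≔ 0 ] [ r ≔ pos S r ] [ s ≔ x ∸ y ]
      eq₃ = ≈-trans (≔-comm S _ _ (λ ())) (≔-cong s refl (≈-sym (≔-id (pos-≢ S 0 (<⇒≢ (m<n⇒m<1+n (r<s T)))))))
      zero-ss : S [ suc s ≔ 0 ] ≈ S
      zero-ss = ≔-id (free R (suc s) (n≤1+n s))
      eq₄ : S [ suc s ≔ 0 ] [ r ≔ x ∸ y + pos S r ] [ s ≔ 0 ] ≈ bump r (x ∸ y) S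
      eq₄ = ≈-trans (≔-cong s refl (≔-cong r refl zero-ss)) (≔-id (trans (pos-≢ S _ s≢r) (free R s ≤-refl)))

    -- Bit v lies on cell v + 1, behind the mark, so the input head makes one step before v is
    -- transferred to it. Once the bit has been tested, the head walks back to the mark.
    correct-bit : ∀ {d} {a : Exp m d} (j : Fin m) → Correct ws a → Correct ws (bitAt j a)
    correct-bit {a = a} j correct-a {ρ} {regs} {s} {r} {S} {B} R T s≤K bd =
      runs-⨾ (correct-a (ready-≤ (n≤1+n s) R) (target-scratch ≤-refl ≤-refl R) s′≤K bd)
      (runs-⨾ (runs-resp eq₁ ≈-refl (runs-moves {S [ s ≔ v ]} (move t right {0} refl ∷ [])))
      (runs-weaken (+-mono-≤ {suc (v * 2)} (s≤s (*-monoˡ-≤ 2 v≤)) (+-monoʳ-≤ 1 (s≤s (*-monoˡ-≤ 2 (s≤s v≤)))))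
      (runs-⨾ (runs-resp eq₂ ≈-refl (runs-transfer S s t v 1 s<K s≢t))
      (runs-⨾ (runs-resp eq₃ ≈-refl test) (runs-resp eq₄ eq₅ (runs-clear (bump r (bool→ℕ β) S) t (suc v) t<K))))))
      where
      t = toℕ j
      v = eval ws a ρ
      β = nth (ws j) v
      v≤ : v ≤ bound a B
      v≤ = eval-≤ a bd
      s′≤K : suc s + height a ≤ K
      s′≤K = ≤-trans (≤-reflexive (sym (+-suc s _))) s≤K
      s<K : s < K
      s<K = ≤-trans (m≤m+n (suc s) _) s′≤K
      t<s : t < s
      t<s = ≤-trans (toℕ<n j) (m≤s R)
      t<K : t < K
      t<K = <-trans t<s s<K
      s≢t : s ≢ t
      s≢t eq = <⇒≢ t<s (sym eq)
      t≢r : t ≢ r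
      t≢r = j≢ j (m≤r T)
      s≢r : s ≢ r
      s≢r eq = <⇒≢ (r<s T) (sym eq)
      eq₁ : bump s v S ≈ S [ s ≔ v ] [ t ≔ 0 ]
      eq₁ = ≈-trans (≔-cong s (trans (cong (v +_) (free R s ≤-refl)) (+-identityʳ v)) ≈-refl)
            (≈-sym (≔-id (trans (pos-≢ S v (s≢t ∘ sym)) (home R j))))
      eq₂ : S [ s ≔ v ] [ t ≔ 1 ] ≈ S [ t ≔ 1 ] [ s ≔ v ]
      eq₂ = ≔-comm S _ _ s≢t
      eq₃ : S [ t ≔ v + 1 ] [ s ≔ 0 ] ≈ S [ t ≔ suc v ] [ r ≔ pos S r ]
      eq₃ = ≈-trans (≔-id (trans (pos-≢ S _ s≢t) (free R s ≤-refl)))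
            (≈-trans (≔-cong t (+-comm v 1) ≈-refl) (≈-sym (≔-id (pos-≢ S _ (t≢r ∘ sym)))))
      moved-β : ∀ b → Moved (if b then right else stay) (pos S r) (bool→ℕ b + pos S r)
      moved-β false = refl
      moved-β true  = refl
      symbol : ∀ {ts} → Rep (S [ t ≔ suc v ] [ r ≔ pos S r ]) ts → isTrue (symAt (heads ts) t) ≡ β
      symbol rp = trans (cong isTrue (trans (symAt-heads t<K rp)
        (cong₂ cellOf (input R j) (trans (pos-≢ (S [ t ≔ suc v ]) (pos S r) t≢r) (pos-≡ S t (suc v))))))
          (isTrue-cellOf (ws j) v)
      test : Runs _ (S [ t ≔ suc v ] [ r ≔ pos S r ]) 1 (S [ t ≔ suc v ] [ r ≔ bool→ℕ β + pos S r ])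
      test = runs-moves-if _ (move r (if β then right else stay) {pos S r} {bool→ℕ β + pos S r} (moved-β β) ∷ [])
        (λ rp → cong (λ b → (r , (if b then right else stay)) ∷ []) (symbol rp))
      eq₄ : S [ t ≔ suc v ] [ r ≔ bool→ℕ β + pos S r ] ≈ bump r (bool→ℕ β) S [ t ≔ suc v ]
      eq₄ = ≔-comm S _ _ t≢r
      eq₅ : bump r (bool→ℕ β) S [ t ≔ 0 ] ≈ bump r (bool→ℕ β) S
      eq₅ = ≔-id (trans (pos-≢ S _ t≢r) (home R j))

    correct-len : ∀ {d} (j : Fin m) → Correct {m} {d} ws (len j)
    correct-len j {ρ} {regs} {s} {r} {S} {B} R T s≤K bd =
      runs-⨾ (runs-resp (≈-sym (≔-id (home R j))) ≈-refl (runs-moves {S} (move t right {0} refl ∷ [])))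
      (runs-weaken (+-mono-≤ {suc (n * 2)} (s≤s (*-monoˡ-≤ 2 n≤B)) (s≤s (*-monoˡ-≤ 2 (s≤s n≤B))))
      (runs-⨾ (runs-resp eq₁ ≈-refl loop) (runs-resp ≈-refl eq₂ (runs-clear (bump r n S) t (suc n) t<K))))
      where
      t = toℕ j
      n = length (ws j)
      n≤B : n ≤ B
      n≤B = len-≤ bd j
      t<K : t < K
      t<K = ≤-trans (≤-trans (toℕ<n j) (m≤s R)) (≤-trans (m≤m+n s _) s≤K)
      t≢r : t ≢ r
      t≢r = j≢ j (m≤r T)
      J : ℕ → ℕ → Store
      J k l = S [ r ≔ l + pos S r ] [ t ≔ suc l ]
      eq₁ : S [ t ≔ 1 ] ≈ J n 0
      eq₁ = ≔-cong t refl (≈-sym (≔-id refl))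
      loop = runs-while J n
        (λ k l k+l≡n rp → trans (cong isBit
          (trans (symAt-heads t<K rp) (cong₂ cellOf (input R j) (pos-≡ (S [ r ≔ l + pos S r ]) t (suc l)))))
                                (isBit-cellOf (ws j) k+l≡n))
        (λ k l _ → runs-moves (move t right refl ∷ move r right refl ∷ []))
      eq₂ : bump r n S [ t ≔ 0 ] ≈ bump r n S
      eq₂ = ≔-id (trans (pos-≢ S _ t≢r) (home R j))

    correct : ∀ {d} (a : Exp m d) → Correct ws a
    correct (var i)     = correct-var i
    correct (lit n)     {r = r} {S = S} R T s≤K b = runs-incs r n S
    correct (a ∔ b)     {s = s} {r} {S} R T s≤K bd = runs-resp ≈-refl (bump-bump S r _ _)
      (runs-⨾ (correct a R T (≤-trans (+-monoʳ-≤ s (m≤m+n _ _)) s≤K) bd)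
              (correct b (ready-bump T R) T (≤-trans (+-monoʳ-≤ s (m≤n+m _ _)) s≤K) bd))
    correct (a ∙ b)     {ρ} {s = s} {r} {S} R T s≤K bd = runs-resp ≈-refl
      (≔-cong r (cong (_+ pos S r) (Σ<-const (eval ws a ρ) (eval ws b ρ))) ≈-refl)
      (correct-sum {a = a} (correct a) R T (≤-trans (+-monoʳ-≤ (2 + s) (m≤m+n (height a) _)) K₂) bd
        (λ l l<n R′ → correct b (ready-wk R′) (target-≤ (m≤n+m s 2) T)
          (≤-trans (+-monoʳ-≤ (2 + s) (m≤n+m (height b) _)) K₂) bd))
      where K₂ : 2 + s + (height a + height b) ≤ K
            K₂ = ≤-trans (≤-reflexive (trans (sym (+-suc (suc s) _)) (sym (+-suc s _)))) s≤K
    correct (a ∸̇ b)     = correct-∸ {a = a} {b} (correct a) (correct b)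
    correct (sum a b)   {s = s} {r} R T s≤K bd =
      correct-sum {a = a} (correct a) R T (≤-trans (+-monoʳ-≤ (2 + s) (m≤m+n (height a) _)) K₂) bd
        (λ l l<n R′ → correct b R′ (target-∷ (λ eq → <⇒≢ (m<n⇒m<1+n (r<s T)) (sym eq)) (target-≤ (m≤n+m s 2) T))
                                (≤-trans (+-monoʳ-≤ (2 + s) (m≤n+m (height b) _)) K₂)
                                (bounded-∷ bd (≤-trans l<n (eval-≤ a bd))))
      where K₂ : 2 + s + (height a + height b) ≤ K
            K₂ = ≤-trans (≤-reflexive (trans (sym (+-suc (suc s) _)) (sym (+-suc s _)))) s≤K
    correct (bitAt j a) = correct-bit {a = a} j (correct a)
    correct (len j)     = correct-len j
    correct (wk a)      {ρ = _ ∷ ρ} {_ ∷ regs} R T s≤K b = correct a (ready-wk R) (target-wk T) s≤K (bounded-wk b)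

-- Terms with output

data Out (m : ℕ) : ℕ → Set where
  put    : ∀ {d} → Bool → Out m d
  ε      : ∀ {d} → Out m d
  _⊹_    : ∀ {d} → Out m d → Out m d → Out m d
  for    : ∀ {d} → Exp m d → Out m (suc d) → Out m d
  wkO    : ∀ {d} → Out m d → Out m (suc d)

infixr 5 _⊹_

cat< : ℕ → (ℕ → List Bool) → List Bool
cat< zero    f = []
cat< (suc n) f = cat< n f ++ f n

evalO : ∀ {m d} → (Fin m → List Bool) → Out m d → Vec ℕ d → List Bool
evalO ws (put b)   ρ       = b ∷ []
evalO ws ε         ρ       = []
evalO ws (o ⊹ o′)  ρ       = evalO ws o ρ ++ evalO ws o′ ρ
evalO ws (for a o) ρ       = cat< (eval ws a ρ) (λ i → evalO ws o (i ∷ ρ))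
evalO ws (wkO o)   (_ ∷ ρ) = evalO ws o ρ

boundO : ∀ {m d} → Out m d → ℕ → ℕ
boundO (put b)   B = 1
boundO ε         B = 0
boundO (o ⊹ o′)  B = boundO o B + boundO o′ B
boundO (for a o) B = bound a B * boundO o (B + bound a B)
boundO (wkO o)   B = boundO o B

boundO-poly : ∀ {m d} (o : Out m d) → IsPoly (boundO o)
boundO-poly (put b)   = poly-const 1
boundO-poly ε         = poly-const 0
boundO-poly (o ⊹ o′)  = poly-+ (boundO-poly o) (boundO-poly o′)
boundO-poly (for a o) = poly-* (bound-poly a) (poly-∘ (boundO-poly o) (poly-+ poly-id (bound-poly a)))
boundO-poly (wkO o)   = boundO-poly o

cat<-≤ : ∀ n {f b} → (∀ i → i < n → length (f i) ≤ b) → length (cat< n f) ≤ n * b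
cat<-≤ zero            f≤b = z≤n
cat<-≤ (suc n) {f} {b} f≤b = begin
  length (cat< n f ++ f n)         ≡⟨ length-++ (cat< n f) ⟩
  length (cat< n f) + length (f n) ≤⟨ +-mono-≤ (cat<-≤ n (λ i i<n → f≤b i (m<n⇒m<1+n i<n))) (f≤b n (n<1+n n)) ⟩
  n * b + b                        ≡⟨ +-comm (n * b) b ⟩
  suc n * b                        ∎
  where open ≤-Reasoning

length-evalO : ∀ {m d} {ws : Fin m → List Bool} (o : Out m d) {ρ B} → Bounded ws ρ B →
               length (evalO ws o ρ) ≤ boundO o B
length-evalO (put b)   bd = ≤-refl
length-evalO ε         bd = z≤n
length-evalO {ws = ws} (o ⊹ o′) {ρ} bd = ≤-trans (≤-reflexive (length-++ (evalO ws o ρ)))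
                                   (+-mono-≤ (length-evalO o bd) (length-evalO o′ bd))
length-evalO (for a o) bd = ≤-trans
  (cat<-≤ _ (λ i i<n → length-evalO o (bounded-∷ bd (≤-trans i<n (eval-≤ a bd)))))
  (*-monoˡ-≤ _ (eval-≤ a bd))
length-evalO (wkO o) {_ ∷ _} bd = length-evalO o (bounded-wk bd)

heightO : ∀ {m d} → Out m d → ℕ
heightO (put b)   = 0
heightO ε         = 0
heightO (o ⊹ o′)  = heightO o + heightO o′
heightO (for a o) = 2 + (height a + heightO o)
heightO (wkO o)   = heightO o

costO : ∀ {m d} → Out m d → ℕ → ℕ
costO (put b)   B = 1
costO ε         B = 1
costO (o ⊹ o′)  B = costO o B + costO o′ B
costO (for a o) B = cost a B + (suc (bound a B * suc (costO o (B + bound a B) + 1)) + suc (bound a B * 2))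
costO (wkO o)   B = costO o B

costO-poly : ∀ {m d} (o : Out m d) → IsPoly (costO o)
costO-poly (put b)   = poly-const 1
costO-poly ε         = poly-const 1
costO-poly (o ⊹ o′)  = poly-+ (costO-poly o) (costO-poly o′)
costO-poly (for a o) = poly-+ (cost-poly a) (poly-+
  (poly-+ (poly-const 1) (poly-* (bound-poly a) (poly-+ (poly-const 1)
    (poly-+ (poly-∘ (costO-poly o) (poly-+ poly-id (bound-poly a))) (poly-const 1)))))
  (poly-+ (poly-const 1) (poly-* (bound-poly a) (poly-const 2))))
costO-poly (wkO o)   = costO-poly o

cellAt-++ˡ : ∀ w x {k} → k ≢ length w → cellAt (map bit (w ++ x ∷ [])) k ≡ cellAt {⊤} (map bit w) k
cellAt-++ˡ []      x {zero}  k≢ = contradiction refl k≢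
cellAt-++ˡ []      x {suc k} k≢ = refl
cellAt-++ˡ (_ ∷ w) x {zero}  k≢ = refl
cellAt-++ˡ (_ ∷ w) x {suc k} k≢ = cellAt-++ˡ w x (k≢ ∘ cong suc)

cellAt-++ʳ : ∀ w x → cellAt {⊤} (map bit (w ++ x ∷ [])) (length w) ≡ bit x
cellAt-++ʳ []      x = refl
cellAt-++ʳ (_ ∷ w) x = cellAt-++ʳ w x

look-put : ∀ {w t} b → RepTape w (suc (length w)) t →
           ∀ k → look (write (bit b) t) k (suc (length w)) ≡ cellOf (w ++ b ∷ []) k
look-put {w} {t} b r zero    = r zero
look-put {w} {t} b r (suc k) with k ≟ length w
... | yes refl = trans (look-write-≡ (bit b) t k) (sym (cellAt-++ʳ w b))
... | no k≢    = trans (look-write-≢ (bit b) t k≢) (trans (r (suc k)) (sym (cellAt-++ˡ w b k≢)))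

rep-put : ∀ {w t} b → RepTape w (suc (length w)) t →
          RepTape (w ++ b ∷ []) (suc (length (w ++ b ∷ []))) (act (bit b , right) t)
rep-put {w} {t} b r k rewrite length-++ w {b ∷ []} | +-comm (length w) 1 =
  trans (look-right (write (bit b) t) k (suc (length w))) (look-put b r k)

leadingBits-cells : ∀ (xs : List Sym) w → (∀ k → cellAt xs k ≡ cellAt (map bit w) k) → leadingBits xs ≡ w
leadingBits-cells []       []      eq = refl
leadingBits-cells []       (b ∷ w) eq with () ← eq 0
leadingBits-cells (x ∷ xs) []      eq with refl ← eq 0 = refl
leadingBits-cells (x ∷ xs) (b ∷ w) eq with refl ← eq 0 = cong (b ∷_) (leadingBits-cells xs w (eq ∘ suc))

readOut-rep : ∀ {w t} → RepTape w 1 t → readOut t ≡ w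
readOut-rep {w} {t} r = leadingBits-cells (head t ∷ rights t) w
  λ { zero → r 1 ; (suc k) → r (suc (suc k)) }

-- The output head rests on the first free cell after the word, so that appending a bit is a single
-- write.
withOut : List Bool → Store → Store
withOut o S = store (λ j → if j ≡ᵇ 1 then o else word S j) (pos (S [ 1 ≔ suc (length o) ]))

withOut-≔ : ∀ o S {x} v → 1 ≢ x → withOut o (S [ x ≔ v ]) ≈ withOut o S [ x ≔ v ]
withOut-≔ o S {x} v 1≢x with p , q ← ≔-comm S {x} {1} v (suc (length o)) (1≢x ∘ sym) = (λ j → refl) , q

module OutCompilation (extra : ℕ) where
  open Programs extra
  open Execution extra
  open Compilation extra
  open Rep
  open Ready
  open Target

  putBit : Bool → Prog
  putBit b = prim (λ ss → tabulate (λ i → if toℕ i ≡ᵇ 1 then (bit b , right) else (lookup ss i , stay)))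

  runs-put : ∀ b o S → Runs (putBit b) (withOut o S) 1 (withOut (o ++ b ∷ []) S)
  execute (runs-put b o S) {ts} r = 1 , Vec.zipWith act (tabulate action) ts , ≤-refl , ⇓-prim ,
    rep (λ i → subst (RepTape _ _) (sym (lookup-act action ts i)) (go i))
    where
    action : Fin K → Sym × Move
    action i = if toℕ i ≡ᵇ 1 then (bit b , right) else (lookup (heads ts) i , stay)
    go : ∀ i → RepTape (word (withOut (o ++ b ∷ []) S) (toℕ i)) (pos (withOut (o ++ b ∷ []) S) (toℕ i))
                       (act (action i) (lookup ts i))
    go i with toℕ i ≡ᵇ 1 | tapeRep r i
    ... | true  | r = rep-put b r
    ... | false | r rewrite lookup-map i head ts = r

  compileO : ∀ {m d} → Out m d → Vec ℕ d → ℕ → Prog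
  compileO (put b)   regs s = putBit b
  compileO ε         regs s = moves (const [])
  compileO (o ⊹ o′)  regs s = compileO o regs s ⨾ compileO o′ regs s
  compileO (for a o) regs s = compile a regs (2 + s) s ⨾ iterate s (compileO o (suc s ∷ regs) (2 + s))
  compileO (wkO o)   (_ ∷ regs) s = compileO o regs s

  ready-withOut : ∀ {d ws} {ρ regs : Vec ℕ d} {s S o} → 1 < s → (∀ i → lookup regs i ≢ 1) →
                  Ready {1} ws ρ regs s S → Ready ws ρ regs s (withOut o S)
  ready-withOut {S = S} {o} 1<s fresh R with R′ ← ready-≔ {S = S} 1 {suc (length o)} ≤-refl 1<s fresh R = record
    { vars  = vars R′
    ; low   = low R′
    ; free  = free R′
    ; input = λ { zero → input R zero }
    ; home  = home R′
    ; m≤s   = m≤s R′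
    }

  -- Stated for an arbitrary output `out` written so far, because a loop body starts in the middle
  -- of the output.
  correctO : ∀ {d ws} (o : Out 1 d) {ρ regs s S B} out → 1 < s → (∀ i → lookup regs i ≢ 1) →
             Ready ws ρ regs s S → s + heightO o ≤ K → Bounded ws ρ B →
             Runs (compileO o regs s) (withOut out S) (costO o B) (withOut (out ++ evalO ws o ρ) S)
  correctO (put b)  {S = S} out 1<s fresh R s≤K bd = runs-put b out S
  correctO ε        {S = S} out 1<s fresh R s≤K bd rewrite ++-identityʳ out = runs-moves []
  correctO {ws = ws} (o ⊹ o′) {ρ} {s = s} out 1<s fresh R s≤K bd
    rewrite sym (++-assoc out (evalO ws o ρ) (evalO ws o′ ρ)) =
    runs-⨾ (correctO o out 1<s fresh R (≤-trans (+-monoʳ-≤ s (m≤m+n _ _)) s≤K) bd)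
           (correctO o′ (out ++ evalO ws o ρ) 1<s fresh R (≤-trans (+-monoʳ-≤ s (m≤n+m _ _)) s≤K) bd)
  correctO {ws = ws} (for a o) {ρ} {regs} {s} {S} {B} out 1<s fresh R s≤K bd =
    runs-⨾ (correct ws a (ready-withOut (≤-trans 1<s (m≤n+m s 2)) fresh (ready-≤ (m≤n+m s 2) R))
                    (target-scratch ≤-refl (m<n+m s (s≤s z≤n)) R)
                    (≤-trans (+-monoʳ-≤ (2 + s) (m≤m+n (height a) _)) K₂) bd)
           (runs-weaken (+-mono-≤ (s≤s (*-monoˡ-≤ _ (eval-≤ a bd))) (s≤s (*-monoˡ-≤ _ (eval-≤ a bd))))
             (runs-resp eq₀ ≈-refl loop))
    where
    n = eval ws a ρ
    f : ℕ → List Bool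
    f i = evalO ws o (i ∷ ρ)
    K₂ : 2 + s + (height a + heightO o) ≤ K
    K₂ = ≤-trans (≤-reflexive (trans (sym (+-suc (suc s) _)) (sym (+-suc s _)))) s≤K
    1≢s : 1 ≢ s
    1≢s = <⇒≢ 1<s
    1≢s′ : 1 ≢ suc s
    1≢s′ = <⇒≢ (m<n⇒m<1+n 1<s)
    St : ℕ → Store
    St l = withOut (out ++ cat< l f) S
    St-zero : ∀ l j → s ≤ j → pos (St l) j ≡ 0
    St-zero l j s≤j = free (ready-withOut {o = out ++ cat< l f} 1<s fresh R) j s≤j
    eq₀ : bump s n (withOut out S) ≈ St 0 [ s ≔ n ]
    eq₀ rewrite ++-identityʳ out =
      ≔-cong s (trans (cong (n +_) (trans (pos-≢ S _ (1≢s ∘ sym)) (free R s ≤-refl))) (+-identityʳ n)) ≈-refl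
    eq-out : ∀ o l k → withOut o (S [ suc s ≔ l ] [ s ≔ k ]) ≈ withOut o S [ suc s ≔ l ] [ s ≔ k ]
    eq-out o l k = ≈-trans (withOut-≔ o (S [ suc s ≔ l ]) k 1≢s) (≔-cong s refl (withOut-≔ o S l 1≢s′))
    step : ∀ l → l < n → ∀ k → Runs (compileO o (suc s ∷ regs) (2 + s)) (St l [ suc s ≔ l ] [ s ≔ k ])
             (costO o (B + bound a B)) (St (suc l) [ suc s ≔ l ] [ s ≔ k ])
    step l l<n k rewrite sym (++-assoc out (cat< l f) (f l)) =
      runs-resp (≈-sym (eq-out (out ++ cat< l f) l k)) (eq-out ((out ++ cat< l f) ++ f l) l k)
        (correctO o (out ++ cat< l f) (≤-trans 1<s (m≤n+m s 2))
          (λ { zero → 1≢s′ ∘ sym ; (suc i) → fresh i })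
          (ready-∷ {v = l} (trans (pos-≢ (S [ suc s ≔ l ]) {s} {suc s} k (λ ())) (pos-≡ S (suc s) l)) ≤-refl
            (ready-≔ s (m≤s R) (m<n+m s (s≤s z≤n)) (λ i → <⇒≢ (low R i))
              (ready-≔ (suc s) (m≤n⇒m≤1+n (m≤s R)) ≤-refl (λ i → <⇒≢ (m<n⇒m<1+n (low R i)))
                (ready-≤ (m≤n+m s 2) R))))
          (≤-trans (+-monoʳ-≤ (2 + s) (m≤n+m (heightO o) _)) K₂)
          (bounded-∷ bd (≤-trans l<n (eval-≤ a bd))))
    loop = runs-iterate {s} {compileO o (suc s ∷ regs) (2 + s)} {costO o (B + bound a B)} n St
      (≤-trans (m≤m+n (2 + s) (height a + heightO o)) K₂)
      (St-zero 0 (suc s) (n≤1+n s)) (St-zero n s ≤-refl) (St-zero n (suc s) (n≤1+n s)) step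
  correctO (wkO o) {_ ∷ ρ} {_ ∷ regs} out 1<s fresh R s≤K bd =
    correctO o out 1<s (fresh ∘ suc) (ready-wk R) s≤K (bounded-wk bd)

  -- A word starts under the head. One step to the left gives its symbols the numbers from 1 on and
  -- makes room for the mark on cell 0.
  setup : Prog
  setup = prim (Vec.map (_, left)) ⨾ prim (Vec.map (λ _ → work unit , stay))

  initialStore : List Bool → List Bool → Store
  initialStore w u = store (λ { 0 → w ; 1 → u ; (suc (suc _)) → [] }) (λ _ → 0)

  initialTapes : List Bool → List Bool → Tapes
  initialTapes w u = load w ∷ load u ∷ Vec.replicate extra (load [])

  rep-load : ∀ w → RepTape w 0 (act (work unit , stay) (act (head (load {⊤} w) , left) (load w)))
  rep-load []      zero          = refl
  rep-load []      (suc zero)    = refl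
  rep-load []      (suc (suc k)) = refl
  rep-load (_ ∷ w) zero          = refl
  rep-load (_ ∷ w) (suc k)       = refl

  lookup-map-act : ∀ {n} (f : Sym → Sym × Move) (ts : Vec (Tape ⊤) n) i →
    lookup (Vec.zipWith act (Vec.map f (Vec.map head ts)) ts) i ≡ act (f (head (lookup ts i))) (lookup ts i)
  lookup-map-act f ts i = trans (lookup-zipWith act i (Vec.map f (Vec.map head ts)) ts)
    (cong (λ a → act a (lookup ts i)) (trans (lookup-map i f (Vec.map head ts)) (cong f (lookup-map i head ts))))

  runs-setup : ∀ w u → ∃ λ ts → setup ⊢ initialTapes w u ⇓[ 2 ] ts × Rep (initialStore w u) ts
  runs-setup w u = _ , ⇓-⨾ ⇓-prim ⇓-prim , rep go
    where
    ts₀ = initialTapes w u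
    ts₁ = Vec.zipWith act (Vec.map (_, left) (heads ts₀)) ts₀
    ts₂ = Vec.zipWith act (Vec.map (λ _ → work unit , stay) (heads ts₁)) ts₁
    loaded : ∀ i → lookup ts₂ i ≡ act (work unit , stay) (act (head (lookup ts₀ i) , left) (lookup ts₀ i))
    loaded i = trans (lookup-map-act (λ _ → work unit , stay) ts₁ i)
                     (cong (act (work unit , stay)) (lookup-map-act (_, left) ts₀ i))
    lookup-ts₀ : ∀ i → lookup ts₀ i ≡ load (word (initialStore w u) (toℕ i))
    lookup-ts₀ zero          = refl
    lookup-ts₀ (suc zero)    = refl
    lookup-ts₀ (suc (suc i)) = lookup-replicate i (load [])
    go : ∀ i → RepTape (word (initialStore w u) (toℕ i)) 0 (lookup ts₂ i)
    go i = subst (RepTape _ 0) (sym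
      (trans (loaded i) (cong (λ t → act (work unit , stay) (act (head t , left) t)) (lookup-ts₀ i))))
                 (rep-load (word (initialStore w u) (toℕ i)))

  runs-from-setup : ∀ {P w u b S} → Runs P (initialStore w u) b S →
    ∃₂ λ n ts → n ≤ 2 + b × setup ⨾ P ⊢ initialTapes w u ⇓[ n ] ts × Rep S ts
  runs-from-setup {w = w} {u} R
    with ts₁ , setup⇓ , r₁ ← runs-setup w u
    with n , ts₂ , n≤ , P⇓ , r₂ ← execute R r₁ =
    2 + n , ts₂ , +-monoʳ-≤ 2 n≤ , ⇓-⨾ setup⇓ P⇓ , r₂

  ready-initial : ∀ {m} {ws : Fin m → List Bool} {w u s} → m ≤ s →
                  (∀ j → word (initialStore w u) (toℕ j) ≡ ws j) → Ready ws [] [] s (initialStore w u)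
  ready-initial m≤s eq = record
    { vars = λ () ; low = λ () ; free = λ _ _ → refl ; input = eq ; home = λ _ → refl ; m≤s = m≤s }

  computable : ∀ {f} P p → (∀ w → ∃₂ λ n ts → n < ⟦ p ⟧ (length w) ×
                 P ⊢ initialTapes w [] ⇓[ n ] ts × RepTape (f w) 1 (lookup ts (suc zero))) →
               PolyTimeComputable f
  computable {f} P p executes = record
    { machine  = tm
    ; time     = p
    ; halts    = λ w → true , cong (verdict ∘ state) (final w)
    ; computes = λ w → trans (cong output (final w)) (readOut-rep (proj₂ (proj₂ (proj₂ (proj₂ (executes w))))))
    }
    where
    tm : TM
    tm = machine P (const true)
    open TM tm
    final : ∀ w → run (⟦ p ⟧ (length w)) (init w []) ≡ config (inj₂ (just true)) (proj₁ (proj₂ (executes w)))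
    final w = run-machine P (const true) (proj₁ (proj₂ (proj₂ (proj₂ (executes w)))))
      (proj₁ (proj₂ (proj₂ (executes w))))

  decidable : ∀ {A} P accept p certLength (f : List Bool → List Bool → ℕ) →
              (∀ w → A w ⇔ ∃ λ u → length u ≤ ⟦ certLength ⟧ (length w) × f w u ≢ 0) →
              (∀ w u → ∃₂ λ n ts → n < ⟦ p ⟧ (length w + length u) ×
                P ⊢ initialTapes w u ⇓[ n ] ts × accept (heads ts) ≡ isSuc (f w u)) →
              InNP A
  decidable P accept p certLength f certifies executes = record
    { verifier   = tm
    ; time       = p
    ; certLength = certLength
    ; halts      = λ w u → _ , final w u
    ; verifies   = λ w → mk⇔
        (λ Aw → let u , ≤ , ≢0 = to (certifies w) Aw in
                u , ≤ , trans (final w u) (cong just (isSuc-≢ ≢0)))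
        (λ (u , ≤ , acc) → from (certifies w) (u , ≤ , λ eq →
          true≢ (trans (sym acc) (trans (final w u) (cong (just ∘ isSuc) eq)))))
    }
    where
    open Function.Equivalence
    tm : TM
    tm = machine P accept
    open TM tm
    final : ∀ w u → verdict (state (run (⟦ p ⟧ (length w + length u)) (init w u))) ≡ just (isSuc (f w u))
    final w u with n , ts , n< , P⇓ , acc ← executes w u =
      trans (cong (verdict ∘ state) (run-machine P accept P⇓ n<)) (cong just acc)
    isSuc-≢ : ∀ {n} → n ≢ 0 → isSuc n ≡ true
    isSuc-≢ {zero}  n≢0 = contradiction refl n≢0
    isSuc-≢ {suc n} n≢0 = refl
    true≢ : just true ≢ just false
    true≢ ()

words₂ : List Bool → List Bool → Fin 2 → List Bool
words₂ w u zero    = w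
words₂ w u (suc _) = u

module _ {A : Language} (Φ : Exp 2 0) (certLength : Polynomial)
         (correct-Φ : ∀ w → A w ⇔ ∃ λ u → length u ≤ ⟦ certLength ⟧ (length w) × eval (words₂ w u) Φ [] ≢ 0) where

  private
    extra : ℕ
    extra = suc (height Φ)
  open Programs extra
  open Execution extra
  open Compilation extra
  open OutCompilation extra

  private
    P : Prog
    -- Registers 0 and 1 are the two words, register 2 receives the value and scratch space starts
    -- at 3; hence `extra` exceeds the height by one.
    P = setup ⨾ compile Φ [] 3 2

    executes : ∀ w u → ∃₂ λ n ts → n ≤ 2 + cost Φ (length w + length u) ×
               P ⊢ initialTapes w u ⇓[ n ] ts × nonzero 2 (heads ts) ≡ isSuc (eval (words₂ w u) Φ [])
    executes w u =
      let n , ts , n≤ , P⇓ , r = runs-from-setup (correct (words₂ w u) Φ {regs = []} {s = 3} {r = 2} {B = length w + length u}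
            (ready-initial (s≤s (s≤s z≤n)) (λ { zero → refl ; (suc zero) → refl }))
            (record { r<s = ≤-refl ; r≢var = λ () ; m≤r = ≤-refl }) ≤-refl
            (bounded (λ ()) (λ { zero → m≤m+n _ _ ; (suc zero) → m≤n+m _ (length w) })))
      in n , ts , n≤ , P⇓ , trans (nonzero-pos (s≤s (s≤s (s≤s z≤n))) r) (cong isSuc (+-identityʳ _))

  inNP : InNP A
  inNP with p , eq ← poly-+ (poly-const 3) (cost-poly Φ) =
    decidable P (nonzero 2) p certLength (λ w u → eval (words₂ w u) Φ []) correct-Φ λ w u →
      let n , ts , n≤ , P⇓ , acc = executes w u in
      n , ts , ≤-trans (s≤s n≤) (≤-reflexive (eq _)) , P⇓ , acc

words₁ : List Bool → Fin 1 → List Bool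
words₁ w _ = w

module _ (o : Out 1 0) where

  private
    extra : ℕ
    extra = heightO o
  open Programs extra
  open Execution extra
  open Compilation extra
  open OutCompilation extra

  private
    P : Prog
    -- The first `inc 1` steps off the mark to the first free cell. At the end the head returns to
    -- the mark and moves to the first output bit, since `readOut` reads rightwards from the head.
    P = setup ⨾ inc 1 ⨾ compileO o [] 2 ⨾ clear 1 ⨾ inc 1

    out : List Bool → List Bool
    out w = evalO (words₁ w) o []

    W : List Bool → Store
    W w = withOut (out w) (initialStore w [])

    enter : ∀ w → Runs (inc 1) (initialStore w []) 1 (withOut [] (initialStore w []))
    enter w = runs-resp {S₁ = initialStore w [] [ 1 ≔ 0 ]} {S₂ = initialStore w [] [ 1 ≔ 1 ]}
      (≈-sym (≔-id {initialStore w []} {1} refl))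
      ((λ { 0 → refl ; 1 → refl ; (suc (suc _)) → refl }) , λ _ → refl)
      (runs-moves {initialStore w []} (move 1 right {0} refl ∷ []))

    emit : ∀ w → Runs (compileO o [] 2) (withOut [] (initialStore w [])) (costO o (length w)) (W w)
    emit w = correctO o {regs = []} {s = 2} [] ≤-refl (λ ())
      (ready-initial (s≤s z≤n) (λ { zero → refl })) ≤-refl (bounded (λ ()) (λ { zero → ≤-refl }))

    rewind : ∀ w → Runs (clear 1) (W w) (suc (suc (boundO o (length w)) * 2)) (W w [ 1 ≔ 0 ])
    rewind w = runs-weaken (s≤s (*-monoˡ-≤ 2 (s≤s (length-evalO o (bounded (λ ()) (λ { zero → ≤-refl }))))))
      (runs-resp (≈-sym (≔-id {W w} {1} refl)) ≈-refl (runs-clear (W w) 1 (suc (length (out w))) (s≤s (s≤s z≤n))))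

    total : ∀ w → Runs (inc 1 ⨾ compileO o [] 2 ⨾ clear 1 ⨾ inc 1) (initialStore w [])
                    (1 + (costO o (length w) + (suc (suc (boundO o (length w)) * 2) + 1))) (W w [ 1 ≔ 1 ])
    total w = runs-⨾ (enter w) (runs-⨾ (emit w) (runs-⨾ (rewind w) (runs-moves {W w} (move 1 right {0} refl ∷ []))))

    executes : ∀ w → ∃₂ λ n ts → n ≤ 2 + (1 + (costO o (length w) + (suc (suc (boundO o (length w)) * 2) + 1))) ×
                                  P ⊢ initialTapes w [] ⇓[ n ] ts × RepTape (out w) 1 (lookup ts (suc zero))
    executes w = let n , ts , n≤ , P⇓ , r = runs-from-setup (total w) in n , ts , n≤ , P⇓ , Rep.tapeRep r (suc zero)

  polyTime : PolyTimeComputable out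
  polyTime with p , eq ← poly-+ (poly-const 4) (poly-+ (costO-poly o) (poly-+
      (poly-+ (poly-const 1) (poly-* (poly-+ (poly-const 1) (boundO-poly o)) (poly-const 2))) (poly-const 1))) =
    computable P p λ w →
      let n , ts , n≤ , P⇓ , r = executes w in
      n , ts , ≤-trans (s≤s n≤) (≤-reflexive (eq (length w))) , P⇓ , r

-- Model checking by approximants

∈-tabulate : ∀ {n} (f : Fin n → Bool) {i} → i ∈ tabulate f ⇔ f i ≡ true
∈-tabulate f {i} = mk⇔
  (λ i∈ → trans (sym (lookup∘tabulate f i)) ([]=⇒lookup i∈))
  (λ eq → lookup⇒[]= i (tabulate f) (trans (lookup∘tabulate f i) eq))

does-true : ∀ {P : Set} (P? : Dec P) → does P? ≡ true ⇔ P
does-true (yes p) = mk⇔ (λ _ → p) (λ _ → refl)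
does-true (no ¬p) = mk⇔ (λ ()) (λ p → contradiction p ¬p)

Pred : ℕ → Set₁
Pred n = Fin n → Set

module Approximation {n : ℕ} (F : Pred n → Pred n)
  (mono : ∀ {P Q : Pred n} → (∀ {i} → P i → Q i) → ∀ {i} → F P i → F Q i)
  (F? : ∀ {P : Pred n} → (∀ i → Dec (P i)) → ∀ i → Dec (F P i)) where

  Approx : ℕ → Pred n
  Approx zero    i = ⊤
  Approx (suc r) i = F (Approx r) i

  Approx? : ∀ r i → Dec (Approx r i)
  Approx? zero    i = yes unit
  Approx? (suc r) i = F? (Approx? r) i

  antitone : ∀ r {i} → Approx (suc r) i → Approx r i
  antitone zero    _ = unit
  antitone (suc r) a = mono (antitone r) a

  Stable : ℕ → Set
  Stable r = ∀ i → Approx r i → Approx (suc r) i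

  stage : ℕ → Subset n
  stage r = tabulate (λ i → does (Approx? r i))

  ∈-stage : ∀ {r i} → i ∈ stage r ⇔ Approx r i
  ∈-stage {r} {i} = mk⇔ (to (does-true (Approx? r i)) ∘ to (∈-tabulate _))
                        (from (∈-tabulate _) ∘ from (does-true (Approx? r i)))

  -- Every stage before stabilisation removes at least one of the n elements.
  stable-or-small : ∀ r → Stable r ⊎ ∣ stage r ∣ + r ≤ n
  stable-or-small zero    = inj₂ (≤-trans (≤-reflexive (+-identityʳ _)) (∣p∣≤n (stage 0)))
  stable-or-small (suc r) with stable-or-small r
  ... | inj₁ stable = inj₁ (λ i → mono (λ {i} → stable i))
  ... | inj₂ small with all? (λ i → Approx? r i →-dec Approx? (suc r) i)
  ... | yes stable = inj₁ (λ i → mono (λ {i} → stable i))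
  ... | no ¬stable with i , ¬step ← ¬∀⟶∃¬ n _ (λ i → Approx? r i →-dec Approx? (suc r) i) ¬stable =
    inj₂ (≤-trans (≤-reflexive (+-suc _ r)) (≤-trans (+-monoˡ-≤ r (p⊂q⇒∣p∣<∣q∣ strict)) small))
    where
    strict : stage (suc r) ⊂ stage r
    strict = (λ i∈ → from (∈-stage {r}) (antitone r (to (∈-stage {suc r}) i∈))) , i ,
             from (∈-stage {r}) (decidable-stable (Approx? r i) (λ ¬a → ¬step (λ a → contradiction a ¬a))) ,
             λ i∈ → ¬step (λ _ → to (∈-stage {suc r}) i∈)

  ∣∣-pos : ∀ {m} {p : Subset m} {i} → i ∈ p → 0 < ∣ p ∣
  ∣∣-pos {p = true  ∷ p} i∈ = s≤s z≤n
  ∣∣-pos {p = false ∷ p} (Vec.there i∈) = ∣∣-pos i∈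

  -- If none of the stages before n is stable, each step has removed an element; stage n is then
  -- empty and stable for want of elements.
  stable : Stable n
  stable with stable-or-small n
  ... | inj₁ s = s
  ... | inj₂ ∣∣+n≤n = λ i a → contradiction (≤-trans (+-monoˡ-≤ n (∣∣-pos (from (∈-stage {n}) a))) ∣∣+n≤n)
    (<-irrefl refl)

module _ {n a : ℕ} (M : Kripke n a) where

  □ₛ ◇ₛ : Pred n → Pred n
  □ₛ P i = ∀ j → j ∈ R M i → P j
  ◇ₛ P i = ∃ λ j → j ∈ R M i × P j

  □? : ∀ {P} → (∀ i → Dec (P i)) → ∀ i → Dec (□ₛ P i)
  □? P? i = all? (λ j → (j ∈? R M i) →-dec P? j)

  ◇? : ∀ {P} → (∀ i → Dec (P i)) → ∀ i → Dec (◇ₛ P i)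
  ◇? P? i = any? (λ j → (j ∈? R M i) ×-dec P? j)

  -- Release formulas are greatest fixpoints of Z ↦ ψ ∧ (φ ∨ N Z), with N the
  -- next-time operator.
  module Release (N : Pred n → Pred n)
    (N-mono : ∀ {P Q : Pred n} → (∀ {i} → P i → Q i) → ∀ {i} → N P i → N Q i)
    (N? : ∀ {P : Pred n} → (∀ i → Dec (P i)) → ∀ i → Dec (N P i))
    (φ ψ : Pred n) (φ? : ∀ i → Dec (φ i)) (ψ? : ∀ i → Dec (ψ i)) where

    F : Pred n → Pred n
    F Z i = ψ i × (φ i ⊎ N Z i)

    F-mono : ∀ {P Q : Pred n} → (∀ {i} → P i → Q i) → ∀ {i} → F P i → F Q i
    F-mono P⊆Q (p , inj₁ q) = p , inj₁ q
    F-mono P⊆Q (p , inj₂ q) = p , inj₂ (N-mono P⊆Q q)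

    F? : ∀ {P : Pred n} → (∀ i → Dec (P i)) → ∀ i → Dec (F P i)
    F? P? i = ψ? i ×-dec (φ? i ⊎-dec N? P? i)

    open Approximation F F-mono F? public

  □-mono : ∀ {P Q : Pred n} → (∀ {i} → P i → Q i) → ∀ {i} → □ₛ P i → □ₛ Q i
  □-mono P⊆Q p j j∈ = P⊆Q (p j j∈)

  ◇-mono : ∀ {P Q : Pred n} → (∀ {i} → P i → Q i) → ∀ {i} → ◇ₛ P i → ◇ₛ Q i
  ◇-mono P⊆Q (j , j∈ , p) = j , j∈ , P⊆Q p

  mutual
    -- The decidable counterpart of `_,_⊨_`: the n-th approximant takes the place of the
    -- quantification over fullpaths.
    MC : CTL a → Pred n
    MC tt        i = ⊤
    MC ff         i = ⊥
    MC (atom p)   i = p ∈ L M i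
    MC (neg φ)    i = ¬ MC φ i
    MC (φ and ψ)  i = MC φ i × MC ψ i
    MC (φ or ψ)   i = MC φ i ⊎ MC ψ i
    MC (AX φ)     i = □ₛ (MC φ) i
    MC (EX φ)     i = ◇ₛ (MC φ) i
    MC A[ φ V ψ ] i = stageA φ ψ n i
    MC E[ φ V ψ ] i = stageE φ ψ n i

    stageA stageE : CTL a → CTL a → ℕ → Pred n
    stageA φ ψ zero    i = ⊤
    stageA φ ψ (suc r) i = MC ψ i × (MC φ i ⊎ □ₛ (stageA φ ψ r) i)
    stageE φ ψ zero    i = ⊤
    stageE φ ψ (suc r) i = MC ψ i × (MC φ i ⊎ ◇ₛ (stageE φ ψ r) i)

  mutual
    MC? : ∀ φ i → Dec (MC φ i)
    MC? tt        i = yes unit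
    MC? ff         i = no λ ()
    MC? (atom p)   i = p ∈? L M i
    MC? (neg φ)    i = ¬? (MC? φ i)
    MC? (φ and ψ)  i = MC? φ i ×-dec MC? ψ i
    MC? (φ or ψ)   i = MC? φ i ⊎-dec MC? ψ i
    MC? (AX φ)     i = □? (MC? φ) i
    MC? (EX φ)     i = ◇? (MC? φ) i
    MC? A[ φ V ψ ] i = stageA? φ ψ n i
    MC? E[ φ V ψ ] i = stageE? φ ψ n i

    stageA? : ∀ φ ψ r i → Dec (stageA φ ψ r i)
    stageA? φ ψ zero    i = yes unit
    stageA? φ ψ (suc r) i = MC? ψ i ×-dec (MC? φ i ⊎-dec □? (stageA? φ ψ r) i)

    stageE? : ∀ φ ψ r i → Dec (stageE φ ψ r i)
    stageE? φ ψ zero    i = yes unit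
    stageE? φ ψ (suc r) i = MC? ψ i ×-dec (MC? φ i ⊎-dec ◇? (stageE? φ ψ r) i)

  module AR (φ ψ : CTL a) = Release □ₛ □-mono □? (MC φ) (MC ψ) (MC? φ) (MC? ψ)
  module ER (φ ψ : CTL a) = Release ◇ₛ ◇-mono ◇? (MC φ) (MC ψ) (MC? φ) (MC? ψ)

  -- The stages are spelled out next to `MC` to make the recursion structural; this connects them
  -- with the general approximation, whose stability is then available.
  stageA⇔ : ∀ φ ψ r {i} → stageA φ ψ r i ⇔ AR.Approx φ ψ r i
  stageA⇔ φ ψ zero    = mk⇔ id id
  stageA⇔ φ ψ (suc r) = mk⇔ (AR.F-mono φ ψ (to (stageA⇔ φ ψ r))) (AR.F-mono φ ψ (from (stageA⇔ φ ψ r)))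

  stageE⇔ : ∀ φ ψ r {i} → stageE φ ψ r i ⇔ ER.Approx φ ψ r i
  stageE⇔ φ ψ zero    = mk⇔ id id
  stageE⇔ φ ψ (suc r) = mk⇔ (ER.F-mono φ ψ (to (stageE⇔ φ ψ r))) (ER.F-mono φ ψ (from (stageE⇔ φ ψ r)))

  unfoldA : ∀ φ ψ {i} → stageA φ ψ n i → stageA φ ψ (suc n) i
  unfoldA φ ψ {i} s = from (stageA⇔ φ ψ (suc n)) (AR.stable φ ψ i (to (stageA⇔ φ ψ n) s))

  unfoldE : ∀ φ ψ {i} → stageE φ ψ n i → stageE φ ψ (suc n) i
  unfoldE φ ψ {i} s = from (stageE⇔ φ ψ (suc n)) (ER.stable φ ψ i (to (stageE⇔ φ ψ n) s))

  path-in-S : ∀ {i} (π : Fullpath M i) k → at π k ∈ S M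
  path-in-S π k = proj₁ (R⊆S² M (steps π k))

  tail : ∀ {i} (π : Fullpath M i) → Fullpath M (at π 1)
  tail π = record { at = at π ∘ suc ; starts = refl ; steps = steps π ∘ suc }

  cons : ∀ {i j} → j ∈ R M i → Fullpath M j → Fullpath M i
  cons {i} j∈ π = record
    { at     = λ { zero → i ; (suc k) → at π k }
    ; starts = refl
    ; steps  = λ { zero → subst (_∈ R M i) (sym (starts π)) j∈ ; (suc k) → steps π k }
    }

  -- The choice of successors is a parameter: totality gives some path, a refined choice gives a
  -- path that remains in a given set.
  module Unfold (choose : ∀ {i} → i ∈ S M → ∃ λ j → j ∈ R M i) where
    walk : ∀ {i} → i ∈ S M → ℕ → Σ (Fin n) (_∈ S M)
    walk {i} i∈ zero    = i , i∈
    walk     i∈ (suc k) = let _ , j∈ = walk i∈ k ; j , e = choose j∈ in j , proj₂ (R⊆S² M e)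

    path : ∀ {i} → i ∈ S M → Fullpath M i
    path i∈ = record { at = proj₁ ∘ walk i∈ ; starts = refl ; steps = λ k → proj₂ (choose (proj₂ (walk i∈ k))) }

  module _ (total : Total M) where

    -- Stage n contains its own unfolding, so membership in it passes along the path as long as φ
    -- fails, and membership yields ψ.
    MC-A-sound : ∀ φ ψ →
      (∀ {i} → i ∈ S M → MC φ i ⇔ M , i ⊨ φ) → (∀ {i} → i ∈ S M → MC ψ i ⇔ M , i ⊨ ψ) →
      ∀ {i} → MC A[ φ V ψ ] i → M , i ⊨ A[ φ V ψ ]
    MC-A-sound φ ψ IHφ IHψ {i} s π k ¬φ = to (IHψ (path-in-S π k)) (proj₁ (unfoldA φ ψ (invariant k ¬φ)))
      where
      invariant : ∀ k → (∀ j → j < k → ¬ (M , at π j ⊨ φ)) → stageA φ ψ n (at π k)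
      invariant zero    ¬φ = subst (stageA φ ψ n) (sym (starts π)) s
      invariant (suc k) ¬φ with proj₂ (unfoldA φ ψ (invariant k (λ j j<k → ¬φ j (m<n⇒m<1+n j<k))))
      ... | inj₁ p = contradiction (to (IHφ (path-in-S π k)) p) (¬φ k (n<1+n k))
      ... | inj₂ q = q _ (steps π k)

    MC-A-complete : ∀ φ ψ →
      (∀ {i} → i ∈ S M → MC φ i ⇔ M , i ⊨ φ) → (∀ {i} → i ∈ S M → MC ψ i ⇔ M , i ⊨ ψ) →
      ∀ r {i} → i ∈ S M → M , i ⊨ A[ φ V ψ ] → stageA φ ψ r i
    MC-A-complete φ ψ IHφ IHψ zero    i∈ sat = unit
    MC-A-complete φ ψ IHφ IHψ (suc r) {i} i∈ sat =
      -- Totality supplies a path from i; without any path the universal statement would say nothing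
      -- about ψ at i.
      from (IHψ i∈) (sat (Unfold.path total i∈) 0 (λ _ ())) , rest (MC? φ i)
      where
      rest : Dec (MC φ i) → MC φ i ⊎ □ₛ (stageA φ ψ r) i
      rest (yes p) = inj₁ p
      rest (no ¬p) = inj₂ λ j j∈ → MC-A-complete φ ψ IHφ IHψ r (proj₂ (R⊆S² M j∈))
        λ π k ¬φ → sat (cons j∈ π) (suc k)
          λ { zero _ → ¬p ∘ from (IHφ i∈) ; (suc l) (s≤s l<k) → ¬φ l l<k }

    MC-E-complete : ∀ φ ψ →
      (∀ {i} → i ∈ S M → MC φ i ⇔ M , i ⊨ φ) → (∀ {i} → i ∈ S M → MC ψ i ⇔ M , i ⊨ ψ) →
      ∀ r {i} → i ∈ S M → M , i ⊨ E[ φ V ψ ] → stageE φ ψ r i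
    MC-E-complete φ ψ IHφ IHψ zero    i∈ sat = unit
    MC-E-complete φ ψ IHφ IHψ (suc r) {i} i∈ (π , sat) =
      from (IHψ i∈) (subst (M ,_⊨ ψ) (starts π) (sat 0 (λ _ ()))) , rest (MC? φ i)
      where
      rest : Dec (MC φ i) → MC φ i ⊎ ◇ₛ (stageE φ ψ r) i
      rest (yes p) = inj₁ p
      rest (no ¬p) = inj₂ (at π 1 , subst (λ s → at π 1 ∈ R M s) (starts π) (steps π 0) ,
        MC-E-complete φ ψ IHφ IHψ r (path-in-S π 1) (tail π , λ k ¬φ → sat (suc k)
          λ { zero _ → ¬p ∘ from (IHφ i∈) ∘ subst (M ,_⊨ φ) (starts π) ; (suc l) (s≤s l<k) → ¬φ l l<k }))

    MC-E-sound : ∀ φ ψ →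
      (∀ {i} → i ∈ S M → MC φ i ⇔ M , i ⊨ φ) → (∀ {i} → i ∈ S M → MC ψ i ⇔ M , i ⊨ ψ) →
      ∀ {i} → i ∈ S M → MC E[ φ V ψ ] i → M , i ⊨ E[ φ V ψ ]
    MC-E-sound φ ψ IHφ IHψ {i} i∈ s = path i∈ , λ k ¬φ →
      to (IHψ (path-in-S (path i∈) k)) (proj₁ (unfoldE φ ψ (invariant k ¬φ)))
      where
      Z : Pred n
      Z = stageE φ ψ n
      good? : ∀ i → Dec (◇ₛ Z i)
      good? = ◇? (stageE? φ ψ n)
      -- A successor in `Z` is taken whenever there is one. Where there is none, φ has released the
      -- obligation and any successor will do.
      choose : ∀ {i} → i ∈ S M → ∃ λ j → j ∈ R M i
      choose {i} i∈ with good? i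
      ... | yes (j , j∈ , _) = j , j∈
      ... | no _             = total i∈
      choose-good : ∀ {i} (i∈ : i ∈ S M) → ◇ₛ Z i → Z (proj₁ (choose i∈))
      choose-good {i} i∈ g with good? i
      ... | yes (_ , _ , z) = z
      ... | no ¬g           = contradiction g ¬g
      open Unfold choose
      invariant : ∀ k → (∀ j → j < k → ¬ (M , at (path i∈) j ⊨ φ)) → Z (at (path i∈) k)
      invariant zero    ¬φ = s
      invariant (suc k) ¬φ with proj₂ (unfoldE φ ψ (invariant k (λ j j<k → ¬φ j (m<n⇒m<1+n j<k))))
      ... | inj₁ p = contradiction (to (IHφ (path-in-S (path i∈) k)) p) (¬φ k (n<1+n k))
      ... | inj₂ q = choose-good (proj₂ (walk i∈ k)) q

    MC-correct : ∀ φ {i} → i ∈ S M → MC φ i ⇔ M , i ⊨ φ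
    MC-correct tt       i∈ = mk⇔ id id
    MC-correct ff        i∈ = mk⇔ id id
    MC-correct (atom p)  i∈ = mk⇔ id id
    MC-correct (neg φ)   i∈ = mk⇔ (_∘ from (MC-correct φ i∈)) (_∘ to (MC-correct φ i∈))
    MC-correct (φ and ψ) i∈ = mk⇔ (λ (p , q) → to (MC-correct φ i∈) p , to (MC-correct ψ i∈) q)
                                  (λ (p , q) → from (MC-correct φ i∈) p , from (MC-correct ψ i∈) q)
    MC-correct (φ or ψ)  i∈ = mk⇔
      (λ { (inj₁ p) → inj₁ (to (MC-correct φ i∈) p) ; (inj₂ q) → inj₂ (to (MC-correct ψ i∈) q) })
      (λ { (inj₁ p) → inj₁ (from (MC-correct φ i∈) p) ; (inj₂ q) → inj₂ (from (MC-correct ψ i∈) q) })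
    MC-correct (AX φ)    i∈ = mk⇔ (λ p j j∈ → to (MC-correct φ (proj₂ (R⊆S² M j∈))) (p j j∈))
                                  (λ p j j∈ → from (MC-correct φ (proj₂ (R⊆S² M j∈))) (p j j∈))
    MC-correct (EX φ)    i∈ = mk⇔ (λ (j , j∈ , p) → j , j∈ , to (MC-correct φ (proj₂ (R⊆S² M j∈))) p)
                                  (λ (j , j∈ , p) → j , j∈ , from (MC-correct φ (proj₂ (R⊆S² M j∈))) p)
    MC-correct A[ φ V ψ ] i∈ = mk⇔ (MC-A-sound φ ψ (MC-correct φ) (MC-correct ψ))
                                   (MC-A-complete φ ψ (MC-correct φ) (MC-correct ψ) n i∈)
    MC-correct E[ φ V ψ ] i∈ = mk⇔ (MC-E-sound φ ψ (MC-correct φ) (MC-correct ψ) i∈)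
                                   (MC-E-complete φ ψ (MC-correct φ) (MC-correct ψ) n i∈)

-- First-order formulas over the input word

Term : ℕ → Set
Term = Exp 1

⟪_⟫ : ∀ {d} → Term d → List Bool → Vec ℕ d → ℕ
⟪ a ⟫ w ρ = eval (words₁ w) a ρ

data Formula : ℕ → Set where
  _≐_ _≺_     : ∀ {d} → Term d → Term d → Formula d
  one         : ∀ {d} → Term d → Formula d
  rel         : ∀ {d} → Fin 4 → Term d → Term d → Term d → Formula d
  ~_          : ∀ {d} → Formula d → Formula d
  _&_ _∥_ _⊃_ : ∀ {d} → Formula d → Formula d → Formula d
  all< ex<    : ∀ {d} → Term d → Formula (suc d) → Formula d

infix  5 _≐_ _≺_
infix  4 ~_
infixr 3 _&_
infixr 2 _∥_
infixr 1 _⊃_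

-- Four ternary relations, existentially quantified as in Fagin's theorem.
Table : Set
Table = Fin 4 → ℕ → ℕ → ℕ → Bool

sat : ∀ {d} → List Bool → Table → Formula d → Vec ℕ d → Set
sat w G (a ≐ b)       ρ = ⟪ a ⟫ w ρ ≡ ⟪ b ⟫ w ρ
sat w G (a ≺ b)       ρ = ⟪ a ⟫ w ρ < ⟪ b ⟫ w ρ
sat w G (one a)       ρ = nth w (⟪ a ⟫ w ρ) ≡ true
sat w G (rel c a b e) ρ = G c (⟪ a ⟫ w ρ) (⟪ b ⟫ w ρ) (⟪ e ⟫ w ρ) ≡ true
sat w G (~ φ)         ρ = ¬ sat w G φ ρ
sat w G (φ & ψ)       ρ = sat w G φ ρ × sat w G ψ ρ
sat w G (φ ∥ ψ)       ρ = sat w G φ ρ ⊎ sat w G ψ ρ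
sat w G (φ ⊃ ψ)       ρ = sat w G φ ρ → sat w G ψ ρ
sat w G (all< a φ)    ρ = ∀ i → i < ⟪ a ⟫ w ρ → sat w G φ (i ∷ ρ)
sat w G (ex< a φ)     ρ = ∃ λ i → i < ⟪ a ⟫ w ρ × sat w G φ (i ∷ ρ)

lift₂ : ∀ {d} → Term d → Exp 2 d
lift₂ (var i)     = var i
lift₂ (lit n)     = lit n
lift₂ (a ∔ b)     = lift₂ a ∔ lift₂ b
lift₂ (a ∙ b)     = lift₂ a ∙ lift₂ b
lift₂ (a ∸̇ b)     = lift₂ a ∸̇ lift₂ b
lift₂ (sum a b)   = sum (lift₂ a) (lift₂ b)
lift₂ (bitAt j a) = bitAt zero (lift₂ a)
lift₂ (len j)     = len zero
lift₂ (wk a)      = wk (lift₂ a)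

lift₂-eval : ∀ {d} (a : Term d) w u ρ → eval (words₂ w u) (lift₂ a) ρ ≡ ⟪ a ⟫ w ρ
lift₂-eval (var i)     w u ρ = refl
lift₂-eval (lit n)     w u ρ = refl
lift₂-eval (a ∔ b)     w u ρ = cong₂ _+_ (lift₂-eval a w u ρ) (lift₂-eval b w u ρ)
lift₂-eval (a ∙ b)     w u ρ = cong₂ _*_ (lift₂-eval a w u ρ) (lift₂-eval b w u ρ)
lift₂-eval (a ∸̇ b)     w u ρ = cong₂ _∸_ (lift₂-eval a w u ρ) (lift₂-eval b w u ρ)
lift₂-eval (sum a b)   w u ρ = trans
  (Σ<-cong (eval (words₂ w u) (lift₂ a) ρ) (λ i → lift₂-eval b w u (i ∷ ρ)))
  (cong (λ n → Σ< n (λ i → ⟪ b ⟫ w (i ∷ ρ))) (lift₂-eval a w u ρ))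
lift₂-eval (bitAt j a) w u ρ = cong (bool→ℕ ∘ nth w) (lift₂-eval a w u ρ)
lift₂-eval (len j)     w u ρ = refl
lift₂-eval (wk a)      w u (_ ∷ ρ) = lift₂-eval a w u ρ

-- The place of entry (i, j, k) of table c in the certificate, for i, j, k < B.
address : ℕ → ℕ → ℕ → ℕ → ℕ → ℕ
address B c i j k = c + 4 * (i + B * (j + B * k))

addressᴱ : ∀ {d} → Exp 2 d → ℕ → Exp 2 d → Exp 2 d → Exp 2 d → Exp 2 d
addressᴱ B c i j k = lit c ∔ lit 4 ∙ (i ∔ B ∙ (j ∔ B ∙ k))

tableOf : List Bool → List Bool → Table
tableOf w u c i j k = nth u (address (suc (length w)) (toℕ c) i j k)

-- Truth is being nonzero. Products are conjunctions, sums are disjunctions and existential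
-- quantifiers, and `lit 1 ∸̇_` is negation.
translate : ∀ {d} → Formula d → Exp 2 d
translate (a ≐ b)       = lit 1 ∸̇ ((lift₂ a ∸̇ lift₂ b) ∔ (lift₂ b ∸̇ lift₂ a))
translate (a ≺ b)       = lift₂ b ∸̇ lift₂ a
translate (one a)       = bitAt zero (lift₂ a)
translate (rel c a b e) = bitAt (suc zero) (addressᴱ (lit 1 ∔ len zero) (toℕ c) (lift₂ a) (lift₂ b) (lift₂ e))
translate (~ φ)         = lit 1 ∸̇ translate φ
translate (φ & ψ)       = translate φ ∙ translate ψ
translate (φ ∥ ψ)       = translate φ ∔ translate ψ
translate (φ ⊃ ψ)       = (lit 1 ∸̇ translate φ) ∔ translate ψ
translate (all< a φ)    = lit 1 ∸̇ sum (lift₂ a) (lit 1 ∸̇ translate φ)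
translate (ex< a φ)     = sum (lift₂ a) (translate φ)

Nonzero : ℕ → Set
Nonzero n = n ≢ 0

nonzero? : ∀ n → Dec (Nonzero n)
nonzero? zero    = no λ t → t refl
nonzero? (suc n) = yes λ ()

¬Nonzero⇒≡0 : ∀ {n} → ¬ Nonzero n → n ≡ 0
¬Nonzero⇒≡0 {zero}  ¬t = refl
¬Nonzero⇒≡0 {suc n} ¬t = contradiction (λ ()) ¬t

⇔-trans : ∀ {A B C : Set} → A ⇔ B → B ⇔ C → A ⇔ C
⇔-trans e f = f ⇔-∘ e

≡⇒⇔ : ∀ {A B : Set} → A ≡ B → A ⇔ B
≡⇒⇔ refl = mk⇔ id id

true-not : ∀ n → Nonzero (1 ∸ n) ⇔ (¬ Nonzero n)
true-not zero    = mk⇔ (λ _ t → t refl) (λ _ ())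
true-not (suc n) = mk⇔ (λ t _ → t (0∸n≡0 n)) (λ ¬t _ → ¬t λ ())

true-+ : ∀ m {n} → Nonzero (m + n) ⇔ (Nonzero m ⊎ Nonzero n)
true-+ zero    = mk⇔ inj₂ (λ { (inj₁ t) → contradiction refl t ; (inj₂ t) → t })
true-+ (suc m) = mk⇔ (λ _ → inj₁ λ ()) (λ _ ())

true-* : ∀ m n → Nonzero (m * n) ⇔ (Nonzero m × Nonzero n)
true-* zero    n       = mk⇔ (contradiction refl) (proj₁)
true-* (suc m) zero    = mk⇔ (λ t → contradiction (*-zeroʳ m) t) (λ (_ , t) → contradiction refl t)
true-* (suc m) (suc n) = mk⇔ (λ _ → (λ ()) , λ ()) (λ _ ())

true-∸ : ∀ m n → Nonzero (m ∸ n) ⇔ (n < m)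
true-∸ m n = mk⇔ (λ t → ≰⇒> (t ∘ m≤n⇒m∸n≡0)) (λ n<m eq → <⇒≱ n<m (m∸n≡0⇒m≤n eq))

true-Σ : ∀ n {f} → Nonzero (Σ< n f) ⇔ (∃ λ i → i < n × Nonzero (f i))
true-Σ zero    = mk⇔ (contradiction refl) (λ ())
true-Σ (suc n) {f} = mk⇔ forth back
  where
  forth : Nonzero (Σ< n f + f n) → ∃ λ i → i < suc n × Nonzero (f i)
  forth t with to (true-+ (Σ< n f)) t
  ... | inj₁ s = let i , i<n , p = to (true-Σ n) s in i , m<n⇒m<1+n i<n , p
  ... | inj₂ p = n , n<1+n n , p
  back : (∃ λ i → i < suc n × Nonzero (f i)) → Nonzero (Σ< n f + f n)
  back (i , i<1+n , p) with m<1+n⇒m<n∨m≡n i<1+n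
  ... | inj₁ i<n  = from (true-+ (Σ< n f)) (inj₁ (from (true-Σ n) (i , i<n , p)))
  ... | inj₂ refl = from (true-+ (Σ< n f)) (inj₂ p)

true-bool : ∀ b → Nonzero (bool→ℕ b) ⇔ (b ≡ true)
true-bool false = mk⇔ (contradiction refl) (λ ())
true-bool true  = mk⇔ (λ _ → refl) (λ _ ())

module _ (w u : List Bool) where

  private
    ws = words₂ w u

  -- The classical readings of `⊃` and `all<` are justified because `Nonzero` is decidable and,
  -- being a negation, stable under double negation.
  translate-correct : ∀ {d} (φ : Formula d) ρ → Nonzero (eval ws (translate φ) ρ) ⇔ sat w (tableOf w u) φ ρ
  translate-correct (a ≐ b) ρ rewrite lift₂-eval a w u ρ | lift₂-eval b w u ρ = mk⇔
    (λ t → let ≡0 = ¬Nonzero⇒≡0 (to (true-not (x ∸ y + (y ∸ x))) t) in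
           ≤-antisym (m∸n≡0⇒m≤n (m+n≡0⇒m≡0 (x ∸ y) ≡0)) (m∸n≡0⇒m≤n (m+n≡0⇒n≡0 (x ∸ y) ≡0)))
    (λ x≡y → from (true-not (x ∸ y + (y ∸ x)))
      λ t → t (cong₂ _+_ (m≤n⇒m∸n≡0 (≤-reflexive x≡y)) (m≤n⇒m∸n≡0 (≤-reflexive (sym x≡y)))))
    where
    x = ⟪ a ⟫ w ρ
    y = ⟪ b ⟫ w ρ
  translate-correct (a ≺ b) ρ rewrite lift₂-eval a w u ρ | lift₂-eval b w u ρ = true-∸ (⟪ b ⟫ w ρ) (⟪ a ⟫ w ρ)
  translate-correct (one a) ρ rewrite lift₂-eval a w u ρ = true-bool (nth w (⟪ a ⟫ w ρ))
  translate-correct (rel c a b e) ρ rewrite lift₂-eval a w u ρ | lift₂-eval b w u ρ | lift₂-eval e w u ρ =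
    true-bool (tableOf w u c (⟪ a ⟫ w ρ) (⟪ b ⟫ w ρ) (⟪ e ⟫ w ρ))
  translate-correct (~ φ)   ρ = ⇔-trans (true-not _) (¬-cong-⇔ (translate-correct φ ρ))
  translate-correct (φ & ψ) ρ = ⇔-trans (true-* (eval ws (translate φ) ρ) (eval ws (translate ψ) ρ)) (mk⇔
    (λ (p , q) → to (translate-correct φ ρ) p , to (translate-correct ψ ρ) q)
    (λ (p , q) → from (translate-correct φ ρ) p , from (translate-correct ψ ρ) q))
  translate-correct (φ ∥ ψ) ρ = ⇔-trans (true-+ (eval ws (translate φ) ρ)) (mk⇔
    (λ { (inj₁ p) → inj₁ (to (translate-correct φ ρ) p) ; (inj₂ q) → inj₂ (to (translate-correct ψ ρ) q) })
    (λ { (inj₁ p) → inj₁ (from (translate-correct φ ρ) p) ; (inj₂ q) → inj₂ (from (translate-correct ψ ρ) q) }))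
  translate-correct (φ ⊃ ψ) ρ = ⇔-trans (true-+ (1 ∸ eval ws (translate φ) ρ)) (mk⇔
    (λ { (inj₁ ¬p) p → contradiction (from (translate-correct φ ρ) p) (to (true-not _) ¬p)
       ; (inj₂ q) _ → to (translate-correct ψ ρ) q })
    λ f → decide f (nonzero? (eval ws (translate φ) ρ)))
    where
    decide : (sat w (tableOf w u) φ ρ → sat w (tableOf w u) ψ ρ) → Dec (Nonzero (eval ws (translate φ) ρ)) →
             Nonzero (1 ∸ eval ws (translate φ) ρ) ⊎ Nonzero (eval ws (translate ψ) ρ)
    decide f (yes p) = inj₂ (from (translate-correct ψ ρ) (f (to (translate-correct φ ρ) p)))
    decide f (no ¬p) = inj₁ (from (true-not _) ¬p)
  translate-correct (all< a φ) ρ rewrite lift₂-eval a w u ρ =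
    ⇔-trans (true-not _) (⇔-trans (¬-cong-⇔ (true-Σ (⟪ a ⟫ w ρ))) (mk⇔
    (λ ¬ex i i<n → to (translate-correct φ (i ∷ ρ)) (stable i λ ¬p → ¬ex (i , i<n , from (true-not _) ¬p)))
    (λ all (i , i<n , ¬p) → to (true-not _) ¬p (from (translate-correct φ (i ∷ ρ)) (all i i<n)))))
    where
    stable : ∀ i → ¬ ¬ Nonzero (eval ws (translate φ) (i ∷ ρ)) → Nonzero (eval ws (translate φ) (i ∷ ρ))
    stable i ¬¬t t = ¬¬t λ f → f t
  translate-correct (ex< a φ) ρ rewrite lift₂-eval a w u ρ = ⇔-trans (true-Σ (⟪ a ⟫ w ρ)) (mk⇔
    (λ (i , i<n , p) → i , i<n , to (translate-correct φ (i ∷ ρ)) p)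
    (λ (i , i<n , p) → i , i<n , from (translate-correct φ (i ∷ ρ)) p))

-- Relation tables as certificates of polynomial length

listing : (ℕ → Bool) → ℕ → List Bool
listing f zero    = []
listing f (suc n) = f 0 ∷ listing (f ∘ suc) n

length-listing : ∀ f n → length (listing f n) ≡ n
length-listing f zero    = refl
length-listing f (suc n) = cong suc (length-listing (f ∘ suc) n)

nth-listing : ∀ f n {i} → i < n → nth (listing f n) i ≡ f i
nth-listing f (suc n) {zero}  _         = refl
nth-listing f (suc n) {suc i} (s≤s i<n) = nth-listing (f ∘ suc) n i<n

size : ℕ → ℕ
size B = 4 * (B * (B * B))

digits : ∀ B .{{_ : NonZero B}} {x} y → x < B → (x + B * y) % B ≡ x × (x + B * y) / B ≡ y
digits B {x} y x<B rewrite *-comm B y = trans ([m+kn]%n≡m%n x y B) (m<n⇒m%n≡m x<B) , (begin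
  (x + y * B) / B       ≡⟨ +-distrib-/ x (y * B)
    (subst (_< B) (sym (cong₂ _+_ (m<n⇒m%n≡m x<B) (m*n%n≡0 y B)))
      (≤-trans (≤-reflexive (cong suc (+-identityʳ x))) x<B)) ⟩
  x / B + y * B / B     ≡⟨ cong₂ _+_ (m<n⇒m/n≡0 x<B) (m*n/n≡m y B) ⟩
  y                     ∎)
  where open ≡-Reasoning

digit-< : ∀ {B x y z} → x < B → y < z → x + B * y < B * z
digit-< {B} {x} {y} {z} x<B y<z = ≤-trans (+-monoˡ-≤ (B * y) x<B)
  (≤-trans (≤-reflexive (sym (*-suc B y))) (*-monoʳ-≤ B y<z))

fromTag : ℕ → Fin 4
fromTag 0 = zero
fromTag 1 = suc zero
fromTag 2 = suc (suc zero)
fromTag _ = suc (suc (suc zero))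

fromTag-toℕ : ∀ c → fromTag (toℕ c) ≡ c
fromTag-toℕ zero                   = refl
fromTag-toℕ (suc zero)             = refl
fromTag-toℕ (suc (suc zero))       = refl
fromTag-toℕ (suc (suc (suc zero))) = refl

module _ (G : Table) (N : ℕ) where

  private
    B = suc N

    cell : ℕ → Bool
    cell x = G (fromTag (x % 4)) (x / 4 % B) (x / 4 / B % B) (x / 4 / B / B)

  certificate : List Bool
  certificate = listing cell (size B)

  length-certificate : length certificate ≡ size B
  length-certificate = length-listing cell (size B)

  nth-certificate : ∀ c {i j k} → i ≤ N → j ≤ N → k ≤ N → nth certificate (address B (toℕ c) i j k) ≡ G c i j k
  nth-certificate c {i} {j} {k} i≤ j≤ k≤ = trans (nth-listing cell (size B) bound<) value
    where
    c<4 : toℕ c < 4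
    c<4 = toℕ<n c
    bound< : address B (toℕ c) i j k < size B
    bound< = digit-< c<4 (digit-< (s≤s i≤) (digit-< (s≤s j≤) (s≤s k≤)))
    value : cell (address B (toℕ c) i j k) ≡ G c i j k
    value rewrite proj₁ (digits 4 (i + B * (j + B * k)) c<4) | proj₂ (digits 4 (i + B * (j + B * k)) c<4)
                | proj₁ (digits B (j + B * k) (s≤s i≤)) | proj₂ (digits B (j + B * k) (s≤s i≤))
                | proj₁ (digits B k (s≤s j≤)) | proj₂ (digits B k (s≤s j≤)) =
      cong (λ c → G c i j k) (fromTag-toℕ c)

size-poly : IsPoly (λ n → size (suc n))
size-poly = poly-* (poly-const 4) (poly-* 1+n (poly-* 1+n 1+n))
  where 1+n = poly-+ (poly-const 1) poly-id

-- A certificate of polynomial length preserves a table only for arguments up to N. Completeness is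
-- therefore demanded for every table that agrees with the intended one there.
Agree : ℕ → Table → Table → Set
Agree N G G′ = ∀ c {i j k} → i ≤ N → j ≤ N → k ≤ N → G′ c i j k ≡ G c i j k

module _ {A : Language} (Φ : Formula 0)
         (sound : ∀ w G → sat w G Φ [] → A w)
         (complete : ∀ w → A w → ∃ λ G → ∀ G′ → Agree (length w) G G′ → sat w G′ Φ []) where

  private
    certifies : ∀ p → (∀ n → size (suc n) ≡ ⟦ p ⟧ n) → ∀ w →
      A w ⇔ ∃ λ u → length u ≤ ⟦ p ⟧ (length w) × Nonzero (eval (words₂ w u) (translate Φ) [])
    certifies p eq w = mk⇔
      (λ Aw → let G , agree = complete w Aw ; u = certificate G (length w) in
        u , ≤-reflexive (trans (length-certificate G (length w)) (eq (length w))) ,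
        from (translate-correct w u Φ []) (agree (tableOf w u) (nth-certificate G (length w))))
      (λ (u , _ , t) → sound w (tableOf w u) (to (translate-correct w u Φ []) t))

  inNP-by-formula : InNP A
  inNP-by-formula = inNP (translate Φ) (proj₁ size-poly) (certifies (proj₁ size-poly) (proj₂ size-poly))

-- Codes of instances

-- Beyond its end, w counts as continued by false.
record At (w : List Bool) (p : ℕ) (x : List Bool) : Set where
  constructor occurs
  field nth-≡ : ∀ i → i < length x → nth w (p + i) ≡ nth x i
open At

nth-++ˡ : ∀ x y {i} → i < length x → nth (x ++ y) i ≡ nth x i
nth-++ˡ (_ ∷ x) y {zero}  _         = refl
nth-++ˡ (_ ∷ x) y {suc i} (s≤s i<) = nth-++ˡ x y i<

nth-++ʳ : ∀ x y i → nth (x ++ y) (length x + i) ≡ nth y i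
nth-++ʳ []      y i = refl
nth-++ʳ (_ ∷ x) y i = nth-++ʳ x y i

At-++ : ∀ {w p x y} → At w p x → At w (p + length x) y → At w p (x ++ y)
nth-≡ (At-++ {w} {p} {x} {y} ax ay) i i< with i <? length x
... | yes i<x = trans (nth-≡ ax i i<x) (sym (nth-++ˡ x y i<x))
... | no i≮x with j , refl ← m≤n⇒∃[o]m+o≡n (≮⇒≥ i≮x) = begin
  nth w (p + (length x + j)) ≡⟨ cong (nth w) (+-assoc p (length x) j) ⟨
  nth w (p + length x + j)   ≡⟨ nth-≡ ay j
    (+-cancelˡ-< (length x) j (length y) (≤-trans i< (≤-reflexive (length-++ x)))) ⟩
  nth y j                    ≡⟨ nth-++ʳ x y j ⟨
  nth (x ++ y) (length x + j) ∎
  where open ≡-Reasoning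

At-++ˡ : ∀ {w p} x {y} → At w p (x ++ y) → At w p x
nth-≡ (At-++ˡ x {y} a) i i< = trans (nth-≡ a i (≤-trans i< (≤-trans (m≤m+n _ _) (≤-reflexive (sym (length-++ x))))))
  (nth-++ˡ x y i<)

At-++ʳ : ∀ {w p} x {y} → At w p (x ++ y) → At w (p + length x) y
nth-≡ (At-++ʳ {w} {p} x {y} a) i i< = begin
  nth w (p + length x + i)   ≡⟨ cong (nth w) (+-assoc p (length x) i) ⟩
  nth w (p + (length x + i)) ≡⟨ nth-≡ a (length x + i)
    (≤-trans (+-monoʳ-< (length x) i<) (≤-reflexive (sym (length-++ x)))) ⟩
  nth (x ++ y) (length x + i) ≡⟨ nth-++ʳ x y i ⟩
  nth y i                    ∎
  where open ≡-Reasoning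

At-self : ∀ w → At w 0 w
At-self w = occurs λ i i< → refl

-- The lengths are compared separately because `nth` cannot tell a trailing `false` from the end of
-- the word.
At⇒≡ : ∀ w x → length w ≡ length x → At w 0 x → w ≡ x
At⇒≡ []      []      _  _ = refl
At⇒≡ (_ ∷ w) (_ ∷ x) eq (occurs a) =
  cong₂ _∷_ (a 0 (s≤s z≤n)) (At⇒≡ w x (suc-injective eq) (occurs λ i i< → a (suc i) (s≤s i<)))

length-unary : ∀ k → length (unary k) ≡ suc k
length-unary zero    = refl
length-unary (suc k) = cong suc (length-unary k)

UnaryAt : List Bool → ℕ → ℕ → Set
UnaryAt w p k = (∀ i → i < k → nth w (p + i) ≡ true) × ¬ nth w (p + k) ≡ true

nth-unary : ∀ {i k} → i < k → nth (unary k) i ≡ true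
nth-unary {zero}  {suc k} _        = refl
nth-unary {suc i} {suc k} (s≤s i<) = nth-unary i<

nth-unary-end : ∀ k → nth (unary k) k ≡ false
nth-unary-end zero    = refl
nth-unary-end (suc k) = nth-unary-end k

¬true⇒false : ∀ {b} → b ≢ true → b ≡ false
¬true⇒false {false} _ = refl
¬true⇒false {true}  f = contradiction refl f

unaryAt⇔ : ∀ {w p k} → At w p (unary k) ⇔ UnaryAt w p k
unaryAt⇔ {w} {p} {k} = mk⇔
  (λ (occurs a) → (λ i i<k → trans (a i (≤-trans (m<n⇒m<1+n i<k) (≤-reflexive (sym (length-unary k)))))
    (nth-unary i<k)) ,
         λ t → case (trans (sym t) (trans (a k (≤-reflexive (sym (length-unary k)))) (nth-unary-end k))))
  λ (ones , end) → occurs λ i i< → go ones end i (≤-trans i< (≤-reflexive (length-unary k)))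
  where
  case : true ≢ false
  case ()
  go : (∀ i → i < k → nth w (p + i) ≡ true) → ¬ nth w (p + k) ≡ true → ∀ i → i < suc k →
       nth w (p + i) ≡ nth (unary k) i
  go ones end i i< with m<1+n⇒m<n∨m≡n i<
  ... | inj₁ i<k  = trans (ones i i<k) (sym (nth-unary i<k))
  ... | inj₂ refl = trans (¬true⇒false end) (sym (nth-unary-end k))

nth-toList : ∀ {n} (v : Vec Bool n) i → nth (toList v) (toℕ i) ≡ lookup v i
nth-toList (x ∷ v) zero    = refl
nth-toList (x ∷ v) (suc i) = nth-toList v i

vecAt⇔ : ∀ {n w p} (v : Vec Bool n) → At w p (toList v) ⇔ (∀ i → nth w (p + toℕ i) ≡ lookup v i)
vecAt⇔ {n} {w} {p} v = mk⇔
  (λ (occurs a) i → trans (a (toℕ i) (≤-trans (toℕ<n i) (≤-reflexive (sym (length-toList v))))) (nth-toList v i))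
  λ f → occurs λ i i< → let i<n = ≤-trans i< (≤-reflexive (length-toList v)) in
    subst (λ i → nth w (p + i) ≡ nth (toList v) i) (toℕ-fromℕ< i<n)
      (trans (f (fromℕ< i<n)) (sym (nth-toList v (fromℕ< i<n))))

length-rows : ∀ {m m′ k} (f : Fin m′ → Subset k) (h : Fin m → Fin m′) →
              length (concatMap (toList ∘ f) (List.tabulate h)) ≡ m * k
length-rows {zero}  f h = refl
length-rows {suc m} f h = trans (length-++ (toList (f (h zero))))
  (cong₂ _+_ (length-toList (f (h zero))) (length-rows f (h ∘ suc)))

length-matrix : ∀ {m k} (f : Fin m → Subset k) → length (matrix f) ≡ m * k
length-matrix f = length-rows f id

-- `allFin` is a `List.tabulate` whose index function changes from row to row; the induction is
-- therefore over an arbitrary `h`.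
rowsAt⇔ : ∀ {m m′ k w p} (f : Fin m′ → Subset k) (h : Fin m → Fin m′) →
          At w p (concatMap (toList ∘ f) (List.tabulate h)) ⇔
          (∀ i j → nth w (p + (toℕ i * k + toℕ j)) ≡ lookup (f (h i)) j)
rowsAt⇔ {zero}  f h = mk⇔ (λ _ ()) (λ _ → occurs λ _ ())
rowsAt⇔ {suc m} {k = k} {w} {p} f h = mk⇔
  (λ { a zero    j → to (vecAt⇔ (f (h zero))) (At-++ˡ {w} {p} (toList (f (h zero))) a) j
     ; a (suc i) j → trans (cong (nth w) (shift≡ i j))
       (to (rowsAt⇔ f (h ∘ suc)) (At-++ʳ {w} {p} (toList (f (h zero))) a) i j) })
  λ g → At-++ {w} {p} (from (vecAt⇔ (f (h zero))) (g zero))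
    (from (rowsAt⇔ f (h ∘ suc)) λ i j → trans (cong (nth w) (sym (shift≡ i j))) (g (suc i) j))
  where
  shift≡ : ∀ (i : Fin m) (j : Fin k) →
    p + (k + toℕ i * k + toℕ j) ≡ p + length (toList (f (h zero))) + (toℕ i * k + toℕ j)
  shift≡ i j rewrite length-toList (f (h zero)) | +-assoc k (toℕ i * k) (toℕ j) = sym (+-assoc p k _)

matrixAt⇔ : ∀ {m k w p} (f : Fin m → Subset k) →
            At w p (matrix f) ⇔ (∀ i j → nth w (p + (toℕ i * k + toℕ j)) ≡ lookup (f i) j)
matrixAt⇔ f = rowsAt⇔ f id

all-Fin : ∀ {n} {P : ℕ → Set} → (∀ i → i < n → P i) ⇔ (∀ (i : Fin n) → P (toℕ i))
all-Fin {P = P} = mk⇔ (λ f i → f (toℕ i) (toℕ<n i)) (λ f i i<n → subst P (toℕ-fromℕ< i<n) (f (fromℕ< i<n)))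

ex-Fin : ∀ {n} {P : ℕ → Set} → (∃ λ i → i < n × P i) ⇔ (∃ λ (i : Fin n) → P (toℕ i))
ex-Fin {P = P} = mk⇔ (λ (i , i<n , p) → fromℕ< i<n , subst P (sym (toℕ-fromℕ< i<n)) p)
                     (λ (i , p) → toℕ i , toℕ<n i , p)

-- Verifying certificates

v : ∀ k {d} {k<d : True (k <? d)} → Term d
v k {k<d = k<d} = var (#_ k {m<n = k<d})

∣w∣ : ∀ {d} → Term d
∣w∣ = len zero

-- The start of the code of s₀, of S, of R, of L and of the formula.
codeS₀ codeS codeR codeL codeF : ∀ {d} → Term d → Term d → Term d → Term d
codeS₀ n a s = (lit 1 ∔ n) ∔ (lit 1 ∔ a)
codeS  n a s = codeS₀ n a s ∔ (lit 1 ∔ s)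
codeR  n a s = codeS n a s ∔ n
codeL  n a s = codeR n a s ∔ n ∙ n
codeF  n a s = codeL n a s ∔ n ∙ a

unaryᶠ : ∀ {d} → Term d → Term d → Formula d
unaryᶠ p k = all< k (one (wk p ∔ v 0)) & ~ one (p ∔ k)

-- Pos x p q: the code of subformula x occupies positions p, …, q − 1 of w.
-- Val x i r: state i is in the r-th approximant of subformula x (r matters
-- only if x is a release formula).
-- St i, Tr i j: the states and transitions of the repaired structure.
Pos Val : ∀ {d} → Term d → Term d → Term d → Formula d
Pos = rel (# 0)
Val = rel (# 1)

St : ∀ {d} → Term d → Formula d
St i = rel (# 2) i (lit 0) (lit 0)

Tr : ∀ {d} → Term d → Term d → Formula d
Tr i j = rel (# 3) i j (lit 0)

_⇔ᶠ_ : ∀ {d} → Formula d → Formula d → Formula d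
φ ⇔ᶠ ψ = (φ ⊃ ψ) & (ψ ⊃ φ)

infix 0 _⇔ᶠ_

-- Variables, innermost first: s, a, n. `header` checks the input structure, `repair` the tables for
-- the substructure, `nodes` every node against its children, and `root` that some node covers the
-- rest of the word and holds at s.
header repair root nodes : Formula 3
header =
  unaryᶠ (lit 0) (v 2) & unaryᶠ (lit 1 ∔ v 2) (v 1) & unaryᶠ (codeS₀ (v 2) (v 1) (v 0)) (v 0) & v 0 ≺ v 2 &
  one (codeS (v 2) (v 1) (v 0) ∔ v 0) &
  all< (v 2) (all< (v 3) (one (codeR (v 4) (v 3) (v 2) ∔ (v 1 ∙ v 4 ∔ v 0)) ⊃
    one (codeS (v 4) (v 3) (v 2) ∔ v 1) & one (codeS (v 4) (v 3) (v 2) ∔ v 0))) &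
  all< (v 2) (one (codeS (v 3) (v 2) (v 1) ∔ v 0) ⊃ ex< (v 3) (one (codeR (v 4) (v 3) (v 2) ∔ (v 1 ∙ v 4 ∔ v 0))))
repair =
  St (v 0) & all< (v 2) (St (v 0) ⊃ one (codeS (v 3) (v 2) (v 1) ∔ v 0)) &
  all< (v 2) (all< (v 3) (Tr (v 1) (v 0) ⊃
    one (codeR (v 4) (v 3) (v 2) ∔ (v 1 ∙ v 4 ∔ v 0)) & St (v 1) & St (v 0))) &
  all< (v 2) (St (v 0) ⊃ ex< (v 3) (Tr (v 1) (v 0)))
-- The bounds place the root in the range over which `nodes` quantifies. Its end is the end of the
-- word, which fixes the length of the code.
root = codeF (v 2) (v 1) (v 0) ≺ lit 1 ∔ ∣w∣ & ex< ∣w∣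
  (Pos (v 0) (codeF (v 3) (v 2) (v 1)) ∣w∣ & Val (v 0) (v 1) (v 3))

-- Variables, innermost first: i, y, q, p, x, s, a, n.
unaryNode : ℕ → Formula 8 → Formula 6
unaryNode k θ =
  unaryᶠ (v 1) (lit k) & v 1 ∔ lit (suc k) ≺ lit 1 ∔ ∣w∣ &
  ex< ∣w∣ (Pos (v 0) (v 2 ∔ lit (suc k)) (v 1) & all< (v 6) (St (v 0) ⊃ (Val (v 4) (v 0) (v 7) ⇔ᶠ θ)))

-- Variables, innermost first: m, z, y, q, p, x, s, a, n.
binaryNode : ℕ → Formula 9 → Formula 6
binaryNode k θ =
  unaryᶠ (v 1) (lit k) & v 1 ∔ lit (suc k) ≺ lit 1 ∔ ∣w∣ &
  ex< ∣w∣ (ex< ∣w∣ (ex< (lit 1 ∔ ∣w∣) (Pos (v 2) (v 4 ∔ lit (suc k)) (v 0) & Pos (v 1) (v 0) (v 3) & θ)))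

-- Variables in the argument: i, m, z, y, q, p, x, s, a, n.
booleanBody : Formula 10 → Formula 9
booleanBody θ = all< (v 8) (St (v 0) ⊃ (Val (v 6) (v 0) (v 9) ⇔ᶠ θ))

-- Variables in the argument: i, r, m, z, y, q, p, x, s, a, n.
releaseBody : Formula 11 → Formula 9
releaseBody θ =
  all< (v 8) (St (v 0) ⊃ Val (v 6) (v 0) (lit 0)) &
  all< (v 8) (all< (v 9) (St (v 0) ⊃
    (Val (v 7) (v 0) (lit 1 ∔ v 1) ⇔ᶠ Val (v 3) (v 0) (v 10) & (Val (v 4) (v 0) (v 10) ∥ θ))))

negᶠ AXᶠ EXᶠ : Formula 8
negᶠ = ~ Val (v 1) (v 0) (v 7)
AXᶠ  = all< (v 7) (Tr (v 1) (v 0) ⊃ Val (v 2) (v 0) (v 8))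
EXᶠ  = ex< (v 7) (Tr (v 1) (v 0) & Val (v 2) (v 0) (v 8))

andᶠ orᶠ : Formula 10
andᶠ = Val (v 3) (v 0) (v 9) & Val (v 2) (v 0) (v 9)
orᶠ  = Val (v 3) (v 0) (v 9) ∥ Val (v 2) (v 0) (v 9)

ARᶠ ERᶠ : Formula 11
ARᶠ = all< (v 10) (Tr (v 1) (v 0) ⊃ Val (v 8) (v 0) (v 2))
ERᶠ = ex< (v 10) (Tr (v 1) (v 0) & Val (v 8) (v 0) (v 2))

-- Variables, innermost first: q, p, x, s, a, n.
node : Formula 6
node =
  unaryᶠ (v 1) (lit 0) & v 0 ≐ v 1 ∔ lit 1 & all< (v 5) (St (v 0) ⊃ Val (v 3) (v 0) (v 6)) ∥
  unaryᶠ (v 1) (lit 1) & v 0 ≐ v 1 ∔ lit 2 & all< (v 5) (St (v 0) ⊃ ~ Val (v 3) (v 0) (v 6)) ∥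
  unaryᶠ (v 1) (lit 2) & ex< (v 4) (unaryᶠ (v 2 ∔ lit 3) (v 0) & v 1 ≐ v 2 ∔ (lit 3 ∔ (lit 1 ∔ v 0)) &
    all< (v 6) (St (v 0) ⊃ (Val (v 4) (v 0) (v 7) ⇔ᶠ one (codeL (v 7) (v 6) (v 5) ∔ (v 0 ∙ v 6 ∔ v 1))))) ∥
  unaryNode 3 negᶠ ∥
  binaryNode 4 (booleanBody andᶠ) ∥
  binaryNode 5 (booleanBody orᶠ) ∥
  unaryNode 6 AXᶠ ∥
  unaryNode 7 EXᶠ ∥
  binaryNode 8 (releaseBody ARᶠ) ∥
  binaryNode 9 (releaseBody ERᶠ)

-- Only positions up to the length of the word are examined, so every node formula has to bound the
-- positions that it passes on to its children.
nodes = all< ∣w∣ (all< (lit 1 ∔ ∣w∣) (all< (lit 1 ∔ ∣w∣) (Pos (v 2) (v 1) (v 0) ⊃ node)))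

Φ : Formula 0
Φ = ex< ∣w∣ (ex< ∣w∣ (ex< ∣w∣ (header & repair & nodes & root)))

module Layout (n a s : ℕ) where
  atS₀ atS atR atL atF : ℕ
  atS₀ = suc n + suc a
  atS  = atS₀ + suc s
  atR  = atS + n
  atL  = atR + n * n
  atF  = atL + n * a

-- M is the repaired structure that tables 2 and 3 describe.
module Tables {n a} (M : Kripke n a) (G : Table)
  (S⇔ : ∀ i → G (# 2) (toℕ i) 0 0 ≡ true ⇔ i ∈ S M)
  (R⇔ : ∀ i j → G (# 3) (toℕ i) (toℕ j) 0 ≡ true ⇔ j ∈ R M i) where

  Computes : (ℕ → Set) → Pred n → Set
  Computes X P = ∀ i → i ∈ S M → X (toℕ i) ⇔ P i

  box⇔ : ∀ {X P} → Computes X P → ∀ i →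
         (∀ j → j < n → G (# 3) (toℕ i) j 0 ≡ true → X j) ⇔ □ₛ M P i
  box⇔ {X} c i = mk⇔
    (λ f j j∈ → to (c j (proj₂ (R⊆S² M j∈))) (f (toℕ j) (toℕ<n j) (from (R⇔ i j) j∈)))
    (λ f → from (all-Fin {P = λ j → G (# 3) (toℕ i) j 0 ≡ true → X j})
      λ j g → let j∈ = to (R⇔ i j) g in from (c j (proj₂ (R⊆S² M j∈))) (f j j∈))

  dia⇔ : ∀ {X P} → Computes X P → ∀ i →
         (∃ λ j → j < n × G (# 3) (toℕ i) j 0 ≡ true × X j) ⇔ ◇ₛ M P i
  dia⇔ {X} c i = mk⇔
    (λ e → let j , g , x = to (ex-Fin {P = λ j → G (# 3) (toℕ i) j 0 ≡ true × X j}) e ; j∈ = to (R⇔ i j) g in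
           j , j∈ , to (c j (proj₂ (R⊆S² M j∈))) x)
    (λ (j , j∈ , p) → toℕ j , toℕ<n j , from (R⇔ i j) j∈ , from (c j (proj₂ (R⊆S² M j∈))) p)

  members : ∀ {X : ℕ → Set} → (∀ i → i < n → G (# 2) i 0 0 ≡ true → X i) ⇔ (∀ i → i ∈ S M → X (toℕ i))
  members {X} = mk⇔
    (λ f i i∈ → f (toℕ i) (toℕ<n i) (from (S⇔ i) i∈))
    (λ f → from (all-Fin {P = λ i → G (# 2) i 0 0 ≡ true → X i}) λ i g → f i (to (S⇔ i) g))

lookup-ext : ∀ {A : Set} {n} {xs ys : Vec A n} → (∀ i → lookup xs i ≡ lookup ys i) → xs ≡ ys
lookup-ext {xs = xs} {ys} eq = trans (sym (tabulate∘lookup xs)) (trans (tabulate-cong eq) (tabulate∘lookup ys))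

pair⇔ : ∀ {A B : Set} → ((A → B) × (B → A)) ⇔ (A ⇔ B)
pair⇔ = mk⇔ (λ (f , g) → mk⇔ f g) (λ e → to e , from e)

At-unary : ∀ {w p x} k → UnaryAt w p k → At w (p + suc k) x → At w p (unary k ++ x)
At-unary {w} {p} {x} k u ax = At-++ (from unaryAt⇔ u) (subst (λ l → At w (p + l) x) (sym (length-unary k)) ax)

At-unary⁻¹ : ∀ {w p x} k → At w p (unary k ++ x) → UnaryAt w p k × At w (p + suc k) x
At-unary⁻¹ {w} {p} {x} k at =
  to unaryAt⇔ (At-++ˡ (unary k) at) , subst (λ l → At w (p + l) x) (length-unary k) (At-++ʳ (unary k) at)

-- Soundness: an instance and its repair from an accepted certificate

module Soundness (w : List Bool) (G : Table) (n a s : ℕ)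
  (h : sat w G header (s ∷ a ∷ n ∷ [])) (rp : sat w G repair (s ∷ a ∷ n ∷ []))
  (nd : sat w G nodes (s ∷ a ∷ n ∷ [])) (rt : sat w G root (s ∷ a ∷ n ∷ [])) where

  open Layout n a s

  N : ℕ
  N = length w

  s<n : s < n
  s<n = proj₁ (proj₂ (proj₂ (proj₂ h)))

  S₁ : Subset n
  S₁ = Vec.tabulate (λ i → nth w (atS + toℕ i))
  R₁ : Fin n → Subset n
  R₁ i = Vec.tabulate (λ j → nth w (atR + (toℕ i * n + toℕ j)))
  L₁ : Fin n → Subset a
  L₁ i = Vec.tabulate (λ p → nth w (atL + (toℕ i * a + toℕ p)))

  ∈S₁ : ∀ {i} → i ∈ S₁ ⇔ nth w (atS + toℕ i) ≡ true
  ∈S₁ = ∈-tabulate _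
  ∈R₁ : ∀ {i j} → j ∈ R₁ i ⇔ nth w (atR + (toℕ i * n + toℕ j)) ≡ true
  ∈R₁ = ∈-tabulate _

  M : Kripke n a
  M = record
    { s₀   = fromℕ< s<n
    ; S    = S₁
    ; R    = R₁
    ; L    = L₁
    ; s₀∈S = from ∈S₁ (subst (λ s → nth w (atS + s) ≡ true) (sym (toℕ-fromℕ< s<n))
      (proj₁ (proj₂ (proj₂ (proj₂ (proj₂ h))))))
    ; R⊆S² = λ {i} {j} j∈ → let p , q = proj₁ (proj₂ (proj₂ (proj₂ (proj₂ (proj₂ h))))) (toℕ i) (toℕ<n i) (toℕ j) (toℕ<n j) (to (∈R₁ {i}) j∈)
                            in from ∈S₁ p , from ∈S₁ q
    }

  M-total : Total M
  M-total {i} i∈ =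
    let j , p = to (ex-Fin {P = λ j → nth w (atR + (toℕ i * n + j)) ≡ true})
                  (proj₂ (proj₂ (proj₂ (proj₂ (proj₂ (proj₂ h))))) (toℕ i) (toℕ<n i) (to ∈S₁ i∈))
    in j , from (∈R₁ {i}) p

  S₂ : Subset n
  S₂ = Vec.tabulate (λ i → G (# 2) (toℕ i) 0 0)
  R₂ : Fin n → Subset n
  R₂ i = Vec.tabulate (λ j → G (# 3) (toℕ i) (toℕ j) 0)

  ∈S₂ : ∀ i → G (# 2) (toℕ i) 0 0 ≡ true ⇔ i ∈ S₂
  ∈S₂ i = ⇔-sym (∈-tabulate _)
  ∈R₂ : ∀ i j → G (# 3) (toℕ i) (toℕ j) 0 ≡ true ⇔ j ∈ R₂ i
  ∈R₂ i j = ⇔-sym (∈-tabulate _)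

  R₂-facts : ∀ {i j} → j ∈ R₂ i → j ∈ R₁ i × i ∈ S₂ × j ∈ S₂
  R₂-facts {i} {j} j∈ =
    let p , q , r = proj₁ (proj₂ (proj₂ rp)) (toℕ i) (toℕ<n i) (toℕ j) (toℕ<n j) (from (∈R₂ i j) j∈)
    in from (∈R₁ {i}) p , to (∈S₂ i) q , to (∈S₂ j) r

  M′ : Kripke n a
  M′ = record
    { s₀   = fromℕ< s<n
    ; S    = S₂
    ; R    = R₂
    ; L    = L₁
    ; s₀∈S = to (∈S₂ _) (subst (λ s → G (# 2) s 0 0 ≡ true) (sym (toℕ-fromℕ< s<n)) (proj₁ rp))
    ; R⊆S² = λ j∈ → proj₂ (R₂-facts j∈)
    }

  M′-total : Total M′
  M′-total {i} i∈ =
    let j , p = to (ex-Fin {P = λ j → G (# 3) (toℕ i) j 0 ≡ true})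
                  (proj₂ (proj₂ (proj₂ rp)) (toℕ i) (toℕ<n i) (from (∈S₂ i) i∈))
    in j , to (∈R₂ i j) p

  M′⊑M : M′ ⊑ M
  M′⊑M = record
    { S⊆  = λ {i} i∈ → from ∈S₁ (proj₁ (proj₂ rp) (toℕ i) (toℕ<n i) (from (∈S₂ i) i∈))
    ; s₀≡ = refl
    ; R⊆  = λ i j∈ → proj₁ (R₂-facts j∈)
    ; L≡  = λ _ → refl
    }

  open Tables M′ G ∈S₂ ∈R₂

  val : ℕ → ℕ → ℕ → Set
  val x r i = G (# 1) x i r ≡ true

  record Represents (x p q : ℕ) : Set where
    constructor represents
    field
      φ     : CTL a
      code  : At w p (encodeCTL φ)
      end   : p + length (encodeCTL φ) ≡ q
      value : Computes (val x n) (MC M′ φ)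

  computed : ∀ {x} {X : ℕ → Set} {P : Pred n} →
    (∀ i → i < n → G (# 2) i 0 0 ≡ true → (val x n i → X i) × (X i → val x n i)) → Computes X P → Computes (val x n) P
  computed f c i i∈ = ⇔-trans (to pair⇔ (to members f i i∈)) (c i i∈)

  -- Treats both path quantifiers at once: `Q` is the next-time operator on states and `θ` its
  -- rendering in the certificate.
  stageC : ∀ {x y z φ ψ} {θ : ℕ → ℕ → Set} {Q : Pred n → Pred n} {st : ℕ → Pred n} →
    (∀ i → st 0 i) → (∀ r {i} → st (suc r) i ⇔ (MC M′ ψ i × (MC M′ φ i ⊎ Q (st r) i))) →
    (∀ r → Computes (val x r) (st r) → Computes (θ r) (Q (st r))) →
    Computes (val y n) (MC M′ φ) → Computes (val z n) (MC M′ ψ) →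
    (∀ i → i < n → G (# 2) i 0 0 ≡ true → val x 0 i) →
    (∀ r → r < n → ∀ i → i < n → G (# 2) i 0 0 ≡ true →
      (val x (suc r) i → val z n i × (val y n i ⊎ θ r i)) × (val z n i × (val y n i ⊎ θ r i) → val x (suc r) i)) →
    ∀ r → r ≤ n → Computes (val x r) (st r)
  stageC st₀ stₛ c cφ cψ base step zero    r≤n i i∈ = mk⇔ (λ _ → st₀ i) (λ _ → to members base i i∈)
  stageC {φ = φ} {ψ} {Q = Q} {st} st₀ stₛ c cφ cψ base step (suc r) r≤n i i∈ =
    ⇔-trans (to pair⇔ (to members (step r r≤n) i i∈))
    (⇔-trans (_×-⇔_ (cψ i i∈) (_⊎-⇔_ (cφ i i∈)
      (c r (stageC {φ = φ} {ψ} {Q = Q} {st} st₀ stₛ c cφ cψ base step r (<⇒≤ r≤n)) i i∈)))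
             (⇔-sym (stₛ r)))

  end₁ : ∀ {p q} k l → p + suc k + l ≡ q → p + (suc k + l) ≡ q
  end₁ {p} k l e = trans (sym (+-assoc p (suc k) l)) e

  end₂ : ∀ {p m q} k l (x y : List Bool) → p + suc k + length x ≡ m → m + length y ≡ q → l ≡ length (x ++ y) →
         p + (suc k + l) ≡ q
  end₂ {p} k l x y refl refl refl = trans (cong (λ l → p + (suc k + l)) (length-++ x))
    (trans (sym (+-assoc p (suc k) _)) (sym (+-assoc (p + suc k) (length x) (length y))))

  At₂ : ∀ {p m x y} k → UnaryAt w p k → At w (p + suc k) x → p + suc k + length x ≡ m → At w m y →
        At w p (unary k ++ x ++ y)
  At₂ {x = x} k u ax refl ay = At-unary k u (At-++ {x = x} ax ay)

  -- Children start strictly later than their parent, and no start exceeds N; hence f, with N < p +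
  -- f, is enough fuel. The second child starts where the first ends, which is known only after the
  -- first has been parsed.
  parse : ∀ f x p q → N < p + f → x < N → p < suc N → q < suc N → G (# 0) x p q ≡ true → Represents x p q
  parse zero    x p q N<p x<N p≤N q≤N pos = contradiction p≤N (<⇒≱ (s≤s (≤-trans N<p (≤-reflexive (+-identityʳ p)))))
  parse (suc f) x p q N<p x<N p≤N q≤N pos = go (nd x x<N p p≤N q q≤N pos)
    where
    later : ∀ k → N < p + suc k + f
    later k = ≤-trans N<p (≤-trans (≤-reflexive (+-suc p f))
      (≤-trans (s≤s (+-monoˡ-≤ f (m≤m+n p k))) (≤-reflexive (cong (_+ f) (sym (+-suc p k))))))
    child : ∀ k {y q} → y < N → p + suc k < suc N → q < suc N → G (# 0) y (p + suc k) q ≡ true →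
      Represents y (p + suc k) q
    child k y<N p<N q<N g = parse f _ _ _ (later k) y<N p<N q<N g
    child₂ : ∀ k {z m q} → p + suc k ≤ m → z < N → m < suc N → q < suc N → G (# 0) z m q ≡ true → Represents z m q
    child₂ k ≤m z<N m<N q<N g = parse f _ _ _ (≤-trans (later k) (+-monoˡ-≤ f ≤m)) z<N m<N q<N g
    below : ∀ {y m} k (r : Represents y (p + suc k) m) → p + suc k ≤ m
    below k (represents φ _ refl _) = m≤m+n (p + suc k) _
    go : sat w G node (q ∷ p ∷ x ∷ s ∷ a ∷ n ∷ []) → Represents x p q
    go (inj₁ (u , e , f)) = represents tt (from unaryAt⇔ u) (sym e) λ i i∈ →
      mk⇔ (λ _ → unit) (λ _ → to members f i i∈)
    go (inj₂ (inj₁ (u , e , f))) = represents ff (from unaryAt⇔ u) (sym e) λ i i∈ → mk⇔ (to members f i i∈) λ ()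
    go (inj₂ (inj₂ (inj₁ (u , c , c<a , u′ , e , f)))) = represents (atom (fromℕ< c<a))
      (At-unary 2 u (from unaryAt⇔ (subst (UnaryAt w (p + 3)) (sym (toℕ-fromℕ< c<a)) u′)))
      (trans (cong (λ l → p + (3 + l)) (trans (length-unary _) (cong suc (toℕ-fromℕ< c<a)))) (sym e))
      (computed f λ i i∈ → ⇔-trans
        (≡⇒⇔ (cong (λ c → nth w (atL + (toℕ i * a + c)) ≡ true) (sym (toℕ-fromℕ< c<a)))) (⇔-sym (∈-tabulate _)))
    go (inj₂ (inj₂ (inj₂ (inj₁ (u , p< , y , y< , g , f))))) =
      let represents φ at e val = child 3 y< p< q≤N g in
      represents (neg φ) (At-unary 3 u at) (end₁ 3 _ e) (computed f λ i i∈ → ¬-cong-⇔ (val i i∈))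
    go (inj₂ (inj₂ (inj₂ (inj₂ (inj₁ (u , p< , y , y< , z , z< , m , m< , g , g′ , f)))))) =
      let r@(represents φ at e val) = child 4 y< p< m< g
          represents ψ at′ e′ val′ = child₂ 4 (below 4 r) z< m< q≤N g′ in
      represents (φ and ψ) (At₂ 4 u at e at′) (end₂ 4 _ (encodeCTL φ) (encodeCTL ψ) e e′ refl)
        (computed f λ i i∈ → _×-⇔_ (val i i∈) (val′ i i∈))
    go (inj₂ (inj₂ (inj₂ (inj₂ (inj₂ (inj₁ (u , p< , y , y< , z , z< , m , m< , g , g′ , f))))))) =
      let r@(represents φ at e val) = child 5 y< p< m< g
          represents ψ at′ e′ val′ = child₂ 5 (below 5 r) z< m< q≤N g′ in
      represents (φ or ψ) (At₂ 5 u at e at′) (end₂ 5 _ (encodeCTL φ) (encodeCTL ψ) e e′ refl)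
        (computed f λ i i∈ → _⊎-⇔_ (val i i∈) (val′ i i∈))
    go (inj₂ (inj₂ (inj₂ (inj₂ (inj₂ (inj₂ (inj₁ (u , p< , y , y< , g , f)))))))) =
      let represents φ at e val = child 6 y< p< q≤N g in
      represents (AX φ) (At-unary 6 u at) (end₁ 6 _ e) (computed f λ i i∈ → box⇔ val i)
    go (inj₂ (inj₂ (inj₂ (inj₂ (inj₂ (inj₂ (inj₂ (inj₁ (u , p< , y , y< , g , f))))))))) =
      let represents φ at e val = child 7 y< p< q≤N g in
      represents (EX φ) (At-unary 7 u at) (end₁ 7 _ e) (computed f λ i i∈ → dia⇔ val i)
    go (inj₂ (inj₂ (inj₂ (inj₂ (inj₂
      (inj₂ (inj₂ (inj₂ (inj₁ (u , p< , y , y< , z , z< , m , m< , g , g′ , b , f)))))))))) =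
      let r@(represents φ at e val) = child 8 y< p< m< g
          represents ψ at′ e′ val′ = child₂ 8 (below 8 r) z< m< q≤N g′ in
      represents A[ φ V ψ ] (At₂ 8 u at e at′) (end₂ 8 _ (encodeCTL φ) (encodeCTL ψ) e e′ refl)
        (stageC {φ = φ} {ψ} {Q = □ₛ M′} {st = stageA M′ φ ψ} (λ _ → unit) (λ r → mk⇔ id id) (λ r c i i∈ →
          box⇔ c i) val val′ b f n ≤-refl)
    go (inj₂ (inj₂ (inj₂ (inj₂ (inj₂
      (inj₂ (inj₂ (inj₂ (inj₂ (u , p< , y , y< , z , z< , m , m< , g , g′ , b , f)))))))))) =
      let r@(represents φ at e val) = child 9 y< p< m< g
          represents ψ at′ e′ val′ = child₂ 9 (below 9 r) z< m< q≤N g′ in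
      represents E[ φ V ψ ] (At₂ 9 u at e at′) (end₂ 9 _ (encodeCTL φ) (encodeCTL ψ) e e′ refl)
        (stageC {φ = φ} {ψ} {Q = ◇ₛ M′} {st = stageE M′ φ ψ} (λ _ → unit) (λ r → mk⇔ id id) (λ r c i i∈ →
          dia⇔ c i) val val′ b f n ≤-refl)

At-split : ∀ {w p} x {y l} → length x ≡ l → At w p (x ++ y) ⇔ (At w p x × At w (p + l) y)
At-split x refl = mk⇔ (λ at → At-++ˡ x at , At-++ʳ x at) (λ (ax , ay) → At-++ ax ay)

module Code (I : Instance) where
  open Instance I
  open Layout n a (toℕ (s₀ M)) public

  Encoded : List Bool → Set
  Encoded w =
    UnaryAt w 0 n × UnaryAt w (suc n) a × UnaryAt w atS₀ (toℕ (s₀ M)) ×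
    (∀ i → nth w (atS + toℕ i) ≡ lookup (S M) i) ×
    (∀ i j → nth w (atR + (toℕ i * n + toℕ j)) ≡ lookup (R M i) j) ×
    (∀ i p → nth w (atL + (toℕ i * a + toℕ p)) ≡ lookup (L M i) p) ×
    At w atF (encodeCTL η)

  encoded⇔ : ∀ w → At w 0 (encode I) ⇔ Encoded w
  encoded⇔ w =
    ⇔-trans (At-split (unary n) (length-unary n)) (_×-⇔_ unaryAt⇔
    (⇔-trans (At-split (unary a) (length-unary a)) (_×-⇔_ unaryAt⇔
    (⇔-trans (At-split (unary (toℕ (s₀ M))) (length-unary (toℕ (s₀ M)))) (_×-⇔_ unaryAt⇔
    (⇔-trans (At-split (toList (S M)) (length-toList (S M))) (_×-⇔_ (vecAt⇔ (S M))
    (⇔-trans (At-split (matrix (R M)) (length-matrix (R M))) (_×-⇔_ (matrixAt⇔ (R M))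
    (⇔-trans (At-split (matrix (L M)) (length-matrix (L M))) (_×-⇔_ (matrixAt⇔ (L M)) (mk⇔ id id))))))))))))

  length-encode : length (encode I) ≡ atF + length (encodeCTL η)
  length-encode =
    trans (split 0 (unary n) y₁ (length-unary n))
    (trans (split (suc n) (unary a) y₂ (length-unary a))
    (trans (split atS₀ (unary (toℕ (s₀ M))) y₃ (length-unary (toℕ (s₀ M))))
    (trans (split atS (toList (S M)) y₄ (length-toList (S M)))
    (trans (split atR (matrix (R M)) y₅ (length-matrix (R M)))
           (split atL (matrix (L M)) (encodeCTL η) (length-matrix (L M)))))))
    where
    y₁ y₂ y₃ y₄ y₅ : List Bool
    y₅ = matrix (L M) ++ encodeCTL η
    y₄ = matrix (R M) ++ y₅
    y₃ = toList (S M) ++ y₄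
    y₂ = unary (toℕ (s₀ M)) ++ y₃
    y₁ = unary a ++ y₂
    split : ∀ p (x y : List Bool) {l} → length x ≡ l → p + length (x ++ y) ≡ p + l + length y
    split p x y refl = trans (cong (p +_) (length-++ x)) (sym (+-assoc p (length x) (length y)))

Φ-sound : ∀ w G → sat w G Φ [] → ModelRepair w
Φ-sound w G (n , _ , a , _ , s , _ , h , rp , nd , rt@(atF< , x , x<N , pos , s∈φ)) =
  I , sym (At⇒≡ w (encode I) total-length whole) ,
  M′ , M′-total , M′⊑M ,
  to (MC-correct M′ M′-total φ (s₀∈S M′)) (to (value (fromℕ< s<n) (s₀∈S M′))
    (subst (λ s → G (# 1) x s n ≡ true) (sym (toℕ-fromℕ< s<n)) s∈φ))
  where
  open Soundness w G n a s h rp nd rt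
  open Layout n a s
  r : Represents x atF N
  r = parse (suc N) x atF N (m≤n+m (suc N) atF) x<N atF< ≤-refl pos
  open Represents r
  I : Instance
  I = record { M = M ; total = M-total ; η = φ }
  s≡ : toℕ (s₀ M) ≡ s
  s≡ = toℕ-fromℕ< s<n
  -- The number of the initial state equals s by a proof, not by computation, and every later offset
  -- depends on it; generalising it allows the equation to be matched.
  pieces : ∀ s′ → s′ ≡ s → let module L = Layout n a s′ in
    UnaryAt w 0 n × UnaryAt w (suc n) a × UnaryAt w L.atS₀ s′ ×
    (∀ i → nth w (L.atS + toℕ i) ≡ lookup (S M) i) ×
    (∀ i j → nth w (L.atR + (toℕ i * n + toℕ j)) ≡ lookup (R M i) j) ×
    (∀ i p → nth w (L.atL + (toℕ i * a + toℕ p)) ≡ lookup (L M i) p) ×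
    At w L.atF (encodeCTL φ)
  pieces _ refl = proj₁ h , proj₁ (proj₂ h) , proj₁ (proj₂ (proj₂ h)) ,
    (λ i → sym (lookup∘tabulate _ i)) , (λ i j → sym (lookup∘tabulate _ j)) , (λ i p → sym (lookup∘tabulate _ p)) ,
      code
  whole : At w 0 (encode I)
  whole = from (Code.encoded⇔ I w) (pieces _ s≡)
  total-length : length w ≡ length (encode I)
  total-length = trans (sym end)
    (trans (cong (λ s → Layout.atF n a s + length (encodeCTL φ)) (sym s≡)) (sym (Code.length-encode I)))

-- p is the position at which the code of φ starts.
sub : ∀ {a} → CTL a → ℕ → List (ℕ × CTL a)
sub tt         p = []
sub ff         p = []
sub (atom _)   p = []
sub (neg φ)    p = (p + 4 , φ) ∷ []
sub (φ and ψ)  p = (p + 5 , φ) ∷ (p + 5 + length (encodeCTL φ) , ψ) ∷ []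
sub (φ or ψ)   p = (p + 6 , φ) ∷ (p + 6 + length (encodeCTL φ) , ψ) ∷ []
sub (AX φ)     p = (p + 7 , φ) ∷ []
sub (EX φ)     p = (p + 8 , φ) ∷ []
sub A[ φ V ψ ] p = (p + 9 , φ) ∷ (p + 9 + length (encodeCTL φ) , ψ) ∷ []
sub E[ φ V ψ ] p = (p + 10 , φ) ∷ (p + 10 + length (encodeCTL φ) , ψ) ∷ []

-- The place in this list serves as the name of a node. Equal subformulas at different positions are
-- different nodes.
subs : ∀ {a} → CTL a → ℕ → List (ℕ × CTL a)
subs tt         p = (p , tt) ∷ []
subs ff         p = (p , ff) ∷ []
subs (atom c)   p = (p , atom c) ∷ []
subs (neg φ)    p = (p , neg φ) ∷ subs φ (p + 4)
subs (φ and ψ)  p = (p , (φ and ψ)) ∷ subs φ (p + 5) ++ subs ψ (p + 5 + length (encodeCTL φ))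
subs (φ or ψ)   p = (p , (φ or ψ)) ∷ subs φ (p + 6) ++ subs ψ (p + 6 + length (encodeCTL φ))
subs (AX φ)     p = (p , AX φ) ∷ subs φ (p + 7)
subs (EX φ)     p = (p , EX φ) ∷ subs φ (p + 8)
subs A[ φ V ψ ] p = (p , A[ φ V ψ ]) ∷ subs φ (p + 9) ++ subs ψ (p + 9 + length (encodeCTL φ))
subs E[ φ V ψ ] p = (p , E[ φ V ψ ]) ∷ subs φ (p + 10) ++ subs ψ (p + 10 + length (encodeCTL φ))

module _ {a : ℕ} where

  Closed : List (ℕ × CTL a) → Set
  Closed l = ∀ {q χ c} → (q , χ) ∈ˡ l → c ∈ˡ sub χ q → c ∈ˡ l

  self∈ : ∀ (φ : CTL a) p → (p , φ) ∈ˡ subs φ p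
  self∈ tt         p = here refl
  self∈ ff         p = here refl
  self∈ (atom _)   p = here refl
  self∈ (neg φ)    p = here refl
  self∈ (φ and ψ)  p = here refl
  self∈ (φ or ψ)   p = here refl
  self∈ (AX φ)     p = here refl
  self∈ (EX φ)     p = here refl
  self∈ A[ φ V ψ ] p = here refl
  self∈ E[ φ V ψ ] p = here refl

  closed₁ : ∀ {p q χ φ} → sub χ p ≡ (q , φ) ∷ [] → Closed (subs φ q) → Closed ((p , χ) ∷ subs φ q)
  closed₁ eq cl (here refl) c∈ rewrite eq with here refl ← c∈ = there (self∈ _ _)
  closed₁ eq cl (there x∈)  c∈ = there (cl x∈ c∈)

  closed₂ : ∀ {p q q′ χ φ ψ} → sub χ p ≡ (q , φ) ∷ (q′ , ψ) ∷ [] → Closed (subs φ q) → Closed (subs ψ q′) →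
            Closed ((p , χ) ∷ subs φ q ++ subs ψ q′)
  closed₂ {q = q} {φ = φ} eq cl cl′ (here refl) c∈ rewrite eq with c∈
  ... | here refl         = there (∈-++⁺ˡ (self∈ _ _))
  ... | there (here refl) = there (∈-++⁺ʳ (subs φ q) (self∈ _ _))
  closed₂ {q = q} {φ = φ} eq cl cl′ (there x∈)  c∈ with ∈-++⁻ (subs φ q) x∈
  ... | inj₁ x∈₁ = there (∈-++⁺ˡ (cl x∈₁ c∈))
  ... | inj₂ x∈₂ = there (∈-++⁺ʳ (subs φ q) (cl′ x∈₂ c∈))

  subs-closed : ∀ φ p → Closed (subs φ p)
  subs-closed tt         p (here refl) ()
  subs-closed ff         p (here refl) ()
  subs-closed (atom _)   p (here refl) ()
  subs-closed (neg φ)    p = closed₁ refl (subs-closed φ _)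
  subs-closed (φ and ψ)  p = closed₂ refl (subs-closed φ _) (subs-closed ψ _)
  subs-closed (φ or ψ)   p = closed₂ refl (subs-closed φ _) (subs-closed ψ _)
  subs-closed (AX φ)     p = closed₁ refl (subs-closed φ _)
  subs-closed (EX φ)     p = closed₁ refl (subs-closed φ _)
  subs-closed A[ φ V ψ ] p = closed₂ refl (subs-closed φ _) (subs-closed ψ _)
  subs-closed E[ φ V ψ ] p = closed₂ refl (subs-closed φ _) (subs-closed ψ _)

  subs-length₁ : ∀ {k l e} → l ≤ e → suc l ≤ suc k + e
  subs-length₁ {k} {l} {e} l≤e = s≤s (≤-trans l≤e (m≤n+m e k))

  subs-length₂ : ∀ k (φ ψ : CTL a) {q q′} → length (subs φ q) ≤ length (encodeCTL φ) →
    length (subs ψ q′) ≤ length (encodeCTL ψ) →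
                 suc (length (subs φ q ++ subs ψ q′)) ≤ suc k + length (encodeCTL φ ++ encodeCTL ψ)
  subs-length₂ k φ ψ {q} l≤ l′≤ = subs-length₁ {k} (≤-trans (≤-reflexive (length-++ (subs φ q)))
    (≤-trans (+-mono-≤ l≤ l′≤) (≤-reflexive (sym (length-++ (encodeCTL φ))))))

  -- Every node contributes at least one bit of its own to the code; so node names stay below the
  -- length of the word.
  subs-length : ∀ (φ : CTL a) p → length (subs φ p) ≤ length (encodeCTL φ)
  subs-length tt         p = s≤s z≤n
  subs-length ff         p = s≤s z≤n
  subs-length (atom _)   p = s≤s z≤n
  subs-length (neg φ)    p = subs-length₁ {3} (subs-length φ _)
  subs-length (φ and ψ)  p = subs-length₂ 4 φ ψ (subs-length φ _) (subs-length ψ _)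
  subs-length (φ or ψ)   p = subs-length₂ 5 φ ψ (subs-length φ _) (subs-length ψ _)
  subs-length (AX φ)     p = subs-length₁ {6} (subs-length φ _)
  subs-length (EX φ)     p = subs-length₁ {7} (subs-length φ _)
  subs-length A[ φ V ψ ] p = subs-length₂ 8 φ ψ (subs-length φ _) (subs-length ψ _)
  subs-length E[ φ V ψ ] p = subs-length₂ 9 φ ψ (subs-length φ _) (subs-length ψ _)

  Located : List Bool → ℕ × CTL a → Set
  Located w (p , φ) = At w p (encodeCTL φ) × p + length (encodeCTL φ) ≤ length w

  located₁ : ∀ {w p} k (φ : CTL a) → At w p (unary k ++ encodeCTL φ) → p + (suc k + length (encodeCTL φ)) ≤ length w →
             Located w (p + suc k , φ)
  located₁ {p = p} k φ at p≤ = proj₂ (At-unary⁻¹ k at) , ≤-trans (≤-reflexive (+-assoc p (suc k) _)) p≤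

  located₂ : ∀ {w p} k (φ ψ : CTL a) → At w p (unary k ++ encodeCTL φ ++ encodeCTL ψ) →
             p + (suc k + length (encodeCTL φ ++ encodeCTL ψ)) ≤ length w →
             Located w (p + suc k , φ) × Located w (p + suc k + length (encodeCTL φ) , ψ)
  located₂ {w} {p} k φ ψ at p≤ =
    (At-++ˡ (encodeCTL φ) at′ , ≤-trans (m≤m+n _ _) bound′) , (At-++ʳ (encodeCTL φ) at′ , bound′)
    where
    at′ = proj₂ (At-unary⁻¹ k at)
    bound′ : p + suc k + length (encodeCTL φ) + length (encodeCTL ψ) ≤ length w
    bound′ = ≤-trans (≤-reflexive (trans (+-assoc (p + suc k) _ _)
      (trans (cong (p + suc k +_) (sym (length-++ (encodeCTL φ)))) (+-assoc p (suc k) _)))) p≤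

  at-first : ∀ {w q φ} {c : ℕ × CTL a} → Located w (q , φ) → c ∈ˡ (q , φ) ∷ [] → Located w c
  at-first loc (here refl) = loc

  at-either : ∀ {w q φ q′ ψ} {c : ℕ × CTL a} → Located w (q , φ) × Located w (q′ , ψ) →
              c ∈ˡ (q , φ) ∷ (q′ , ψ) ∷ [] → Located w c
  at-either (loc , _) (here refl)         = loc
  at-either (_ , loc) (there (here refl)) = loc

  sub-located : ∀ {w} φ p {c} → Located w (p , φ) → c ∈ˡ sub φ p → Located w c
  sub-located {w} (neg φ)    p (at , ≤N) = at-first {w} (located₁ 3 φ at ≤N)
  sub-located {w} (φ and ψ)  p (at , ≤N) = at-either {w} (located₂ 4 φ ψ at ≤N)
  sub-located {w} (φ or ψ)   p (at , ≤N) = at-either {w} (located₂ 5 φ ψ at ≤N)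
  sub-located {w} (AX φ)     p (at , ≤N) = at-first {w} (located₁ 6 φ at ≤N)
  sub-located {w} (EX φ)     p (at , ≤N) = at-first {w} (located₁ 7 φ at ≤N)
  sub-located {w} A[ φ V ψ ] p (at , ≤N) = at-either {w} (located₂ 8 φ ψ at ≤N)
  sub-located {w} E[ φ V ψ ] p (at , ≤N) = at-either {w} (located₂ 9 φ ψ at ≤N)

  module _ {w : List Bool} where

    mutual
      subs-located : ∀ φ p {c} → Located w (p , φ) → c ∈ˡ subs φ p → Located w c
      subs-located tt         p loc (here refl) = loc
      subs-located ff         p loc (here refl) = loc
      subs-located (atom _)   p loc (here refl) = loc
      subs-located (neg φ)    p loc = step₁ φ loc (sub-located (neg φ) p loc)
      subs-located (φ and ψ)  p loc = step₂ φ ψ loc (sub-located (φ and ψ) p loc)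
      subs-located (φ or ψ)   p loc = step₂ φ ψ loc (sub-located (φ or ψ) p loc)
      subs-located (AX φ)     p loc = step₁ φ loc (sub-located (AX φ) p loc)
      subs-located (EX φ)     p loc = step₁ φ loc (sub-located (EX φ) p loc)
      subs-located A[ φ V ψ ] p loc = step₂ φ ψ loc (sub-located A[ φ V ψ ] p loc)
      subs-located E[ φ V ψ ] p loc = step₂ φ ψ loc (sub-located E[ φ V ψ ] p loc)

      step₁ : ∀ φ {q x c} → Located w x → (∀ {c} → c ∈ˡ (q , φ) ∷ [] → Located w c) →
              c ∈ˡ x ∷ subs φ q → Located w c
      step₁ φ     loc loc′ (here refl) = loc
      step₁ φ {q} loc loc′ (there c∈)  = subs-located φ q (loc′ (here refl)) c∈

      step₂ : ∀ φ ψ {q q′ x c} → Located w x → (∀ {c} → c ∈ˡ (q , φ) ∷ (q′ , ψ) ∷ [] → Located w c) →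
              c ∈ˡ x ∷ subs φ q ++ subs ψ q′ → Located w c
      step₂ φ ψ          loc loc′ (here refl) = loc
      step₂ φ ψ {q} {q′} loc loc′ (there c∈) with ∈-++⁻ (subs φ q) c∈
      ... | inj₁ c∈₁ = subs-located φ q (loc′ (here refl)) c∈₁
      ... | inj₂ c∈₂ = subs-located ψ q′ (loc′ (there (here refl))) c∈₂

entryAt : ∀ {A : Set} → List A → ℕ → Maybe A
entryAt []       _       = nothing
entryAt (x ∷ xs) zero    = just x
entryAt (x ∷ xs) (suc i) = entryAt xs i

entryAt-∈ : ∀ {A : Set} {x : A} {xs} → x ∈ˡ xs → ∃ λ i → i < length xs × entryAt xs i ≡ just x
entryAt-∈ (here refl) = 0 , s≤s z≤n , refl
entryAt-∈ (there x∈)  = let i , i< , eq = entryAt-∈ x∈ in suc i , s≤s i< , eq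

∈-entryAt : ∀ {A : Set} {x : A} xs {i} → entryAt xs i ≡ just x → x ∈ˡ xs
∈-entryAt (x ∷ xs) {zero}  refl = here refl
∈-entryAt (x ∷ xs) {suc i} eq   = there (∈-entryAt xs eq)

stageOf : ∀ {n a} → Kripke n a → CTL a → ℕ → Pred n
stageOf M A[ φ V ψ ] = stageA M φ ψ
stageOf M E[ φ V ψ ] = stageE M φ ψ
stageOf M φ          = λ _ → MC M φ

stageOf? : ∀ {n a} (M : Kripke n a) φ r i → Dec (stageOf M φ r i)
stageOf? M tt         r i = MC? M tt i
stageOf? M ff         r i = MC? M ff i
stageOf? M (atom c)   r i = MC? M (atom c) i
stageOf? M (neg φ)    r i = MC? M (neg φ) i
stageOf? M (φ and ψ)  r i = MC? M (φ and ψ) i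
stageOf? M (φ or ψ)   r i = MC? M (φ or ψ) i
stageOf? M (AX φ)     r i = MC? M (AX φ) i
stageOf? M (EX φ)     r i = MC? M (EX φ) i
stageOf? M A[ φ V ψ ] r i = stageA? M φ ψ r i
stageOf? M E[ φ V ψ ] r i = stageE? M φ ψ r i

stageOf-n : ∀ {n a} (M : Kripke n a) φ {i} → stageOf M φ n i ⇔ MC M φ i
stageOf-n M tt         = mk⇔ id id
stageOf-n M ff         = mk⇔ id id
stageOf-n M (atom c)   = mk⇔ id id
stageOf-n M (neg φ)    = mk⇔ id id
stageOf-n M (φ and ψ)  = mk⇔ id id
stageOf-n M (φ or ψ)   = mk⇔ id id
stageOf-n M (AX φ)     = mk⇔ id id
stageOf-n M (EX φ)     = mk⇔ id id
stageOf-n M A[ φ V ψ ] = mk⇔ id id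
stageOf-n M E[ φ V ψ ] = mk⇔ id id

-- Table arguments are arbitrary numbers; outside the range of `Fin n` the answer is negative.
onFin : ∀ {n} {P : Fin n → Set} → (∀ i → Dec (P i)) → ∀ x → Dec (∃ λ i → toℕ i ≡ x × P i)
onFin P? x = any? (λ i → (toℕ i ≟ x) ×-dec P? i)

onFin⇔ : ∀ {n} {P : Fin n → Set} (P? : ∀ i → Dec (P i)) i → does (onFin P? (toℕ i)) ≡ true ⇔ P i
onFin⇔ {P = P} P? i = ⇔-trans (does-true (onFin P? (toℕ i)))
  (mk⇔ (λ (j , eq , p) → subst P (toℕ-injective eq) p) (λ p → i , refl , p))

-- Completeness: the certificate of a given repair

module Completeness (I : Instance) (M′ : Kripke (Instance.n I) (Instance.a I)) (total′ : Total M′)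
                    (M′⊑M : M′ ⊑ Instance.M I) (holds : M′ , s₀ (Instance.M I) ⊨ Instance.η I) where
  open Instance I
  open Code I
  open _⊑_ M′⊑M

  w : List Bool
  w = encode I

  N s : ℕ
  N = length w
  s = toℕ (s₀ M)

  nodesOf : List (ℕ × CTL a)
  nodesOf = subs η atF

  pos? : ∀ (e : Maybe (ℕ × CTL a)) p q → Dec (∃ λ φ → e ≡ just (p , φ) × q ≡ p + length (encodeCTL φ))
  pos? nothing         p q = no λ ()
  pos? (just (p′ , φ)) p q with p′ ≟ p | q ≟ p′ + length (encodeCTL φ)
  ... | no p≢    | _        = no λ { (_ , refl , _) → p≢ refl }
  ... | yes refl | no q≢    = no λ { (_ , refl , refl) → q≢ refl }
  ... | yes refl | yes refl = yes (φ , refl , refl)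

  valueOf : Maybe (ℕ × CTL a) → ℕ → ℕ → Bool
  valueOf nothing        i r = false
  valueOf (just (_ , φ)) i r = does (onFin (stageOf? M′ φ r) i)

  G : Table
  G zero                   x p q = does (pos? (entryAt nodesOf x) p q)
  G (suc zero)             x i r = valueOf (entryAt nodesOf x) i r
  G (suc (suc zero))       i _ _ = does (onFin (_∈? S M′) i)
  G (suc (suc (suc zero))) i j _ = does (onFin (λ i → onFin (_∈? R M′ i) j) i)

  atS≤atF : atS ≤ atF
  atS≤atF = ≤-trans (m≤m+n atS n) (≤-trans (m≤m+n atR (n * n)) (m≤m+n atL (n * a)))

  atF≤N : atF ≤ N
  atF≤N = ≤-trans (m≤m+n atF _) (≤-reflexive (sym length-encode))

  atS≤N : atS ≤ N
  atS≤N = ≤-trans atS≤atF atF≤N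

  n<N : n < N
  n<N = ≤-trans (≤-trans (m≤m+n (suc n) (suc a)) (m≤m+n atS₀ (suc s))) atS≤N

  a<N : a < N
  a<N = ≤-trans (≤-trans (m≤n+m (suc a) (suc n)) (m≤m+n atS₀ (suc s))) atS≤N

  s<N : s < N
  s<N = ≤-trans (m≤n+m (suc s) atS₀) atS≤N

  encoded : Encoded w
  encoded = to (encoded⇔ w) (At-self w)

  atSets : ∀ i → nth w (atS + toℕ i) ≡ lookup (S M) i
  atSets = proj₁ (proj₂ (proj₂ (proj₂ encoded)))
  atRows : ∀ i j → nth w (atR + (toℕ i * n + toℕ j)) ≡ lookup (R M i) j
  atRows = proj₁ (proj₂ (proj₂ (proj₂ (proj₂ encoded))))
  atLabels : ∀ i c → nth w (atL + (toℕ i * a + toℕ c)) ≡ lookup (L M i) c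
  atLabels = proj₁ (proj₂ (proj₂ (proj₂ (proj₂ (proj₂ encoded)))))

  ∈⇔ : ∀ {m} {p : Subset m} {i} → lookup p i ≡ true ⇔ i ∈ p
  ∈⇔ {p = p} {i} = mk⇔ (lookup⇒[]= i p) []=⇒lookup

  inS : ∀ i → nth w (atS + toℕ i) ≡ true ⇔ i ∈ S M
  inS i = ⇔-trans (≡⇒⇔ (cong (_≡ true) (atSets i))) ∈⇔
  inR : ∀ i j → nth w (atR + (toℕ i * n + toℕ j)) ≡ true ⇔ j ∈ R M i
  inR i j = ⇔-trans (≡⇒⇔ (cong (_≡ true) (atRows i j))) ∈⇔

  located : ∀ {c} → c ∈ˡ nodesOf → Located w c
  located = subs-located η atF (proj₂ (proj₂ (proj₂ (proj₂ (proj₂ (proj₂ encoded))))) ,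
    ≤-reflexive (sym length-encode))

  index : ∀ {c} → c ∈ˡ nodesOf → ∃ λ x → x < N × entryAt nodesOf x ≡ just c
  index c∈ = let x , x< , eq = entryAt-∈ c∈ in
    x , ≤-trans x< (≤-trans (subs-length η atF) (≤-trans (m≤n+m _ atF) (≤-reflexive (sym length-encode)))) , eq

  module _ (G′ : Table) (agree : Agree N G G′) where

    private
      ∀n : ∀ (i : Fin n) → toℕ i ≤ N
      ∀n i = <⇒≤ (<-trans (toℕ<n i) n<N)

    S⇔ : ∀ i → G′ (# 2) (toℕ i) 0 0 ≡ true ⇔ i ∈ S M′
    S⇔ i = ⇔-trans (≡⇒⇔ (cong (_≡ true) (agree (# 2) (∀n i) z≤n z≤n))) (onFin⇔ (_∈? S M′) i)

    R⇔ : ∀ i j → G′ (# 3) (toℕ i) (toℕ j) 0 ≡ true ⇔ j ∈ R M′ i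
    R⇔ i j = ⇔-trans (≡⇒⇔ (cong (_≡ true) (agree (# 3) (∀n i) (∀n j) z≤n)))
      (⇔-trans (onFin⇔ (λ i → onFin (_∈? R M′ i) (toℕ j)) i)
        (⇔-trans (⇔-sym (does-true (onFin (_∈? R M′ i) (toℕ j)))) (onFin⇔ (_∈? R M′ i) j)))

    open Tables M′ G′ S⇔ R⇔

    Node : ℕ → ℕ → CTL a → Set
    Node x p φ = x < N × entryAt nodesOf x ≡ just (p , φ)

    val⇔ : ∀ {x p φ} → Node x p φ → ∀ {r} → r ≤ n → ∀ i → G′ (# 1) x (toℕ i) r ≡ true ⇔ stageOf M′ φ r i
    val⇔ {φ = φ} (x<N , eq) {r} r≤n i = ⇔-trans (≡⇒⇔ (cong (_≡ true)
      (trans (agree (# 1) (<⇒≤ x<N) (∀n i) (≤-trans r≤n (<⇒≤ n<N))) (cong (λ e → valueOf e (toℕ i) r) eq))))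
      (onFin⇔ (stageOf? M′ φ r) i)

    MC⇔ : ∀ {x p φ} → Node x p φ → ∀ i → G′ (# 1) x (toℕ i) n ≡ true ⇔ MC M′ φ i
    MC⇔ {φ = φ} nx i = ⇔-trans (val⇔ nx ≤-refl i) (stageOf-n M′ φ)

    pos⇔ : ∀ {x p q} → x < N → p ≤ N → q ≤ N →
      G′ (# 0) x p q ≡ true ⇔ (∃ λ φ → entryAt nodesOf x ≡ just (p , φ) × q ≡ p + length (encodeCTL φ))
    pos⇔ {x} {p} {q} x<N p≤N q≤N = ⇔-trans (≡⇒⇔ (cong (_≡ true) (agree (# 0) (<⇒≤ x<N) p≤N q≤N)))
      (does-true (pos? (entryAt nodesOf x) p q))

    node-located : ∀ {x p φ} → Node x p φ → Located w (p , φ)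
    node-located (_ , eq) = located (∈-entryAt nodesOf eq)

    child : ∀ {x p φ c} → Node x p φ → c ∈ˡ sub φ p → ∃ λ y → Node y (proj₁ c) (proj₂ c)
    child (_ , eq) c∈ = index (subs-closed η atF (∈-entryAt nodesOf eq) c∈)

    node-pos : ∀ {x p φ} → Node x p φ → G′ (# 0) x p (p + length (encodeCTL φ)) ≡ true
    node-pos {φ = φ} nx@(x<N , eq) = let _ , ≤N = node-located nx in
      from (pos⇔ x<N (≤-trans (m≤m+n _ _) ≤N) ≤N) (φ , eq , refl)

    SatNode : Formula 6 → ℕ → ℕ → CTL a → Set
    SatNode θ x p φ = sat w G′ θ (p + length (encodeCTL φ) ∷ p ∷ x ∷ s ∷ a ∷ n ∷ [])

    on-members : ∀ {X Y : ℕ → Set} → (∀ i → i ∈ S M′ → X (toℕ i) ⇔ Y (toℕ i)) →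
      ∀ i → i < n → G′ (# 2) i 0 0 ≡ true → (X i → Y i) × (Y i → X i)
    on-members f = from members (λ i i∈ → from pair⇔ (f i i∈))

    unary-node : ∀ k θ {x p φ χ} → Node x p χ → sub χ p ≡ (p + suc k , φ) ∷ [] →
      encodeCTL χ ≡ unary k ++ encodeCTL φ →
      (∀ {y} → Node y (p + suc k) φ → ∀ i →
        MC M′ χ i ⇔ sat w G′ θ (toℕ i ∷ y ∷ p + length (encodeCTL χ) ∷ p ∷ x ∷ s ∷ a ∷ n ∷ [])) →
      SatNode (unaryNode k θ) x p χ
    unary-node k θ {x} {p} {φ} {χ} nx sub≡ code≡ step
      with y , ny ← child nx (subst (_ ∈ˡ_) (sym sub≡) (here refl)) =
      proj₁ (At-unary⁻¹ k (subst (At w p) code≡ (proj₁ (node-located nx)))) ,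
      s≤s (≤-trans (m≤m+n _ _) (proj₂ (node-located ny))) ,
      y , proj₁ ny , subst (λ q → G′ (# 0) y (p + suc k) q ≡ true) end (node-pos ny) ,
      on-members (λ i i∈ → ⇔-trans (MC⇔ nx i) (step ny i))
      where
      end : p + suc k + length (encodeCTL φ) ≡ p + length (encodeCTL χ)
      end = trans (+-assoc p (suc k) _) (cong (p +_) (sym (trans (cong length code≡)
        (trans (length-++ (unary k)) (cong (_+ length (encodeCTL φ)) (length-unary k))))))

    binary-node : ∀ k θ {x p φ ψ χ} → Node x p χ →
      sub χ p ≡ (p + suc k , φ) ∷ (p + suc k + length (encodeCTL φ) , ψ) ∷ [] →
      encodeCTL χ ≡ unary k ++ encodeCTL φ ++ encodeCTL ψ →
      (∀ {y z} → Node y (p + suc k) φ → Node z (p + suc k + length (encodeCTL φ)) ψ →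
        sat w G′ θ (p + suc k + length (encodeCTL φ) ∷ z ∷ y ∷ p + length (encodeCTL χ) ∷ p ∷ x ∷ s ∷ a ∷ n ∷ [])) →
      SatNode (binaryNode k θ) x p χ
    binary-node k θ {x} {p} {φ} {ψ} {χ} nx sub≡ code≡ step
      with y , ny ← child nx (subst (_ ∈ˡ_) (sym sub≡) (here refl))
      with z , nz ← child nx (subst (_ ∈ˡ_) (sym sub≡) (there (here refl))) =
      proj₁ (At-unary⁻¹ k (subst (At w p) code≡ (proj₁ (node-located nx)))) ,
      s≤s (≤-trans (m≤m+n _ _) (proj₂ (node-located ny))) ,
      y , proj₁ ny , z , proj₁ nz , p + suc k + length (encodeCTL φ) , s≤s (proj₂ (node-located ny)) ,
      node-pos ny ,
      subst (λ q → G′ (# 0) z (p + suc k + length (encodeCTL φ)) q ≡ true) end (node-pos nz) ,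
      step ny nz
      where
      end : p + suc k + length (encodeCTL φ) + length (encodeCTL ψ) ≡ p + length (encodeCTL χ)
      end = trans (+-assoc (p + suc k) _ _) (trans (cong (p + suc k +_) (sym (length-++ (encodeCTL φ))))
        (trans (+-assoc p (suc k) _) (cong (p +_) (sym (trans (cong length code≡)
        (trans (length-++ (unary k)) (cong (_+ length (encodeCTL φ ++ encodeCTL ψ)) (length-unary k))))))))

    boolean-node : ∀ k θ {x p φ ψ χ} → Node x p χ →
      sub χ p ≡ (p + suc k , φ) ∷ (p + suc k + length (encodeCTL φ) , ψ) ∷ [] →
      encodeCTL χ ≡ unary k ++ encodeCTL φ ++ encodeCTL ψ →
      (∀ {y z} → Node y (p + suc k) φ → Node z (p + suc k + length (encodeCTL φ)) ψ → ∀ i →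
        MC M′ χ i ⇔
        sat w G′ θ (toℕ i ∷ p + suc k + length (encodeCTL φ) ∷ z ∷ y ∷ p + length
          (encodeCTL χ) ∷ p ∷ x ∷ s ∷ a ∷ n ∷ [])) →
      SatNode (binaryNode k (booleanBody θ)) x p χ
    boolean-node k θ nx sub≡ code≡ step = binary-node k (booleanBody θ) nx sub≡ code≡
      λ ny nz → on-members (λ i i∈ → ⇔-trans (MC⇔ nx i) (step ny nz i))

    release-node : ∀ k θ {x p φ ψ χ} {Q : Pred n → Pred n} → Node x p χ →
      sub χ p ≡ (p + suc k , φ) ∷ (p + suc k + length (encodeCTL φ) , ψ) ∷ [] →
      encodeCTL χ ≡ unary k ++ encodeCTL φ ++ encodeCTL ψ →
      (∀ i → stageOf M′ χ 0 i) →
      (∀ r {i} → stageOf M′ χ (suc r) i ⇔ (MC M′ ψ i × (MC M′ φ i ⊎ Q (stageOf M′ χ r) i))) →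
      (∀ {y z} r → r < n → ∀ i → Q (stageOf M′ χ r) i ⇔
        sat w G′ θ (toℕ i ∷ r ∷ p + suc k + length (encodeCTL φ) ∷ z ∷ y ∷ p + length
          (encodeCTL χ) ∷ p ∷ x ∷ s ∷ a ∷ n ∷ [])) →
      SatNode (binaryNode k (releaseBody θ)) x p χ
    release-node k θ {χ = χ} nx sub≡ code≡ base unfold step = binary-node k (releaseBody θ) nx sub≡ code≡
      λ {y} {z} ny nz →
        from members (λ i i∈ → from (val⇔ nx z≤n i) (base i)) ,
        λ r r<n → on-members (λ i i∈ → ⇔-trans (val⇔ nx r<n i) (⇔-trans (unfold r)
          (_×-⇔_ (⇔-sym (MC⇔ nz i)) (_⊎-⇔_ (⇔-sym (MC⇔ ny i)) (step {y} {z} r r<n i)))))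

    node-sat : ∀ {x p} φ → Node x p φ → SatNode node x p φ
    node-sat {x} {p} tt nx = inj₁ (to unaryAt⇔ (proj₁ (node-located nx)) , refl ,
      from members (λ i i∈ → from (MC⇔ nx i) unit))
    node-sat {x} {p} ff nx = inj₂ (inj₁ (to unaryAt⇔ (proj₁ (node-located nx)) , refl ,
      from members (λ i i∈ → to (MC⇔ nx i))))
    node-sat {x} {p} (atom c) nx = inj₂ (inj₂ (inj₁ (proj₁ split , toℕ c , toℕ<n c , to unaryAt⇔ (proj₂ split) ,
      cong (λ l → p + (3 + l)) (length-unary (toℕ c)) ,
      on-members (λ i i∈ → ⇔-trans (MC⇔ nx i) (⇔-trans (≡⇒⇔ (cong (c ∈_) (L≡ i∈)))
        (⇔-sym (⇔-trans (≡⇒⇔ (cong (_≡ true) (atLabels i c))) ∈⇔)))))))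
      where split = At-unary⁻¹ 2 (proj₁ (node-located nx))
    node-sat (neg φ) nx = inj₂ (inj₂
      (inj₂ (inj₁ (unary-node 3 negᶠ nx refl refl λ ny i → ¬-cong-⇔ (⇔-sym (MC⇔ ny i))))))
    node-sat (φ and ψ) nx = inj₂ (inj₂ (inj₂ (inj₂ (inj₁ (boolean-node 4 andᶠ nx refl refl
      λ ny nz i → _×-⇔_ (⇔-sym (MC⇔ ny i)) (⇔-sym (MC⇔ nz i)))))))
    node-sat (φ or ψ) nx = inj₂ (inj₂ (inj₂ (inj₂ (inj₂ (inj₁ (boolean-node 5 orᶠ nx refl refl
      λ ny nz i → _⊎-⇔_ (⇔-sym (MC⇔ ny i)) (⇔-sym (MC⇔ nz i))))))))
    node-sat (AX φ) nx = inj₂ (inj₂ (inj₂ (inj₂ (inj₂ (inj₂ (inj₁ (unary-node 6 AXᶠ nx refl refl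
      λ ny i → ⇔-sym (box⇔ (λ j _ → MC⇔ ny j) i))))))))
    node-sat (EX φ) nx = inj₂ (inj₂ (inj₂ (inj₂ (inj₂ (inj₂ (inj₂ (inj₁ (unary-node 7 EXᶠ nx refl refl
      λ ny i → ⇔-sym (dia⇔ (λ j _ → MC⇔ ny j) i)))))))))
    node-sat A[ φ V ψ ] nx = inj₂ (inj₂
      (inj₂ (inj₂ (inj₂ (inj₂ (inj₂ (inj₂ (inj₁ (release-node 8 ARᶠ {Q = □ₛ M′} nx refl refl
      (λ _ → unit) (λ r → mk⇔ id id) (λ r r<n i → ⇔-sym (box⇔ (λ j _ → val⇔ nx (<⇒≤ r<n) j) i)))))))))))
    node-sat E[ φ V ψ ] nx = inj₂ (inj₂
      (inj₂ (inj₂ (inj₂ (inj₂ (inj₂ (inj₂ (inj₂ (release-node 9 ERᶠ {Q = ◇ₛ M′} nx refl refl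
      (λ _ → unit) (λ r → mk⇔ id id) (λ r r<n i → ⇔-sym (dia⇔ (λ j _ → val⇔ nx (<⇒≤ r<n) j) i)))))))))))

    header-sat : sat w G′ header (s ∷ a ∷ n ∷ [])
    header-sat = proj₁ encoded , proj₁ (proj₂ encoded) , proj₁ (proj₂ (proj₂ encoded)) , toℕ<n (s₀ M) ,
      from (inS (s₀ M)) (s₀∈S M) ,
      from (all-Fin {P = λ i → ∀ j → j < n → nth w (atR + (i * n + j)) ≡ true →
                               nth w (atS + i) ≡ true × nth w (atS + j) ≡ true})
        (λ i → from (all-Fin {P = λ j → nth w (atR + (toℕ i * n + j)) ≡ true →
                                        nth w (atS + toℕ i) ≡ true × nth w (atS + j) ≡ true})
          λ j e → let p , q = R⊆S² M (to (inR i j) e) in from (inS i) p , from (inS j) q) ,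
      from (all-Fin {P = λ i → nth w (atS + i) ≡ true → ∃ λ j → j < n × nth w (atR + (i * n + j)) ≡ true})
        (λ i e → let j , j∈ = total (to (inS i) e) in toℕ j , toℕ<n j , from (inR i j) j∈)

    repair-sat : sat w G′ repair (s ∷ a ∷ n ∷ [])
    repair-sat = from (S⇔ (s₀ M)) (subst (_∈ S M′) s₀≡ (s₀∈S M′)) ,
      from members (λ i i∈ → from (inS i) (S⊆ i∈)) ,
      from (all-Fin {P = λ i → ∀ j → j < n → G′ (# 3) i j 0 ≡ true →
          nth w (atR + (i * n + j)) ≡ true × G′ (# 2) i 0 0 ≡ true × G′ (# 2) j 0 0 ≡ true})
        (λ i → from (all-Fin {P = λ j → G′ (# 3) (toℕ i) j 0 ≡ true →
            nth w (atR + (toℕ i * n + j)) ≡ true × G′ (# 2) (toℕ i) 0 0 ≡ true × G′ (# 2) j 0 0 ≡ true})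
          λ j e → let j∈ = to (R⇔ i j) e ; p , q = R⊆S² M′ j∈ in
            from (inR i j) (R⊆ i j∈) , from (S⇔ i) p , from (S⇔ j) q) ,
      from members (λ i i∈ → let j , j∈ = total′ i∈ in toℕ j , toℕ<n j , from (R⇔ i j) j∈)

    nodes-sat : sat w G′ nodes (s ∷ a ∷ n ∷ [])
    nodes-sat x x<N p p≤N q q≤N e with φ , eq , refl ← to (pos⇔ x<N (s≤s⁻¹ p≤N) (s≤s⁻¹ q≤N)) e =
      node-sat φ (x<N , eq)

    root-sat : sat w G′ root (s ∷ a ∷ n ∷ [])
    root-sat = let x , nx = index (self∈ η atF) in s≤s atF≤N , x , proj₁ nx ,
      subst (λ q → G′ (# 0) x atF q ≡ true) (sym length-encode) (node-pos nx) ,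
      from (MC⇔ nx (s₀ M)) (from (MC-correct M′ total′ η (subst (_∈ S M′) s₀≡ (s₀∈S M′))) holds)

    Φ-sat : sat w G′ Φ []
    Φ-sat = n , n<N , a , a<N , s , s<N , header-sat , repair-sat , nodes-sat , root-sat

Φ-complete : ∀ w → ModelRepair w → ∃ λ G → ∀ G′ → Agree (length w) G G′ → sat w G′ Φ []
Φ-complete _ (I , refl , M′ , total′ , M′⊑M , holds) = G , Φ-sat
  where open Completeness I M′ total′ M′⊑M holds

modelRepair-inNP : InNP ModelRepair
modelRepair-inNP = inNP-by-formula Φ Φ-sound Φ-complete

-- Propositional formulas over a star

isSuc-+ : ∀ m n → isSuc (m + n) ≡ isSuc m ∨ isSuc n
isSuc-+ zero    n = refl
isSuc-+ (suc m) n = refl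

isSuc-* : ∀ m n → isSuc (m * n) ≡ isSuc m ∧ isSuc n
isSuc-* zero    n       = refl
isSuc-* (suc m) zero    = cong isSuc (*-zeroʳ m)
isSuc-* (suc m) (suc n) = refl

isSuc-∸ : ∀ m n → isSuc (n ∸ m) ≡ (m <ᵇ n)
isSuc-∸ zero    zero    = refl
isSuc-∸ zero    (suc n) = refl
isSuc-∸ (suc m) zero    = refl
isSuc-∸ (suc m) (suc n) = isSuc-∸ m n

isSuc-eq : ∀ m n → isSuc (1 ∸ ((m ∸ n) + (n ∸ m))) ≡ (m ≡ᵇ n)
isSuc-eq zero    zero    = refl
isSuc-eq zero    (suc n) = cong isSuc (0∸n≡0 n)
isSuc-eq (suc m) zero    = cong isSuc (0∸n≡0 (m + 0))
isSuc-eq (suc m) (suc n) = isSuc-eq m n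

-- One of the two truncated differences is zero, so their sum is the distance of a and b.
eqᴱ : ∀ {d} → Term d → Term d → Term d
eqᴱ a b = lit 1 ∸̇ ((a ∸̇ b) ∔ (b ∸̇ a))

cat<-cong : ∀ n {f g} → (∀ i → i < n → f i ≡ g i) → cat< n f ≡ cat< n g
cat<-cong zero    f≡g = refl
cat<-cong (suc n) f≡g = cong₂ _++_ (cat<-cong n (λ i i<n → f≡g i (m<n⇒m<1+n i<n))) (f≡g n (n<1+n n))

cat<-suc : ∀ n f → cat< (suc n) f ≡ f 0 ++ cat< n (f ∘ suc)
cat<-suc zero    f = sym (++-identityʳ (f 0))
cat<-suc (suc n) f = trans (cong (_++ f (suc n)) (cat<-suc n f)) (++-assoc (f 0) _ _)

cat<-[] : ∀ n → cat< n (λ _ → []) ≡ []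
cat<-[] zero    = refl
cat<-[] (suc n) = trans (++-identityʳ _) (cat<-[] n)

cat<-true : ∀ n → cat< n (λ _ → true ∷ []) ≡ replicate n true
cat<-true zero    = refl
cat<-true (suc n) = trans (cat<-suc n (λ _ → true ∷ [])) (cong (true ∷_) (cat<-true n))

bitsO : ∀ {d} → List Bool → Out 1 d
bitsO []       = ε
bitsO (b ∷ bs) = put b ⊹ bitsO bs

unaryO : ∀ {d} → Term d → Out 1 d
unaryO a = for a (put true) ⊹ put false

unaryO-eval : ∀ {d} ws a (ρ : Vec ℕ d) → evalO ws (unaryO a) ρ ≡ unary (eval ws a ρ)
unaryO-eval ws a ρ = cong (_++ false ∷ []) (cat<-true (eval ws a ρ))

-- A loop is the only control structure; each of the two loops makes 0 or 1 rounds, and exactly one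
-- of them makes 1.
ifO : ∀ {d} → Term d → Out 1 d → Out 1 d → Out 1 d
ifO a o o′ = for (lit 1 ∸̇ (lit 1 ∸̇ a)) (wkO o) ⊹ for (lit 1 ∸̇ a) (wkO o′)

ifO-eval : ∀ {d} ws a o o′ (ρ : Vec ℕ d) →
           evalO ws (ifO a o o′) ρ ≡ (if isSuc (eval ws a ρ) then evalO ws o ρ else evalO ws o′ ρ)
ifO-eval ws a o o′ ρ with eval ws a ρ
... | zero  = refl
... | suc n rewrite 0∸n≡0 n = ++-identityʳ _

-- letO binds the value of a: the body is run in that iteration only.
letO : ∀ {d} → Term d → Out 1 (suc d) → Out 1 d
letO a o = for (lit 1 ∔ a) (ifO (eqᴱ (v 0) (wk a)) o ε)

letO-eval : ∀ {d} ws a o (ρ : Vec ℕ d) → evalO ws (letO a o) ρ ≡ evalO ws o (eval ws a ρ ∷ ρ)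
letO-eval ws a o ρ = cong₂ _++_ (trans (cat<-cong n skip) (cat<-[] n))
  (trans (body n) (cong (λ b → if b then evalO ws o (n ∷ ρ) else []) (≡ᵇ-refl n)))
  where
  n = eval ws a ρ
  body : ∀ i → evalO ws (ifO (eqᴱ (v 0) (wk a)) o ε) (i ∷ ρ) ≡ (if i ≡ᵇ n then evalO ws o (i ∷ ρ) else [])
  body i = trans (ifO-eval ws (eqᴱ (v 0) (wk a)) o ε (i ∷ ρ))
    (cong (λ b → if b then evalO ws o (i ∷ ρ) else []) (isSuc-eq i n))
  skip : ∀ i → i < n → evalO ws (ifO (eqᴱ (v 0) (wk a)) o ε) (i ∷ ρ) ≡ []
  skip i i<n = trans (body i) (cong (λ b → if b then evalO ws o (i ∷ ρ) else []) (≢⇒≡ᵇ (<⇒≢ i<n)))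

-- Terms denoting CTL formulas; the variable i stands for EX (atom (suc i)).
data Gen : ℕ → Set where
  varG        : ∀ {d} → Term d → Gen d
  ttG ffG     : ∀ {d} → Gen d
  negG        : ∀ {d} → Gen d → Gen d
  andG orG    : ∀ {d} → Gen d → Gen d → Gen d
  allG exG    : ∀ {d} → Term d → Gen (suc d) → Gen d
  ifG         : ∀ {d} → Term d → Gen d → Gen d → Gen d

-- Out-of-range variables are sent to atom 0, which carries no information.
clamp : ∀ A → ℕ → Fin (suc A)
clamp A       zero    with A
... | zero  = zero
... | suc _ = suc zero
clamp zero    (suc i) = zero
clamp (suc A) (suc i) with clamp A i
... | zero  = zero
... | suc j = suc (suc j)

-- The right-hand side is the arithmetic term that `emit` prints for a variable.
toℕ-clamp : ∀ A i → toℕ (clamp A i) ≡ (1 ∸ (1 ∸ (A ∸ i))) * suc i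
toℕ-clamp zero    zero    = refl
toℕ-clamp (suc A) zero    = cong (λ x → (1 ∸ x) * 1) (sym (0∸n≡0 A))
toℕ-clamp zero    (suc i) = refl
toℕ-clamp (suc A) (suc i) with A ∸ i | clamp A i | toℕ-clamp A i
... | zero  | zero  | eq = refl
... | suc x | zero  | eq rewrite 0∸n≡0 x with () ← eq
... | zero  | suc j | eq with () ← eq
... | suc x | suc j | eq rewrite 0∸n≡0 x | +-identityʳ i = cong suc eq

clamp-suc : ∀ {A i} (i<A : i < A) → clamp A i ≡ suc (fromℕ< i<A)
clamp-suc {A} {i} i<A = toℕ-injective
  (trans (toℕ-clamp A i) (trans (in-range (A ∸ i) (m>n⇒m∸n≢0 i<A)) (cong suc (sym (toℕ-fromℕ< i<A)))))
  where
  in-range : ∀ x → x ≢ 0 → (1 ∸ (1 ∸ x)) * suc i ≡ suc i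
  in-range zero    x≢0 = contradiction refl x≢0
  in-range (suc x) _   rewrite 0∸n≡0 x = +-identityʳ (suc i)

⋀ ⋁ : ∀ {a} → ℕ → (ℕ → CTL a) → CTL a
⋀ zero    f = tt
⋀ (suc n) f = f 0 and ⋀ n (f ∘ suc)
⋁ zero    f = ff
⋁ (suc n) f = f 0 or ⋁ n (f ∘ suc)

module _ (w : List Bool) where

  holds : ∀ {d} → (ℕ → Set) → Gen d → Vec ℕ d → Set
  holds X (varG a)    ρ = X (⟪ a ⟫ w ρ)
  holds X ttG         ρ = ⊤
  holds X ffG         ρ = ⊥
  holds X (negG g)    ρ = ¬ holds X g ρ
  holds X (andG g h)  ρ = holds X g ρ × holds X h ρ
  holds X (orG g h)   ρ = holds X g ρ ⊎ holds X h ρ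
  holds X (allG a g)  ρ = ∀ i → i < ⟪ a ⟫ w ρ → holds X g (i ∷ ρ)
  holds X (exG a g)   ρ = ∃ λ i → i < ⟪ a ⟫ w ρ × holds X g (i ∷ ρ)
  holds X (ifG a g h) ρ = if isSuc (⟪ a ⟫ w ρ) then holds X g ρ else holds X h ρ

  -- The condition of `ifG` concerns the input word and the loop indices, so the branch is chosen
  -- while the formula is built and leaves no trace in it.
  form : ∀ {d} A → Gen d → Vec ℕ d → CTL (suc A)
  form A (varG a)    ρ = EX (atom (clamp A (⟪ a ⟫ w ρ)))
  form A ttG         ρ = tt
  form A ffG         ρ = ff
  form A (negG g)    ρ = neg (form A g ρ)
  form A (andG g h)  ρ = form A g ρ and form A h ρ
  form A (orG g h)   ρ = form A g ρ or form A h ρ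
  form A (allG a g)  ρ = ⋀ (⟪ a ⟫ w ρ) (λ i → form A g (i ∷ ρ))
  form A (exG a g)   ρ = ⋁ (⟪ a ⟫ w ρ) (λ i → form A g (i ∷ ρ))
  form A (ifG a g h) ρ = if isSuc (⟪ a ⟫ w ρ) then form A g ρ else form A h ρ

emit : ∀ {d} → Term d → Gen d → Out 1 d
emit A (varG a)    = bitsO (unary 7 ++ unary 2) ⊹ unaryO ((lit 1 ∸̇ (lit 1 ∸̇ (A ∸̇ a))) ∙ (lit 1 ∔ a))
emit A ttG         = bitsO (unary 0)
emit A ffG         = bitsO (unary 1)
emit A (negG g)    = bitsO (unary 3) ⊹ emit A g
emit A (andG g h)  = bitsO (unary 4) ⊹ emit A g ⊹ emit A h
emit A (orG g h)   = bitsO (unary 5) ⊹ emit A g ⊹ emit A h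
emit A (allG a g)  = for a (bitsO (unary 4) ⊹ emit (wk A) g) ⊹ bitsO (unary 0)
emit A (exG a g)   = for a (bitsO (unary 5) ⊹ emit (wk A) g) ⊹ bitsO (unary 1)
emit A (ifG a g h) = ifO a (emit A g) (emit A h)

encode-⋀ : ∀ {a} n (f : ℕ → CTL a) → cat< n (λ i → unary 4 ++ encodeCTL (f i)) ++ unary 0 ≡ encodeCTL (⋀ n f)
encode-⋀ zero    f = refl
encode-⋀ (suc n) f rewrite cat<-suc n (λ i → unary 4 ++ encodeCTL (f i)) =
  cong (unary 4 ++_) (trans (++-assoc (encodeCTL (f 0)) _ _) (cong (encodeCTL (f 0) ++_) (encode-⋀ n (f ∘ suc))))

encode-⋁ : ∀ {a} n (f : ℕ → CTL a) → cat< n (λ i → unary 5 ++ encodeCTL (f i)) ++ unary 1 ≡ encodeCTL (⋁ n f)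
encode-⋁ zero    f = refl
encode-⋁ (suc n) f rewrite cat<-suc n (λ i → unary 5 ++ encodeCTL (f i)) =
  cong (unary 5 ++_) (trans (++-assoc (encodeCTL (f 0)) _ _) (cong (encodeCTL (f 0) ++_) (encode-⋁ n (f ∘ suc))))

emit-correct : ∀ w {d} A (g : Gen d) ρ → evalO (words₁ w) (emit A g) ρ ≡ encodeCTL (form w (⟪ A ⟫ w ρ) g ρ)
emit-correct w A (varG a)    ρ = cong (unary 7 ++_) (cong (unary 2 ++_)
  (trans (unaryO-eval (words₁ w) ((lit 1 ∸̇ (lit 1 ∸̇ (A ∸̇ a))) ∙ (lit 1 ∔ a)) ρ)
         (cong unary (sym (toℕ-clamp (⟪ A ⟫ w ρ) (⟪ a ⟫ w ρ))))))
emit-correct w A ttG         ρ = refl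
emit-correct w A ffG         ρ = refl
emit-correct w A (negG g)    ρ = cong (unary 3 ++_) (emit-correct w A g ρ)
emit-correct w A (andG g h)  ρ = cong (unary 4 ++_) (cong₂ _++_ (emit-correct w A g ρ) (emit-correct w A h ρ))
emit-correct w A (orG g h)   ρ = cong (unary 5 ++_) (cong₂ _++_ (emit-correct w A g ρ) (emit-correct w A h ρ))
emit-correct w A (allG a g)  ρ = trans
  (cong (_++ unary 0) (cat<-cong (⟪ a ⟫ w ρ) (λ i _ → cong (unary 4 ++_) (emit-correct w (wk A) g (i ∷ ρ)))))
  (encode-⋀ (⟪ a ⟫ w ρ) (λ i → form w (⟪ A ⟫ w ρ) g (i ∷ ρ)))
emit-correct w A (exG a g)   ρ = trans
  (cong (_++ unary 1) (cat<-cong (⟪ a ⟫ w ρ) (λ i _ → cong (unary 5 ++_) (emit-correct w (wk A) g (i ∷ ρ)))))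
  (encode-⋁ (⟪ a ⟫ w ρ) (λ i → form w (⟪ A ⟫ w ρ) g (i ∷ ρ)))
emit-correct w A (ifG a g h) ρ rewrite ifO-eval (words₁ w) a (emit A g) (emit A h) ρ with isSuc (⟪ a ⟫ w ρ)
... | true  = emit-correct w A g ρ
... | false = emit-correct w A h ρ

module _ {n a} (M : Kripke n a) (s : Fin n) where

  ⋀-⊨ : ∀ m (f : ℕ → CTL a) → M , s ⊨ ⋀ m f ⇔ (∀ i → i < m → M , s ⊨ f i)
  ⋀-⊨ zero    f = mk⇔ (λ _ _ ()) (λ _ → unit)
  ⋀-⊨ (suc m) f = mk⇔
    (λ { (p , q) zero _ → p ; (p , q) (suc i) (s≤s i<m) → to (⋀-⊨ m (f ∘ suc)) q i i<m })
    (λ g → g 0 (s≤s z≤n) , from (⋀-⊨ m (f ∘ suc)) (λ i i<m → g (suc i) (s≤s i<m)))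

  ⋁-⊨ : ∀ m (f : ℕ → CTL a) → M , s ⊨ ⋁ m f ⇔ (∃ λ i → i < m × M , s ⊨ f i)
  ⋁-⊨ zero    f = mk⇔ (λ ()) (λ ())
  ⋁-⊨ (suc m) f = mk⇔
    (λ { (inj₁ p) → 0 , s≤s z≤n , p
       ; (inj₂ q) → let i , i<m , p = to (⋁-⊨ m (f ∘ suc)) q in suc i , s≤s i<m , p })
    (λ { (zero , _ , p) → inj₁ p ; (suc i , s≤s i<m , p) → inj₂ (from (⋁-⊨ m (f ∘ suc)) (i , i<m , p)) })

module _ (w : List Bool) {n} A (M : Kripke n (suc A)) (s : Fin n) where

  valuation : ℕ → Set
  valuation i = M , s ⊨ EX (atom (clamp A i))

  form-⊨ : ∀ {d} (g : Gen d) ρ → M , s ⊨ form w A g ρ ⇔ holds w valuation g ρ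
  form-⊨ (varG a)    ρ = mk⇔ id id
  form-⊨ ttG         ρ = mk⇔ id id
  form-⊨ ffG         ρ = mk⇔ id id
  form-⊨ (negG g)    ρ = ¬-cong-⇔ (form-⊨ g ρ)
  form-⊨ (andG g h)  ρ = _×-⇔_ (form-⊨ g ρ) (form-⊨ h ρ)
  form-⊨ (orG g h)   ρ = _⊎-⇔_ (form-⊨ g ρ) (form-⊨ h ρ)
  form-⊨ (allG a g)  ρ = ⇔-trans (⋀-⊨ M s (⟪ a ⟫ w ρ) _)
    (mk⇔ (λ f i i< → to (form-⊨ g (i ∷ ρ)) (f i i<)) (λ f i i< → from (form-⊨ g (i ∷ ρ)) (f i i<)))
  form-⊨ (exG a g)   ρ = ⇔-trans (⋁-⊨ M s (⟪ a ⟫ w ρ) _)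
    (mk⇔ (λ (i , i< , p) → i , i< , to (form-⊨ g (i ∷ ρ)) p) (λ (i , i< , p) → i , i< , from (form-⊨ g (i ∷ ρ)) p))
  form-⊨ (ifG a g h) ρ with isSuc (⟪ a ⟫ w ρ)
  ... | true  = form-⊨ g ρ
  ... | false = form-⊨ h ρ

-- State 0 sees every state and all other states see only themselves;
-- deleting transitions from state 0 amounts to choosing a valuation.
edge : ℕ → ℕ → Bool
edge i j = (i ≡ᵇ 0) ∨ (i ≡ᵇ j)

full : ∀ {n} → Subset n
full = tabulate (λ _ → true)

∈-full : ∀ {n} {i : Fin n} → i ∈ full
∈-full = from (∈-tabulate (λ _ → true)) refl

star : ∀ A → Kripke (suc A) (suc A)
star A = record
  { s₀   = zero
  ; S    = full
  ; R    = λ i → tabulate (λ j → edge (toℕ i) (toℕ j))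
  ; L    = λ i → tabulate (λ j → toℕ i ≡ᵇ toℕ j)
  ; s₀∈S = ∈-full
  ; R⊆S² = λ _ → ∈-full , ∈-full
  }

edge-refl : ∀ i → edge i i ≡ true
edge-refl zero    = refl
edge-refl (suc i) = ≡ᵇ-refl i

star-total : ∀ A → Total (star A)
star-total A {i} _ = i , from (∈-tabulate (λ j → edge (toℕ i) (toℕ j))) (edge-refl (toℕ i))

∈-L : ∀ {A} {t i : Fin (suc A)} → i ∈ L (star A) t ⇔ t ≡ i
∈-L {A} {t} {i} = ⇔-trans (∈-tabulate (λ j → toℕ t ≡ᵇ toℕ j))
  (mk⇔ (toℕ-injective ∘ ≡ᵇ-true (toℕ t) (toℕ i)) (λ { refl → ≡ᵇ-refl (toℕ t) }))

-- State i is the only one labelled with atom i, and substructures keep labels; so the formula asks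
-- whether the edge from the root to i has survived.
EX-atom : ∀ {A} {M : Kripke (suc A) (suc A)} → M ⊑ star A → ∀ {i} → M , zero ⊨ EX (atom i) ⇔ i ∈ R M zero
EX-atom {A} {M} M⊑ {i} = mk⇔
  (λ (t , t∈ , i∈) → subst (_∈ R M zero) (to ∈-L (subst (i ∈_) (_⊑_.L≡ M⊑ (proj₂ (R⊆S² M t∈))) i∈)) t∈)
  (λ i∈ → i , i∈ , subst (i ∈_) (sym (_⊑_.L≡ M⊑ (proj₂ (R⊆S² M i∈)))) (from ∈-L refl))

-- All states are kept and only edges from the root are dropped. The loop at the root always stays,
-- so that the structure is total even if every variable is false.
substar : ∀ A → (ℕ → Bool) → Kripke (suc A) (suc A)
substar A X = record
  { s₀   = zero
  ; S    = full
  ; R    = λ { zero    → tabulate (λ { zero → true ; (suc j) → X (toℕ j) })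
             ; (suc i) → R (star A) (suc i) }
  ; L    = L (star A)
  ; s₀∈S = ∈-full
  ; R⊆S² = λ _ → ∈-full , ∈-full
  }

substar-total : ∀ A X → Total (substar A X)
substar-total A X {zero}  _ = zero , from (∈-tabulate (λ { zero → true ; (suc j) → X (toℕ j) })) refl
substar-total A X {suc i} _ = star-total A {suc i} ∈-full

substar-⊑ : ∀ A X → substar A X ⊑ star A
substar-⊑ A X = record
  { S⊆  = id
  ; s₀≡ = refl
  ; R⊆  = λ { zero _ → from (∈-tabulate (λ _ → true)) refl ; (suc i) → id }
  ; L≡  = λ _ → refl
  }

substar-valuation : ∀ A X {i} → i < A → valuation [] A (substar A X) zero i ⇔ X i ≡ true
substar-valuation A X {i} i<A rewrite clamp-suc i<A =
  ⇔-trans (EX-atom {A} (substar-⊑ A X)) (⇔-trans (∈-tabulate (λ { zero → true ; (suc j) → X (toℕ j) }))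
    (≡⇒⇔ (cong (λ i → X i ≡ true) (toℕ-fromℕ< i<A))))

-- Cook–Levin tableaux

×-finite : ∀ {A B} → Finite A → Finite B → Finite (A × B)
×-finite (m , f) (n , g) = m * n , (↔-sym *↔× ↔-∘ (f ×-↔ g))

abstract
  symbol-finite : ∀ {W} → Finite W → Finite (Symbol W)
  symbol-finite {W} fin = let n , f = ⊎-finite ⊤-finite (⊎-finite (2 , ↔-sym 2↔Bool) fin) in
    n , (f ↔-∘ mk↔ₛ′ forth back (λ { (inj₁ _) → refl ; (inj₂ (inj₁ _)) → refl ; (inj₂ (inj₂ _)) → refl })
                                 (λ { □ → refl ; (bit _) → refl ; (work _) → refl }))
    where
    forth : Symbol W → ⊤ ⊎ Bool ⊎ W
    forth □        = inj₁ unit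
    forth (bit b)  = inj₂ (inj₁ b)
    forth (work x) = inj₂ (inj₂ x)
    back : ⊤ ⊎ Bool ⊎ W → Symbol W
    back (inj₁ _)        = □
    back (inj₂ (inj₁ b)) = bit b
    back (inj₂ (inj₂ x)) = work x

module Finiteness {A : Set} (fin : Finite A) where
  open Inverse (proj₂ fin) public using (strictlyInverseˡ; strictlyInverseʳ) renaming (to to index; from to element)

  elements : List A
  elements = map element (allFin (proj₁ fin))

  ∈-elements : ∀ x → x ∈ˡ elements
  ∈-elements x = subst (_∈ˡ elements) (strictlyInverseʳ x) (∈-map⁺ element (∈-allFin (index x)))

  decEq : (x y : A) → Dec (x ≡ y)
  decEq x y = map′ (λ e → trans (sym (strictlyInverseʳ x)) (trans (cong element e) (strictlyInverseʳ y))) (cong index)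
                 (index x ≟ᶠ index y)

vectors : ∀ {A : Set} → List A → ∀ n → List (Vec A n)
vectors xs zero    = [] ∷ []
vectors xs (suc n) = cartesianProductWith _∷_ xs (vectors xs n)

∈-vectors : ∀ {A : Set} {xs : List A} → (∀ x → x ∈ˡ xs) → ∀ {n} (ys : Vec A n) → ys ∈ˡ vectors xs n
∈-vectors all []       = here refl
∈-vectors all (y ∷ ys) = ∈-cartesianProductWith⁺ _∷_ (all y) (∈-vectors all ys)

⋀L ⋁L : ∀ {A : Set} {d} → List A → (A → Gen d) → Gen d
⋀L []       f = ttG
⋀L (x ∷ xs) f = andG (f x) (⋀L xs f)
⋁L []       f = ffG
⋁L (x ∷ xs) f = orG (f x) (⋁L xs f)

truthG : ∀ {d} → Bool → Gen d
truthG true  = ttG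
truthG false = ffG

litG : ∀ {d} → Bool → Gen d → Gen d
litG true  g = g
litG false g = negG g

iffG : ∀ {d} → Gen d → Gen d → Gen d
iffG g h = orG (andG g h) (andG (negG g) (negG h))

module _ (w : List Bool) (X : ℕ → Set) {d} (ρ : Vec ℕ d) where

  private
    H : Gen d → Set
    H g = holds w X g ρ

  ⋀L-holds : ∀ {A : Set} {xs : List A} (f : A → Gen d) → (∀ x → x ∈ˡ xs) → H (⋀L xs f) ⇔ (∀ x → H (f x))
  ⋀L-holds {A} {xs} f all = mk⇔ (λ h x → forth xs h (all x)) (λ h → back xs h)
    where
    forth : ∀ ys → H (⋀L ys f) → ∀ {x} → x ∈ˡ ys → H (f x)
    forth (y ∷ ys) (h , _) (here refl) = h
    forth (y ∷ ys) (_ , h) (there x∈)  = forth ys h x∈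
    back : ∀ ys → (∀ x → H (f x)) → H (⋀L ys f)
    back []       h = unit
    back (y ∷ ys) h = h y , back ys h

  ⋁L-holds : ∀ {A : Set} {xs : List A} (f : A → Gen d) → (∀ x → x ∈ˡ xs) → H (⋁L xs f) ⇔ (∃ λ x → H (f x))
  ⋁L-holds {A} {xs} f all = mk⇔ (forth xs) (λ (x , h) → back xs h (all x))
    where
    forth : ∀ ys → H (⋁L ys f) → ∃ λ x → H (f x)
    forth (y ∷ ys) (inj₁ h) = y , h
    forth (y ∷ ys) (inj₂ h) = forth ys h
    back : ∀ ys {x} → H (f x) → x ∈ˡ ys → H (⋁L ys f)
    back (y ∷ ys) h (here refl) = inj₁ h
    back (y ∷ ys) h (there x∈)  = inj₂ (back ys h x∈)

  truthG-holds : ∀ {P : Set} (P? : Dec P) → H (truthG (does P?)) ⇔ P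
  truthG-holds (yes p) = mk⇔ (λ _ → p) (λ _ → unit)
  truthG-holds (no ¬p) = mk⇔ (λ ()) ¬p

  litG-holds : ∀ {P : Set} (P? : Dec P) g → H (litG (does P?) g) ⇔ (H g ⇔ P)
  litG-holds (yes p) g = mk⇔ (λ h → mk⇔ (λ _ → p) (λ _ → h)) (λ e → from e p)
  litG-holds (no ¬p) g = mk⇔ (λ ¬h → mk⇔ (λ h → contradiction h ¬h) (λ p → contradiction p ¬p)) (λ e h → ¬p (to e h))

  iffG-sound : ∀ g h → H (iffG g h) → H g ⇔ H h
  iffG-sound g h (inj₁ (p , q))   = mk⇔ (λ _ → q) (λ _ → p)
  iffG-sound g h (inj₂ (¬p , ¬q)) = mk⇔ (λ p → contradiction p ¬p) (λ q → contradiction q ¬q)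

  -- A proof of the disjunction has to name the side that holds. The decision comes from P, a fact
  -- about the run that both formulas express.
  iffG-complete : ∀ g h {P : Set} → Dec P → H g ⇔ P → H h ⇔ P → H (iffG g h)
  iffG-complete g h (yes p) e f = inj₁ (from e p , from f p)
  iffG-complete g h (no ¬p) e f = inj₂ (¬p ∘ to e , ¬p ∘ to f)

  ifG-holds : ∀ a g h {b} → isSuc (⟪ a ⟫ w ρ) ≡ b → H (ifG a g h) ⇔ (if b then H g else H h)
  ifG-holds a g h refl = mk⇔ id id

-- With the head on cell T + 1, a loaded word of length ℓ occupies the cells T + 1, ..., T + ℓ.
inRange : ℕ → ℕ → ℕ → Bool
inRange T p ℓ = (T <ᵇ p) ∧ (p <ᵇ suc (T + ℓ))

inRangeᴱ : ∀ {d} → Term d → Term d → Term d → Term d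
inRangeᴱ T p ℓ = (p ∸̇ T) ∙ ((lit 1 ∔ (T ∔ ℓ)) ∸̇ p)

isSuc-inRange : ∀ T p ℓ → isSuc ((p ∸ T) * (suc (T + ℓ) ∸ p)) ≡ inRange T p ℓ
isSuc-inRange T p ℓ = trans (isSuc-* (p ∸ T) (suc (T + ℓ) ∸ p)) (cong₂ _∧_ (isSuc-∸ T p) (isSuc-∸ p (suc (T + ℓ))))

<ᵇ-true : ∀ {m n} → (m <ᵇ n) ≡ true → m < n
<ᵇ-true {m} {n} eq = <ᵇ⇒< m n (subst Bool.T (sym eq) unit)

true-<ᵇ : ∀ {m n} → m < n → (m <ᵇ n) ≡ true
true-<ᵇ {zero}  {suc n} _         = refl
true-<ᵇ {suc m} {suc n} (s≤s m<n) = true-<ᵇ m<n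

false-<ᵇ : ∀ {m n} → n ≤ m → (m <ᵇ n) ≡ false
false-<ᵇ {m}     {zero}  _         = refl
false-<ᵇ {suc m} {suc n} (s≤s n≤m) = false-<ᵇ n≤m

inRange-true : ∀ T p ℓ → inRange T p ℓ ≡ true → ∃ λ i → i < ℓ × p ≡ suc T + i
inRange-true T p ℓ eq with T <ᵇ p in T<p | p <ᵇ suc (T + ℓ) in p<
... | true | true with i , refl ← m≤n⇒∃[o]m+o≡n (<ᵇ-true {T} {p} T<p) =
  i , +-cancelˡ-< (suc T) i ℓ (<ᵇ-true {suc T + i} {suc T + ℓ} p<) , refl

-- The symbol on cell p of a tape loaded with w, if the head stands on cell suc T.
loadedAt : ∀ {W} → ℕ → List Bool → ℕ → Symbol W
loadedAt T w p = if inRange T p (length w) then bit (nth w (p ∸ suc T)) else □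

look-+ : ∀ {W} (t : Tape W) v i → look t (v + i) v ≡ look t i 0
look-+ t zero    i = refl
look-+ t (suc v) i = look-+ t v i

look-blank : ∀ {W} (t : Tape W) → lefts t ≡ [] → ∀ {k v} → k < v → look t k v ≡ □
look-blank t refl {zero}  {suc v} _         = refl
look-blank t eq   {suc k} {suc v} (s≤s k<v) = look-blank t eq k<v

look-load₀ : ∀ {W} w i → look (load {W} w) i 0 ≡ (if i <ᵇ length w then bit (nth w i) else □)
look-load₀ []      zero    = refl
look-load₀ []      (suc i) = refl
look-load₀ (b ∷ w) zero    = refl
look-load₀ (b ∷ w) (suc i) = go w i
  where
  go : ∀ {W} w i → cellAt {W} (map bit w) i ≡ (if i <ᵇ length w then bit (nth w i) else □)
  go []      i       = refl
  go (b ∷ w) zero    = refl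
  go (b ∷ w) (suc i) = go w i

lefts-load : ∀ {W} w → lefts (load {W} w) ≡ []
lefts-load []      = refl
lefts-load (_ ∷ _) = refl

<ᵇ-cancel : ∀ T i ℓ → (T + i <ᵇ T + ℓ) ≡ (i <ᵇ ℓ)
<ᵇ-cancel zero    i ℓ = refl
<ᵇ-cancel (suc T) i ℓ = <ᵇ-cancel T i ℓ

look-load : ∀ {W} T w p → look (load {W} w) p (suc T) ≡ loadedAt T w p
look-load {W} T w p with p <? suc T
... | yes p≤T rewrite false-<ᵇ {T} {p} (s≤s⁻¹ p≤T) = look-blank (load w) (lefts-load w) p≤T
... | no p≰T with i , refl ← m≤n⇒∃[o]m+o≡n (≮⇒≥ p≰T)
  rewrite true-<ᵇ {T} {suc (T + i)} (s≤s (m≤m+n T i)) | <ᵇ-cancel T i (length w) | m+n∸m≡n T i =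
  trans (look-+ (load w) (suc T) i) (look-load₀ w i)

module Tableau (M : TM) where
  open TM M

  Sy : Set
  Sy = Symbol Work

  module Sy = Finiteness (symbol-finite finiteWork)
  module Q = Finiteness finiteState

  Component : Set
  Component = (Fin tapeCount × Sy) ⊎ State

  abstract
    component-finite : Finite Component
    component-finite = ⊎-finite (×-finite (tapeCount , mk↔ₛ′ id id (λ _ → refl) (λ _ → refl))
      (symbol-finite finiteWork)) finiteState

  module Co = Finiteness component-finite

  K : ℕ
  K = proj₁ component-finite

  code : Component → ℕ
  code = toℕ ∘ Co.index

  Local : Set
  Local = State × Vec Sy tapeCount

  locals : List Local
  locals = cartesianProductWith _,_ Q.elements (vectors Sy.elements tapeCount)

  ∈-locals : ∀ l → l ∈ˡ locals
  ∈-locals (q , h) = ∈-cartesianProductWith⁺ _,_ (Q.∈-elements q) (∈-vectors Sy.∈-elements h)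

  -- The transition function, extended to halting states by the identity.
  δ̂ : Local → State × Vec (Sy × Move) tapeCount
  δ̂ (q , h) with verdict q
  ... | just _  = q , Vec.map (_, stay) h
  ... | nothing = δ q h

  localOf : Config → Local
  localOf c = state c , Vec.map head (tapes c)

  step-δ̂ : ∀ c → step c ≡ config (proj₁ (δ̂ (localOf c))) (Vec.zipWith act (proj₂ (δ̂ (localOf c))) (tapes c))
  step-δ̂ c with verdict (state c)
  ... | just _  = cong (config (state c)) (sym (stay-all (tapes c)))
  ... | nothing = refl

  -- The cells 0, ..., 2T + 2 lie symmetrically about the head on cell T + 1. Losing one cell at
  -- each end per step still leaves the head and both its neighbours after T steps.
  win : ∀ {d} → Term d → Term d
  win T = lit 3 ∔ (T ∔ T)

  -- A mixed-radix number with digits component, cell and time; the completeness proof recovers them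
  -- by division.
  idx : ℕ → ℕ → ℕ → Component → ℕ
  idx T t p c = code c + K * (p + (3 + (T + T)) * t)

  -- Component c of cell p at time t; the head stands on cell suc T.
  xG : ∀ {d} → Term d → Term d → Term d → Component → Gen d
  xG T t p c = varG (lit (code c) ∔ lit K ∙ (p ∔ win T ∙ t))

  pinned : ∀ {d} → Term d → Term d → Term d → Fin tapeCount → Sy → Gen d
  pinned T t p j y = ⋀L Sy.elements (λ s → litG (does (Sy.decEq y s)) (xG T t p (inj₁ (j , s))))

  guardG : ∀ {d} → Term d → Term d → Local → Gen d
  guardG T t (q , h) = andG (xG T t (lit 1 ∔ T) (inj₂ q))
    (⋀L (allFin tapeCount) (λ j → xG T t (lit 1 ∔ T) (inj₁ (j , lookup h j))))

  -- Where the content of cell p + 1 was before a move, the head keeping its number: a move to the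
  -- right brings it in from cell p + 2, a move to the left from cell p. Speaking of cell p + 1
  -- avoids a predecessor.
  source : ∀ {d} → Move → Term d → Term d
  source left  p = p
  source stay  p = lit 1 ∔ p
  source right p = lit 2 ∔ p

  contentG : ∀ {d} → Term d → Term d → Term d → Fin tapeCount → Sy → Sy × Move → Gen d
  contentG T t p j s (y , m) = ifG (eqᴱ (source m p) (lit 1 ∔ T)) (truthG (does (Sy.decEq y s)))
    (xG T t (source m p) (inj₁ (j , s)))

  -- The transition function is finite, so the rule is a disjunction over all combinations of a
  -- state and scanned symbols; the guard selects the actual one.
  cellG : ∀ {d} → Term d → Term d → Term d → Fin tapeCount → Sy → Gen d
  cellG T t p j s = ⋁L locals (λ l → andG (guardG T t l) (contentG T t p j s (lookup (proj₂ (δ̂ l)) j)))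

  stateG : ∀ {d} → Term d → Term d → State → Gen d
  stateG T t q = ⋁L locals (λ l → andG (guardG T t l) (truthG (does (Q.decEq (proj₁ (δ̂ l)) q))))

  isAccepting : State → Bool
  isAccepting q with verdict q
  ... | just true = true
  ... | _         = false

  -- Variables, innermost first: the bound on the certificate length, T.
  inputG certG blankG startG stepG controlG acceptG tableau : Gen 2
  inputG = allG (win (v 1)) (ifG (inRangeᴱ (v 2) (v 0) (len zero))
    (ifG (bitAt zero (v 0 ∸̇ (lit 1 ∔ v 2))) (pinned (v 2) (lit 0) (v 0) zero (bit true))
      (pinned (v 2) (lit 0) (v 0) zero (bit false)))
    (pinned (v 2) (lit 0) (v 0) zero □))
  certG = exG (lit 1 ∔ v 0) (allG (win (v 2)) (ifG (inRangeᴱ (v 3) (v 0) (v 1))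
    (orG (pinned (v 3) (lit 0) (v 0) (suc zero) (bit false)) (pinned (v 3) (lit 0) (v 0) (suc zero) (bit true)))
    (pinned (v 3) (lit 0) (v 0) (suc zero) □)))
  blankG = ⋀L (allFin extraTapes) (λ j → allG (win (v 1)) (pinned (v 2) (lit 0) (v 0) (suc (suc j)) □))
  startG = ⋀L Q.elements (λ q → litG (does (Q.decEq start q)) (xG (v 1) (lit 0) (lit 1 ∔ v 1) (inj₂ q)))
  stepG = allG (v 1) (allG (lit 1 ∔ (v 2 ∔ v 2)) (⋀L (allFin tapeCount) (λ j → ⋀L Sy.elements (λ s →
    iffG (xG (v 3) (lit 1 ∔ v 1) (lit 1 ∔ v 0) (inj₁ (j , s))) (cellG (v 3) (v 1) (v 0) j s)))))
  controlG = allG (v 1) (⋀L Q.elements (λ q →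
    iffG (xG (v 2) (lit 1 ∔ v 0) (lit 1 ∔ v 2) (inj₂ q)) (stateG (v 2) (v 0) q)))
  acceptG = ⋁L Q.elements (λ q → if isAccepting q then xG (v 1) (v 1) (lit 1 ∔ v 1) (inj₂ q) else ffG)
  tableau = andG inputG (andG certG (andG blankG (andG startG (andG stepG (andG controlG acceptG)))))

  module Semantics (w : List Bool) (X : ℕ → Set) (T : ℕ) where

    x : ℕ → ℕ → Component → Set
    x t p c = X (idx T t p c)

    C P : ℕ
    C = suc T
    P = 3 + (T + T)

    Pinned : ℕ → Fin tapeCount → Sy → Set
    Pinned p j y = ∀ s → x 0 p (inj₁ (j , s)) ⇔ (y ≡ s)

    record Local≡ (t : ℕ) (c : Config) : Set where
      field
        state⇔ : ∀ q → x t C (inj₂ q) ⇔ state c ≡ q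
        head⇔  : ∀ j s → x t C (inj₁ (j , s)) ⇔ head (lookup (tapes c) j) ≡ s
    open Local≡

    srcℕ : Move → ℕ → ℕ
    srcℕ left  p = p
    srcℕ stay  p = suc p
    srcℕ right p = suc (suc p)

    look-src : ∀ m (t : Tape Work) p → look (shift m t) (suc p) C ≡ look t (srcℕ m p) C
    look-src left  t p = look-left-suc t p C
    look-src stay  t p = refl
    look-src right t p = look-right-suc t (suc p) C

    module _ {d} (ρ : Vec ℕ d) (Tᵗ : Term d) (T≡ : ⟪ Tᵗ ⟫ w ρ ≡ T) where

      x≡ : ∀ t p c → holds w X (xG Tᵗ t p c) ρ ≡ x (⟪ t ⟫ w ρ) (⟪ p ⟫ w ρ) c
      x≡ t p c rewrite T≡ = refl

      pinned-holds : ∀ p j y → holds w X (pinned Tᵗ (lit 0) p j y) ρ ⇔ Pinned (⟪ p ⟫ w ρ) j y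
      pinned-holds p j y = ⇔-trans (⋀L-holds w X ρ _ Sy.∈-elements) (mk⇔
        (λ h s → subst (_⇔ (y ≡ s)) (x≡ (lit 0) p (inj₁ (j , s))) (to (litG-holds w X ρ (Sy.decEq y s) _) (h s)))
        (λ h s → from (litG-holds w X ρ (Sy.decEq y s) _)
          (subst (_⇔ (y ≡ s)) (sym (x≡ (lit 0) p (inj₁ (j , s)))) (h s))))

      guard-holds : ∀ t {c} → Local≡ (⟪ t ⟫ w ρ) c → ∀ l → holds w X (guardG Tᵗ t l) ρ ⇔ localOf c ≡ l
      guard-holds t {c} G l@(q , h) = mk⇔
        (λ (hq , hh) → cong₂ _,_ (to (state⇔ G q) (subst id (x≡C (inj₂ q)) hq))
          (lookup-ext λ j → trans (lookup-map j head (tapes c))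
            (to (head⇔ G j _) (subst id (x≡C (inj₁ (j , lookup h j))) (to (⋀L-holds w X ρ _ ∈-allFin) hh j)))))
        (λ { refl → subst id (sym (x≡C (inj₂ (state c)))) (from (state⇔ G _) refl) ,
             from (⋀L-holds w X ρ _ ∈-allFin) λ j →
               subst id (sym (x≡C (inj₁ (j , lookup (Vec.map head (tapes c)) j))))
               (from (head⇔ G j (lookup (Vec.map head (tapes c)) j)) (sym (lookup-map j head (tapes c)))) })
        where
        x≡C : ∀ k → holds w X (xG Tᵗ t (lit 1 ∔ Tᵗ) k) ρ ≡ x (⟪ t ⟫ w ρ) C k
        x≡C k = trans (x≡ t (lit 1 ∔ Tᵗ) k) (cong (λ p → x (⟪ t ⟫ w ρ) (suc p) k) T≡)

      -- The guards exclude each other, so the disjunction reduces to its value at the actual local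
      -- configuration.
      local-holds : ∀ t {c} (f : Local → Gen d) → Local≡ (⟪ t ⟫ w ρ) c →
                    holds w X (⋁L locals (λ l → andG (guardG Tᵗ t l) (f l))) ρ ⇔ holds w X (f (localOf c)) ρ
      local-holds t {c} f G = ⇔-trans (⋁L-holds w X ρ _ ∈-locals) (mk⇔
        (λ (l , g , h) → subst (λ l → holds w X (f l) ρ) (sym (to (guard-holds t G l) g)) h)
        (λ h → localOf c , from (guard-holds t G (localOf c)) refl , h))

      source≡ : ∀ m p → ⟪ source m p ⟫ w ρ ≡ srcℕ m (⟪ p ⟫ w ρ)
      source≡ left  p = refl
      source≡ stay  p = refl
      source≡ right p = refl

      content-holds : ∀ t p j s ym {tp : Tape Work} →
        (∀ m → x (⟪ t ⟫ w ρ) (srcℕ m (⟪ p ⟫ w ρ)) (inj₁ (j , s)) ⇔ look tp (srcℕ m (⟪ p ⟫ w ρ)) C ≡ s) →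
        holds w X (contentG Tᵗ t p j s ym) ρ ⇔ look (act ym tp) (suc (⟪ p ⟫ w ρ)) C ≡ s
      content-holds t p j s (y , m) {tp} src =
        ⇔-trans (ifG-holds w X ρ (eqᴱ (source m p) (lit 1 ∔ Tᵗ)) (truthG (does (Sy.decEq y s)))
          (xG Tᵗ t (source m p) (inj₁ (j , s))) (isSuc-eq (⟪ source m p ⟫ w ρ) (suc (⟪ Tᵗ ⟫ w ρ)))) (go _ refl)
        where
        p′ = srcℕ m (⟪ p ⟫ w ρ)
        shifted : ∀ {z} → look (write y tp) p′ C ≡ z → (z ≡ s) ⇔ (look (act (y , m) tp) (suc (⟪ p ⟫ w ρ)) C ≡ s)
        shifted eq = ≡⇒⇔ (cong (_≡ s) (sym (trans (look-src m (write y tp) (⟪ p ⟫ w ρ)) eq)))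
        here? : ∀ {b} → (⟪ source m p ⟫ w ρ ≡ᵇ suc (⟪ Tᵗ ⟫ w ρ)) ≡ b → (p′ ≡ᵇ C) ≡ b
        here? eq = trans (cong₂ (λ a b → a ≡ᵇ suc b) (sym (source≡ m p)) (sym T≡)) eq
        go : ∀ b → (⟪ source m p ⟫ w ρ ≡ᵇ suc (⟪ Tᵗ ⟫ w ρ)) ≡ b →
             (if b then holds w X (truthG (does (Sy.decEq y s))) ρ else holds w X
               (xG Tᵗ t (source m p) (inj₁ (j , s))) ρ) ⇔
             look (act (y , m) tp) (suc (⟪ p ⟫ w ρ)) C ≡ s
        go true  eq = ⇔-trans (truthG-holds w X ρ (Sy.decEq y s))
          (shifted (subst (λ k → look (write y tp) k C ≡ y) (sym (≡ᵇ-true p′ C (here? eq))) (look-write-≡ y tp C)))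
        go false eq = ⇔-trans (≡⇒⇔ (trans (x≡ t (source m p) (inj₁ (j , s)))
          (cong (λ p → x (⟪ t ⟫ w ρ) p (inj₁ (j , s))) (source≡ m p))))
          (⇔-trans (src m) (shifted (look-write-≢ y tp (≡ᵇ-false {p′} {C} (here? eq)))))

      cell-holds : ∀ t p j s {c} → Local≡ (⟪ t ⟫ w ρ) c →
        (∀ m → x (⟪ t ⟫ w ρ) (srcℕ m (⟪ p ⟫ w ρ)) (inj₁ (j , s)) ⇔
          look (lookup (tapes c) j) (srcℕ m (⟪ p ⟫ w ρ)) C ≡ s) →
        holds w X (cellG Tᵗ t p j s) ρ ⇔ look (lookup (tapes (step c)) j) (suc (⟪ p ⟫ w ρ)) C ≡ s
      cell-holds t p j s {c} G src =
        ⇔-trans (local-holds t (λ l → contentG Tᵗ t p j s (lookup (proj₂ (δ̂ l)) j)) G)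
          (⇔-trans (content-holds t p j s (lookup (proj₂ (δ̂ (localOf c))) j) src)
        (≡⇒⇔ (cong (λ tp → look tp (suc (⟪ p ⟫ w ρ)) C ≡ s)
          (sym (trans (cong (λ c → lookup (tapes c) j) (step-δ̂ c))
            (lookup-zipWith act j (proj₂ (δ̂ (localOf c))) (tapes c)))))))

      state-holds : ∀ t q {c} → Local≡ (⟪ t ⟫ w ρ) c → holds w X (stateG Tᵗ t q) ρ ⇔ state (step c) ≡ q
      state-holds t q {c} G = ⇔-trans (local-holds t (λ l → truthG (does (Q.decEq (proj₁ (δ̂ l)) q))) G)
        (⇔-trans (truthG-holds w X ρ (Q.decEq (proj₁ (δ̂ (localOf c))) q))
        (≡⇒⇔ (cong (λ c → state c ≡ q) (sym (step-δ̂ c)))))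

-- Correctness of the tableau

module TableauCorrect (M : TM) (w : List Bool) (X : ℕ → Set) (T Cl : ℕ) where
  open TM M
  open Tableau M
  open Semantics w X T
  open Local≡

  ρ : Vec ℕ 2
  ρ = Cl ∷ T ∷ []

  inputBit inputBlank : Gen 3
  inputBit = ifG (bitAt zero (v 0 ∸̇ (lit 1 ∔ v 2))) (pinned (v 2) (lit 0) (v 0) zero (bit true))
    (pinned (v 2) (lit 0) (v 0) zero (bit false))
  inputBlank = pinned (v 2) (lit 0) (v 0) zero □

  certBit certBlank : Gen 4
  certBit = orG (pinned (v 3) (lit 0) (v 0) (suc zero) (bit false)) (pinned (v 3) (lit 0) (v 0) (suc zero) (bit true))
  certBlank = pinned (v 3) (lit 0) (v 0) (suc zero) □

  isSuc-bool : ∀ b → isSuc (bool→ℕ b) ≡ b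
  isSuc-bool true  = refl
  isSuc-bool false = refl

  input-holds : ∀ p → holds w X (ifG (inRangeᴱ (v 2) (v 0) (len zero)) inputBit inputBlank) (p ∷ ρ) ⇔
    Pinned p zero (loadedAt T w p)
  input-holds p = ⇔-trans (ifG-holds w X (p ∷ ρ) (inRangeᴱ (v 2) (v 0) (len zero)) inputBit inputBlank
    (isSuc-inRange T p (length w)))
                          (go (inRange T p (length w)))
    where
    pin : ∀ y → holds w X (pinned (v 2) (lit 0) (v 0) zero y) (p ∷ ρ) ⇔ Pinned p zero y
    pin = pinned-holds (p ∷ ρ) (v 2) refl (v 0) zero
    choose : ∀ b → (if b then holds w X (pinned (v 2) (lit 0) (v 0) zero (bit true)) (p ∷ ρ)
                         else holds w X (pinned (v 2) (lit 0) (v 0) zero (bit false)) (p ∷ ρ)) ⇔ Pinned p zero (bit b)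
    choose true  = pin (bit true)
    choose false = pin (bit false)
    go : ∀ b → (if b then holds w X inputBit (p ∷ ρ) else holds w X inputBlank (p ∷ ρ)) ⇔
               Pinned p zero (if b then bit (nth w (p ∸ suc T)) else □)
    go true  = ⇔-trans (ifG-holds w X (p ∷ ρ) (bitAt zero (v 0 ∸̇ (lit 1 ∔ v 2)))
      (pinned (v 2) (lit 0) (v 0) zero (bit true))
                                  (pinned (v 2) (lit 0) (v 0) zero (bit false)) (isSuc-bool (nth w (p ∸ suc T))))
                       (choose (nth w (p ∸ suc T)))
    go false = pin □

  CertCell : ℕ → ℕ → Set
  CertCell ℓ p = if inRange T p ℓ then Pinned p (suc zero) (bit false) ⊎ Pinned p (suc zero) (bit true) else Pinned p
    (suc zero) □

  cert-holds : ∀ ℓ p → holds w X (ifG (inRangeᴱ (v 3) (v 0) (v 1)) certBit certBlank) (p ∷ ℓ ∷ ρ) ⇔ CertCell ℓ p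
  cert-holds ℓ p = ⇔-trans (ifG-holds w X (p ∷ ℓ ∷ ρ) (inRangeᴱ (v 3) (v 0) (v 1)) certBit certBlank
    (isSuc-inRange T p ℓ))
                           (go (inRange T p ℓ))
    where
    pin : ∀ y → holds w X (pinned (v 3) (lit 0) (v 0) (suc zero) y) (p ∷ ℓ ∷ ρ) ⇔ Pinned p (suc zero) y
    pin = pinned-holds (p ∷ ℓ ∷ ρ) (v 3) refl (v 0) (suc zero)
    go : ∀ b → (if b then holds w X certBit (p ∷ ℓ ∷ ρ) else holds w X certBlank (p ∷ ℓ ∷ ρ)) ⇔
               (if b then Pinned p (suc zero) (bit false) ⊎ Pinned p (suc zero) (bit true) else Pinned p (suc zero) □)
    go true  = _⊎-⇔_ (pin (bit false)) (pin (bit true))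
    go false = pin □

  blank-holds : ∀ j p → holds w X (pinned (v 2) (lit 0) (v 0) j □) (p ∷ ρ) ⇔ Pinned p j □
  blank-holds j p = pinned-holds (p ∷ ρ) (v 2) refl (v 0) j □

  C<P : C < P
  C<P = s≤s (s≤s (≤-trans (m≤m+n T T) (n≤1+n _)))

  isAccepting-just : ∀ q → isAccepting q ≡ true ⇔ verdict q ≡ just true
  isAccepting-just q with verdict q
  ... | just true  = mk⇔ (λ _ → refl) (λ _ → refl)
  ... | just false = mk⇔ (λ ()) (λ ())
  ... | nothing    = mk⇔ (λ ()) (λ ())

  initial-tape : List Bool → Fin tapeCount → List Bool
  initial-tape u zero          = w
  initial-tape u (suc zero)    = u
  initial-tape u (suc (suc _)) = []

  look-init : ∀ u j p → look (lookup (tapes (init w u)) j) p C ≡ loadedAt T (initial-tape u j) p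
  look-init u zero          p = look-load T w p
  look-init u (suc zero)    p = look-load T u p
  look-init u (suc (suc j)) p = trans (cong (λ t → look t p C) (lookup-replicate j (load []))) (look-load T [] p)

  loadedAt-[] : ∀ p → loadedAt {Work} T [] p ≡ □
  loadedAt-[] p with inRange T p 0 in eq
  ... | true  with () ← proj₁ (proj₂ (inRange-true T p 0 eq))
  ... | false = refl

  run-suc : ∀ t c → run (suc t) c ≡ step (run t c)
  run-suc t c = trans (cong (λ n → run n c) (+-comm 1 t)) (run-+ M t 1 c)

  -- Cell p of a tape at time t depends on the cells within distance t of p
  -- at time 0 only, so the window narrows by one cell on both sides per step.
  record Layer (t : ℕ) (c : Config) : Set where
    field
      cells  : ∀ j p s → t ≤ p → p + t ≤ 2 + (T + T) → x t p (inj₁ (j , s)) ⇔ look (lookup (tapes c) j) p C ≡ s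
      states : ∀ q → x t C (inj₂ q) ⇔ state c ≡ q
  open Layer

  layer-local : ∀ {t c} → t ≤ T → Layer t c → Local≡ t c
  layer-local {t} {c} t≤T L = record
    { state⇔ = states L
    ; head⇔  = λ j s → ⇔-trans (cells L j C s (m≤n⇒m≤1+n t≤T) (s≤s (≤-trans (+-monoʳ-≤ T t≤T) (n≤1+n _))))
                               (≡⇒⇔ (cong (_≡ s) (look-head (lookup (tapes c) j) C)))
    }

  module Sound (X? : ∀ i → Dec (X i)) (h : holds w X tableau ρ) where

    private
      ℓ : ℕ
      ℓ = proj₁ (proj₁ (proj₂ h))
      ℓ≤Cl : ℓ ≤ Cl
      ℓ≤Cl = s≤s⁻¹ (proj₁ (proj₂ (proj₁ (proj₂ h))))

      guess : ℕ → Bool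
      guess i = does (X? (idx T 0 (suc T + i) (inj₁ (suc zero , bit true))))

    -- The certificate is read off the valuation, which has to be decidable for this: its i-th bit
    -- tells whether cell T + 1 + i of tape 1 initially carries `bit true`.
    u : List Bool
    u = listing guess ℓ

    length-u : length u ≡ ℓ
    length-u = length-listing guess ℓ

    pinned-guess : ∀ i b → Pinned (suc T + i) (suc zero) (bit b) → guess i ≡ b
    pinned-guess i true  pin = from (does-true (X? _)) (from (pin (bit true)) refl)
    pinned-guess i false pin with X? (idx T 0 (suc T + i) (inj₁ (suc zero , bit true)))
    ... | no _  = refl
    ... | yes y with () ← to (pin (bit true)) y

    cert-pinned : ∀ p → p < P → Pinned p (suc zero) (loadedAt T u p)
    cert-pinned p p<P rewrite length-u
      with c ← to (cert-holds ℓ p) (proj₂ (proj₂ (proj₁ (proj₂ h))) p p<P)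
      with inRange T p ℓ in eq
    ... | false = c
    ... | true  with i , i<ℓ , refl ← inRange-true T p ℓ eq | c
    ... | inj₁ pin rewrite m+n∸m≡n T i | nth-listing guess ℓ i<ℓ | pinned-guess i false pin = pin
    ... | inj₂ pin rewrite m+n∸m≡n T i | nth-listing guess ℓ i<ℓ | pinned-guess i true pin = pin

    all-pinned : ∀ j p → p < P → Pinned p j (loadedAt T (initial-tape u j) p)
    all-pinned zero          p p<P = to (input-holds p) (proj₁ h p p<P)
    all-pinned (suc zero)    p p<P = cert-pinned p p<P
    all-pinned (suc (suc j)) p p<P = subst (Pinned p (suc (suc j))) (sym (loadedAt-[] p))
      (to (blank-holds (suc (suc j)) p) (to (⋀L-holds w X ρ _ ∈-allFin) (proj₁ (proj₂ (proj₂ h))) j p p<P))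

    c₀ : Config
    c₀ = init w u

    layer₀ : Layer 0 c₀
    layer₀ = record
      { cells  = λ j p s _ p≤ → subst (λ y → x 0 p (inj₁ (j , s)) ⇔ (y ≡ s)) (sym (look-init u j p))
                                  (all-pinned j p (s≤s (≤-trans (m≤m+n p 0) p≤)) s)
      ; states = λ q → to (litG-holds w X ρ (Q.decEq start q) (xG (v 1) (lit 0) (lit 1 ∔ v 1) (inj₂ q)))
                          (to (⋀L-holds w X ρ _ Q.∈-elements) (proj₁ (proj₂ (proj₂ (proj₂ h)))) q)
      }

    -- Each cell of the new layer depends on a cell at distance at most one in the old layer, which
    -- the narrower window guarantees to be correct.
    layer-suc : ∀ {t c} → t < T → Layer t c → Layer (suc t) (step c)
    layer-suc {t} {c} t<T L = record
      { cells  = next-cell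
      ; states = λ q → ⇔-trans
          (iffG-sound w X (t ∷ ρ) (xG (v 2) (lit 1 ∔ v 0) (lit 1 ∔ v 2) (inj₂ q)) (stateG (v 2) (v 0) q)
            (to (⋀L-holds w X (t ∷ ρ) _ Q.∈-elements) (proj₁ (proj₂ (proj₂ (proj₂ (proj₂ (proj₂ h))))) t t<T) q))
          (state-holds (t ∷ ρ) (v 2) refl (v 0) q G)
      }
      where
      G : Local≡ t c
      G = layer-local (<⇒≤ t<T) L
      next-cell : ∀ j p s → suc t ≤ p → p + suc t ≤ 2 + (T + T) →
                  x (suc t) p (inj₁ (j , s)) ⇔ look (lookup (tapes (step c)) j) p C ≡ s
      next-cell j (suc p) s (s≤s t≤p) p≤ = ⇔-trans
        (iffG-sound w X ρ′ (xG (v 3) (lit 1 ∔ v 1) (lit 1 ∔ v 0) (inj₁ (j , s))) (cellG (v 3) (v 1) (v 0) j s)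
          (to (⋀L-holds w X ρ′ _ Sy.∈-elements)
          (to (⋀L-holds w X ρ′ _ ∈-allFin) (proj₁ (proj₂ (proj₂ (proj₂ (proj₂ h)))) t t<T p p<) j) s))
        (cell-holds ρ′ (v 3) refl (v 1) (v 0) j s G src)
        where
        ρ′ : Vec ℕ 4
        ρ′ = p ∷ t ∷ ρ
        p+t≤ : p + t ≤ T + T
        p+t≤ = s≤s⁻¹ (s≤s⁻¹ (≤-trans (≤-reflexive (cong suc (sym (+-suc p t)))) p≤))
        p< : p < suc (T + T)
        p< = s≤s (≤-trans (m≤m+n p t) p+t≤)
        src : ∀ m → x t (srcℕ m p) (inj₁ (j , s)) ⇔ look (lookup (tapes c) j) (srcℕ m p) C ≡ s
        src left  = cells L j p s t≤p (≤-trans p+t≤ (m≤n+m _ 2))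
        src stay  = cells L j (suc p) s (m≤n⇒m≤1+n t≤p) (s≤s (≤-trans p+t≤ (n≤1+n _)))
        src right = cells L j (suc (suc p)) s (m≤n⇒m≤1+n (m≤n⇒m≤1+n t≤p)) (s≤s (s≤s p+t≤))

    layer : ∀ t → t ≤ T → Layer t (run t c₀)
    layer zero    _   = layer₀
    layer (suc t) t<T = subst (Layer (suc t)) (sym (run-suc t c₀)) (layer-suc t<T (layer t (<⇒≤ t<T)))

    accepting : Accepting (run T c₀)
    accepting with q , a ← to (⋁L-holds w X ρ _ Q.∈-elements) (proj₂ (proj₂ (proj₂ (proj₂ (proj₂ (proj₂ h))))))
      with isAccepting q in eq
    ... | true = trans (cong verdict (to (states (layer T ≤-refl) q) a)) (to (isAccepting-just q) eq)

    result : ∃ λ u → length u ≤ Cl × Accepting (run T (init w u))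
    result = u , ≤-trans (≤-reflexive length-u) ℓ≤Cl , accepting

  -- The intended meaning of a variable, from which the satisfying valuation is defined.
  Truth : Config → ℕ → Component → Set
  Truth c p (inj₁ (j , s)) = look (lookup (tapes c) j) p C ≡ s
  Truth c p (inj₂ q)       = state c ≡ q

  Truth? : ∀ c p k → Dec (Truth c p k)
  Truth? c p (inj₁ (j , s)) = Sy.decEq (look (lookup (tapes c) j) p C) s
  Truth? c p (inj₂ q)       = Q.decEq (state c) q

  module Complete (u : List Bool) (u≤ : length u ≤ Cl) (acc : Accepting (run T (init w u)))
    (X⇔ : ∀ t p k → t ≤ T → p < P → x t p k ⇔ Truth (run t (init w u)) p k) where

    c₀ : Config
    c₀ = init w u

    initial-pinned : ∀ j p → p < P → Pinned p j (loadedAt T (initial-tape u j) p)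
    initial-pinned j p p<P s = subst (λ y → x 0 p (inj₁ (j , s)) ⇔ (y ≡ s)) (look-init u j p)
      (X⇔ 0 p (inj₁ (j , s)) z≤n p<P)

    cert-cell : ∀ p → p < P → CertCell (length u) p
    cert-cell p p<P with initial-pinned (suc zero) p p<P
    ... | pin with inRange T p (length u)
    ...   | false = pin
    ...   | true with nth u (p ∸ suc T)
    ...     | false = inj₁ pin
    ...     | true  = inj₂ pin

    local : ∀ t → t ≤ T → Local≡ t (run t c₀)
    local t t≤T = record
      { state⇔ = λ q → X⇔ t C (inj₂ q) t≤T C<P
      ; head⇔  = λ j s → ⇔-trans (X⇔ t C (inj₁ (j , s)) t≤T C<P)
        (≡⇒⇔ (cong (_≡ s) (look-head (lookup (tapes (run t c₀)) j) C)))
      }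

    step-holds : ∀ t → t < T → ∀ p → p < suc (T + T) → ∀ j s →
      holds w X (iffG (xG (v 3) (lit 1 ∔ v 1) (lit 1 ∔ v 0) (inj₁ (j , s))) (cellG (v 3) (v 1) (v 0) j s)) (p ∷ t ∷ ρ)
    step-holds t t<T p p< j s = iffG-complete w X (p ∷ t ∷ ρ) (xG (v 3) (lit 1 ∔ v 1) (lit 1 ∔ v 0) (inj₁ (j , s)))
      (cellG (v 3) (v 1) (v 0) j s) (Sy.decEq (look (lookup (tapes (step (run t c₀))) j) (suc p) C) s)
      (subst (λ c → x (suc t) (suc p) (inj₁ (j , s)) ⇔ look (lookup (tapes c) j) (suc p) C ≡ s) (run-suc t c₀)
        (X⇔ (suc t) (suc p) (inj₁ (j , s)) t<T (s≤s (≤-trans p< (n≤1+n _)))))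
      (cell-holds (p ∷ t ∷ ρ) (v 3) refl (v 1) (v 0) j s (local t (<⇒≤ t<T))
        (λ m → X⇔ t (srcℕ m p) (inj₁ (j , s)) (<⇒≤ t<T) (src< m)))
      where
      src< : ∀ m → srcℕ m p < P
      src< left  = ≤-trans p< (m≤n+m _ 2)
      src< stay  = s≤s (≤-trans p< (n≤1+n _))
      src< right = s≤s (s≤s p<)

    control-holds : ∀ t → t < T → ∀ q →
      holds w X (iffG (xG (v 2) (lit 1 ∔ v 0) (lit 1 ∔ v 2) (inj₂ q)) (stateG (v 2) (v 0) q)) (t ∷ ρ)
    control-holds t t<T q = iffG-complete w X (t ∷ ρ) (xG (v 2) (lit 1 ∔ v 0) (lit 1 ∔ v 2) (inj₂ q))
      (stateG (v 2) (v 0) q) (Q.decEq (state (step (run t c₀))) q)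
      (subst (λ c → x (suc t) C (inj₂ q) ⇔ state c ≡ q) (run-suc t c₀) (X⇔ (suc t) C (inj₂ q) t<T C<P))
      (state-holds (t ∷ ρ) (v 2) refl (v 0) q (local t (<⇒≤ t<T)))

    accept-holds : holds w X acceptG ρ
    accept-holds = from (⋁L-holds w X ρ _ Q.∈-elements) (state (run T c₀) ,
      go _ (from (isAccepting-just (state (run T c₀))) acc))
      where
      go : ∀ b → b ≡ true → holds w X (if b then xG (v 1) (v 1) (lit 1 ∔ v 1) (inj₂ (state (run T c₀))) else ffG) ρ
      go true refl = from (X⇔ T C (inj₂ (state (run T c₀))) ≤-refl C<P) refl

    tableau-holds : holds w X tableau ρ
    tableau-holds =
      (λ p p<P → from (input-holds p) (initial-pinned zero p p<P)) ,
      (length u , s≤s u≤ , λ p p<P → from (cert-holds (length u) p) (cert-cell p p<P)) ,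
      from (⋀L-holds w X ρ _ ∈-allFin) (λ j p p<P → from (blank-holds (suc (suc j)) p)
        (subst (Pinned p (suc (suc j))) (loadedAt-[] p) (initial-pinned (suc (suc j)) p p<P))) ,
      from (⋀L-holds w X ρ _ Q.∈-elements) (λ q →
        from (litG-holds w X ρ (Q.decEq start q) (xG (v 1) (lit 0) (lit 1 ∔ v 1) (inj₂ q)))
          (X⇔ 0 C (inj₂ q) z≤n C<P)) ,
      (λ t t<T p p< → from (⋀L-holds w X (p ∷ t ∷ ρ) _ ∈-allFin)
        (λ j → from (⋀L-holds w X (p ∷ t ∷ ρ) _ Sy.∈-elements) (step-holds t t<T p p< j))) ,
      (λ t t<T → from (⋀L-holds w X (t ∷ ρ) _ Q.∈-elements) (control-holds t t<T)) ,
      accept-holds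

-- Unique readability

unary-injective : ∀ i j {x y} → unary i ++ x ≡ unary j ++ y → i ≡ j × x ≡ y
unary-injective zero    zero    eq = refl , ∷-injectiveʳ eq
unary-injective (suc i) (suc j) eq with refl , eq′ ← unary-injective i j (∷-injectiveʳ eq) = refl , eq′

tag : ∀ {a} → CTL a → ℕ
tag tt         = 0
tag ff         = 1
tag (atom p)   = 2
tag (neg φ)    = 3
tag (φ and ψ)  = 4
tag (φ or ψ)   = 5
tag (AX φ)     = 6
tag (EX φ)     = 7
tag A[ φ V ψ ] = 8
tag E[ φ V ψ ] = 9

rest : ∀ {a} → CTL a → List Bool
rest tt         = []
rest ff         = []
rest (atom p)   = unary (toℕ p)
rest (neg φ)    = encodeCTL φ
rest (φ and ψ)  = encodeCTL φ ++ encodeCTL ψ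
rest (φ or ψ)   = encodeCTL φ ++ encodeCTL ψ
rest (AX φ)     = encodeCTL φ
rest (EX φ)     = encodeCTL φ
rest A[ φ V ψ ] = encodeCTL φ ++ encodeCTL ψ
rest E[ φ V ψ ] = encodeCTL φ ++ encodeCTL ψ

tag-rest : ∀ {a} (φ : CTL a) → encodeCTL φ ≡ unary (tag φ) ++ rest φ
tag-rest tt         = refl
tag-rest ff         = refl
tag-rest (atom p)   = refl
tag-rest (neg φ)    = refl
tag-rest (φ and ψ)  = refl
tag-rest (φ or ψ)   = refl
tag-rest (AX φ)     = refl
tag-rest (EX φ)     = refl
tag-rest A[ φ V ψ ] = refl
tag-rest E[ φ V ψ ] = refl

module _ {a : ℕ} where

  mutual
    -- The code is prefix-free. Arbitrary continuations x and y are carried along because the code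
    -- of a first operand is followed by that of the second.
    readable : ∀ (φ ψ : CTL a) {x y} → encodeCTL φ ++ x ≡ encodeCTL ψ ++ y → φ ≡ ψ × x ≡ y
    readable φ ψ {x} {y} eq with tag≡ , rest≡ ← unary-injective (tag φ) (tag ψ)
        (trans (sym (++-assoc (unary (tag φ)) (rest φ) x)) (trans (cong (_++ x) (sym (tag-rest φ)))
          (trans eq (trans (cong (_++ y) (tag-rest ψ)) (++-assoc (unary (tag ψ)) (rest ψ) y))))) =
      same-tag φ ψ tag≡ rest≡

    same-tag : ∀ (φ ψ : CTL a) {x y} → tag φ ≡ tag ψ → rest φ ++ x ≡ rest ψ ++ y → φ ≡ ψ × x ≡ y
    same-tag tt         tt           _ eq = refl , eq
    same-tag ff         ff           _ eq = refl , eq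
    same-tag (atom p)   (atom q)     _ eq with p≡q , eq′ ← unary-injective (toℕ p) (toℕ q) eq =
      cong atom (toℕ-injective p≡q) , eq′
    same-tag (neg φ)    (neg φ′)     _ eq with refl , eq′ ← readable φ φ′ eq = refl , eq′
    same-tag (φ and ψ)  (φ′ and ψ′)  _ eq with refl , refl , eq′ ← readable₂ φ φ′ ψ ψ′ eq = refl , eq′
    same-tag (φ or ψ)   (φ′ or ψ′)   _ eq with refl , refl , eq′ ← readable₂ φ φ′ ψ ψ′ eq = refl , eq′
    same-tag (AX φ)     (AX φ′)      _ eq with refl , eq′ ← readable φ φ′ eq = refl , eq′
    same-tag (EX φ)     (EX φ′)      _ eq with refl , eq′ ← readable φ φ′ eq = refl , eq′
    same-tag A[ φ V ψ ] A[ φ′ V ψ′ ] _ eq with refl , refl , eq′ ← readable₂ φ φ′ ψ ψ′ eq = refl , eq′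
    same-tag E[ φ V ψ ] E[ φ′ V ψ′ ] _ eq with refl , refl , eq′ ← readable₂ φ φ′ ψ ψ′ eq = refl , eq′

    readable₂ : ∀ (φ φ′ ψ ψ′ : CTL a) {x y} →
      (encodeCTL φ ++ encodeCTL ψ) ++ x ≡ (encodeCTL φ′ ++ encodeCTL ψ′) ++ y →
                φ ≡ φ′ × ψ ≡ ψ′ × x ≡ y
    readable₂ φ φ′ ψ ψ′ {x} {y} eq
      with refl , eq₁ ← readable φ φ′ (trans (sym (++-assoc (encodeCTL φ) (encodeCTL ψ) x))
                                        (trans eq (++-assoc (encodeCTL φ′) (encodeCTL ψ′) y)))
      with refl , eq₂ ← readable ψ ψ′ eq₁ = refl , refl , eq₂

unaryAt-unique : ∀ {w p k l} → UnaryAt w p k → UnaryAt w p l → k ≡ l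
unaryAt-unique {k = k} {l} (ones , end) (ones′ , end′) with <-cmp k l
... | tri< k<l _ _ = contradiction (ones′ k k<l) end
... | tri≈ _ k≡l _ = k≡l
... | tri> _ _ l<k = contradiction (ones l l<k) end′

At-unique : ∀ {w p x y} → length x ≡ length y → At w p x → At w p y → x ≡ y
At-unique {x = x} {y} eq (occurs f) (occurs g) = At⇒≡ x y eq (occurs λ i i< →
  trans (sym (f i (≤-trans i< (≤-reflexive (sym eq))))) (g i i<))

-- Kripke structures contain proofs, so equal data need not make equal records; repairability
-- depends on the data alone.
repairable-resp : ∀ {n a} (M M₂ : Kripke n a) η → s₀ M ≡ s₀ M₂ → S M ≡ S M₂ → (∀ i → R M i ≡ R M₂ i) →
  (∀ i → L M i ≡ L M₂ i) →
                  Repairable M η → Repairable M₂ η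
repairable-resp M M₂ η s≡ S≡ R≡ L≡ (M′ , total , sub , sat′) = M′ , total ,
  record
    { S⊆  = λ i∈ → subst (_ ∈_) S≡ (_⊑_.S⊆ sub i∈)
    ; s₀≡ = trans (_⊑_.s₀≡ sub) s≡
    ; R⊆  = λ i j∈ → subst (_ ∈_) (R≡ i) (_⊑_.R⊆ sub i j∈)
    ; L≡  = λ {i} i∈ → trans (_⊑_.L≡ sub i∈) (L≡ i)
    } ,
  subst (M′ ,_⊨ η) s≡ sat′

Tail : ∀ {n a} → List Bool → ℕ → Kripke n a → CTL a → Set
Tail {n} {a} w s M η =
  (∀ i → nth w (atS + toℕ i) ≡ lookup (S M) i) ×
  (∀ i j → nth w (atR + (toℕ i * n + toℕ j)) ≡ lookup (R M i) j) ×
  (∀ i p → nth w (atL + (toℕ i * a + toℕ p)) ≡ lookup (L M i) p) ×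
  At w atF (encodeCTL η)
  where open Layout n a s

repairable-tail : ∀ {n a} w s (M M₂ : Kripke n a) η η₂ → s₀ M ≡ s₀ M₂ → Tail w s M η → Tail w s M₂ η₂ →
  length (encodeCTL η) ≡ length (encodeCTL η₂) → Repairable M η → Repairable M₂ η₂
repairable-tail w s M M₂ η η₂ s≡ (S-at , R-at , L-at , η-at) (S-at₂ , R-at₂ , L-at₂ , η-at₂) ∣η∣≡ r
  with refl , _ ← readable η η₂ (trans (++-identityʳ _) (trans (At-unique ∣η∣≡ η-at η-at₂) (sym (++-identityʳ _)))) =
  repairable-resp M M₂ η s≡
    (lookup-ext λ i → trans (sym (S-at i)) (S-at₂ i))
    (λ i → lookup-ext λ j → trans (sym (R-at i j)) (R-at₂ i j))
    (λ i → lookup-ext λ p → trans (sym (L-at i p)) (L-at₂ i p)) r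

-- A word belongs to `ModelRepair` if some instance with that code is repairable; to conclude that
-- the star is, all instances with the same code must behave alike.
repairable-code : ∀ I J → encode I ≡ encode J →
  Repairable (Instance.M I) (Instance.η I) → Repairable (Instance.M J) (Instance.η J)
repairable-code I J eq = go I J
  (subst (Code.Encoded I) eq (to (Code.encoded⇔ I (encode I)) (At-self (encode I))))
  (to (Code.encoded⇔ J (encode J)) (At-self (encode J)))
  (trans (sym (Code.length-encode I)) (trans (cong length eq) (Code.length-encode J)))
  where
  w = encode J
  go : ∀ I J → Code.Encoded I w → Code.Encoded J w →
       Code.atF I + length (encodeCTL (Instance.η I)) ≡ Code.atF J + length (encodeCTL (Instance.η J)) →
       Repairable (Instance.M I) (Instance.η I) → Repairable (Instance.M J) (Instance.η J)
  go record { n = n ; a = a ; M = M ; η = η } record { M = M₂ ; η = η₂ }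
     (n-at , a-at , s-at , tail-at) (n-at₂ , a-at₂ , s-at₂ , tail-at₂) ∣w∣≡
    with refl ← unaryAt-unique {w} {0} n-at n-at₂
    with refl ← unaryAt-unique {w} {suc n} a-at a-at₂ =
    repairable-tail w (toℕ (s₀ M₂)) M M₂ η η₂ (toℕ-injective s≡) (subst (λ s → Tail w s M η) s≡ tail-at) tail-at₂
      -- Both formulas start at the same position and extend to the end of the word, hence their
      -- codes have equal length.
      (+-cancelˡ-≡ (Layout.atF n a (toℕ (s₀ M₂))) _ _
        (trans (cong (λ s → Layout.atF n a s + length (encodeCTL η)) (sym s≡)) ∣w∣≡))
    where
    s≡ : toℕ (s₀ M) ≡ toℕ (s₀ M₂)
    s≡ = unaryAt-unique {w} s-at s-at₂

-- The reduction

polyᴱ : ∀ {d} → Polynomial → Term d → Term d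
polyᴱ []       a = lit 0
polyᴱ (c ∷ cs) a = lit c ∔ a ∙ polyᴱ cs a

polyᴱ-eval : ∀ {d} w p a (ρ : Vec ℕ d) → ⟪ polyᴱ p a ⟫ w ρ ≡ ⟦ p ⟧ (⟪ a ⟫ w ρ)
polyᴱ-eval w []       a ρ = refl
polyᴱ-eval w (c ∷ cs) a ρ = cong (λ x → c + ⟪ a ⟫ w ρ * x) (polyᴱ-eval w cs a ρ)

bitO : ∀ {d} → Term d → Out 1 d
bitO a = ifO a (put true) (put false)

bitO-eval : ∀ {d} ws a (ρ : Vec ℕ d) → evalO ws (bitO a) ρ ≡ isSuc (eval ws a ρ) ∷ []
bitO-eval ws a ρ = trans (ifO-eval ws a (put true) (put false) ρ) (go (isSuc (eval ws a ρ)))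
  where
  go : ∀ b → (if b then true ∷ [] else false ∷ []) ≡ b ∷ []
  go true  = refl
  go false = refl

cat<-tabulate : ∀ k (f : ℕ → Bool) → cat< k (λ j → f j ∷ []) ≡ toList (tabulate {n = k} (f ∘ toℕ))
cat<-tabulate zero    f = refl
cat<-tabulate (suc k) f = trans (cat<-suc k (λ j → f j ∷ [])) (cong (f 0 ∷_) (cat<-tabulate k (f ∘ suc)))

cat<-rows : ∀ m {m′ k} (h : Fin m → Fin m′) (f : ℕ → ℕ → Bool) (g : Fin m′ → Subset k) →
            (∀ i → toList (g (h i)) ≡ cat< k (λ j → f (toℕ i) j ∷ [])) →
            cat< m (λ i → cat< k (λ j → f i j ∷ [])) ≡ concatMap (toList ∘ g) (List.tabulate h)
cat<-rows zero    h f g eq = refl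
cat<-rows (suc m) {k = k} h f g eq = trans (cat<-suc m (λ i → cat< k (λ j → f i j ∷ [])))
  (cong₂ _++_ (sym (eq zero)) (cat<-rows m (h ∘ suc) (f ∘ suc) g (eq ∘ suc)))

cat<-matrix : ∀ n (f : ℕ → ℕ → Bool) →
              cat< n (λ i → cat< n (λ j → f i j ∷ [])) ≡ matrix {n} {n} (λ i → tabulate (λ j → f (toℕ i) (toℕ j)))
cat<-matrix n f = cat<-rows n id f _ (λ i → sym (cat<-tabulate n (f (toℕ i))))

starInstance : ∀ A → CTL (suc A) → Instance
starInstance A η = record { M = star A ; total = star-total A ; η = η }

squareO : ∀ {d} → Term d → (∀ {d} → Term d → Term d → Term d) → Out 1 d
squareO n e = for n (for (wk n) (bitO (e (v 1) (v 0))))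

squareO-eval : ∀ ws {d} n (e : ∀ {d} → Term d → Term d → Term d) (f : ℕ → ℕ → Bool) (ρ : Vec ℕ d) →
  (∀ i j → isSuc (eval ws (e (v 1) (v 0)) (j ∷ i ∷ ρ)) ≡ f i j) →
  evalO ws (squareO n e) ρ ≡ matrix {eval ws n ρ} {eval ws n ρ} (λ i → tabulate (λ j → f (toℕ i) (toℕ j)))
squareO-eval ws n e f ρ eq = trans
  (cat<-cong (eval ws n ρ) (λ i _ → cat<-cong (eval ws n ρ) (λ j _ →
    trans (bitO-eval ws (e (v 1) (v 0)) (j ∷ i ∷ ρ)) (cong (_∷ []) (eq i j)))))
  (cat<-matrix (eval ws n ρ) f)

edgeᴱ : ∀ {d} → Term d → Term d → Term d
edgeᴱ i j = eqᴱ i (lit 0) ∔ eqᴱ i j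

instanceO : ∀ {d} → Term d → Gen d → Out 1 d
instanceO A g = unaryO n ⊹ unaryO n ⊹ put false ⊹ for n (put true) ⊹
  squareO n edgeᴱ ⊹ squareO n eqᴱ ⊹ emit A g
  where n = lit 1 ∔ A

instanceO-eval : ∀ w {d} A g (ρ : Vec ℕ d) → let A′ = ⟪ A ⟫ w ρ in
  evalO (words₁ w) (instanceO A g) ρ ≡ encode (starInstance A′ (form w A′ g ρ))
instanceO-eval w A g ρ =
  cong₂ _++_ (unaryO-eval ws n ρ) (cong₂ _++_ (unaryO-eval ws n ρ) (cong (false ∷_)
  (cong₂ _++_ (cat<-tabulate (eval ws n ρ) (λ _ → true)) (cong₂ _++_
    (squareO-eval ws n edgeᴱ edge ρ λ i j → trans (isSuc-+ (eval ws (eqᴱ (v 1) (lit 0)) (j ∷ i ∷ ρ)) _)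
      (cong₂ _∨_ (isSuc-eq i 0) (isSuc-eq i j)))
    (cong₂ _++_ (squareO-eval ws n eqᴱ _≡ᵇ_ ρ isSuc-eq) (emit-correct w A g ρ))))))
  where
  ws = words₁ w
  n = lit 1 ∔ A

module Reduction {A : Language} (np : InNP A) where
  open InNP np
  open TM verifier
  open Tableau verifier

  Tᴱ Clᴱ : ∀ {d} → Term d
  Clᴱ = polyᴱ certLength (len zero)
  Tᴱ  = polyᴱ time (len zero ∔ Clᴱ)

  variables : Term 2
  variables = lit K ∙ (win (v 1) ∙ (lit 1 ∔ v 1))

  program : Out 1 0
  program = letO Tᴱ (letO Clᴱ (instanceO variables tableau))

  module _ (w : List Bool) where

    Cl T P vars : ℕ
    Cl   = ⟦ certLength ⟧ (length w)
    T    = ⟦ time ⟧ (length w + Cl)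
    P    = 3 + (T + T)
    vars = K * (P * suc T)


    η : CTL (suc vars)
    η = form w vars tableau (Cl ∷ T ∷ [])

    program-eval : evalO (words₁ w) program [] ≡ encode (starInstance vars η)
    program-eval = begin
      evalO (words₁ w) program []
        ≡⟨ letO-eval (words₁ w) Tᴱ (letO Clᴱ (instanceO variables tableau)) [] ⟩
      evalO (words₁ w) (letO Clᴱ (instanceO variables tableau)) (⟪ Tᴱ ⟫ w [] ∷ [])
        ≡⟨ cong (λ t → evalO (words₁ w) (letO Clᴱ (instanceO variables tableau)) (t ∷ [])) T≡ ⟩
      evalO (words₁ w) (letO Clᴱ (instanceO variables tableau)) (T ∷ [])
        ≡⟨ letO-eval (words₁ w) Clᴱ (instanceO variables tableau) (T ∷ []) ⟩
      evalO (words₁ w) (instanceO variables tableau) (⟪ Clᴱ ⟫ w (T ∷ []) ∷ T ∷ [])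
        ≡⟨ cong (λ c → evalO (words₁ w) (instanceO variables tableau) (c ∷ T ∷ []))
          (polyᴱ-eval w certLength (len zero) (T ∷ [])) ⟩
      evalO (words₁ w) (instanceO variables tableau) (Cl ∷ T ∷ [])
        ≡⟨ instanceO-eval w variables tableau (Cl ∷ T ∷ []) ⟩
      encode (starInstance vars η) ∎
      where
      open ≡-Reasoning
      T≡ : ⟪ Tᴱ ⟫ w [] ≡ T
      T≡ = trans (polyᴱ-eval w time (len zero ∔ Clᴱ) [])
                 (cong (λ c → ⟦ time ⟧ (length w + c)) (polyᴱ-eval w certLength (len zero) []))

    -- The verifier has halted within the time for its own certificate, and a halted run does not
    -- change; so the larger bound T yields the same configuration.
    same-run : ∀ u → length u ≤ Cl → run T (init w u) ≡ run (⟦ time ⟧ (length w + length u)) (init w u)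
    same-run u u≤ = run-stable verifier (init w u) (⟦⟧-mono time (+-monoʳ-≤ (length w) u≤)) (halts w u)

    accepted⇔ : A w ⇔ (∃ λ u → length u ≤ Cl × Accepting (run T (init w u)))
    accepted⇔ = ⇔-trans (verifies w) (mk⇔
      (λ (u , u≤ , acc) → u , u≤ , subst Accepting (sym (same-run u u≤)) acc)
      (λ (u , u≤ , acc) → u , u≤ , subst Accepting (same-run u u≤) acc))

    instance
      -- The start state is a component, so there is at least one, and codes can be divided by their
      -- number.
      K-nonZero : NonZero K
      K-nonZero = nonZeroIndex (Co.index (inj₂ start))

    index< : ∀ {t p} k → t ≤ T → p < P → idx T t p k < vars
    index< k t≤T p<P = digit-< (toℕ<n (Co.index k)) (digit-< p<P (s≤s t≤T))

    sound : Repairable (star vars) η → A w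
    sound (M′ , total′ , sub , h) = from accepted⇔
      (TableauCorrect.Sound.result verifier w (valuation w vars M′ zero) T Cl
        -- A repair may be any total substructure of the star. In each of them the truth of a
        -- variable is the presence of an edge, hence decidable.
        (λ i → map′ (from (EX-atom sub)) (to (EX-atom sub)) (clamp vars i ∈? R M′ zero))
        (to (form-⊨ w vars M′ zero tableau (Cl ∷ T ∷ [])) h))

    complete : A w → Repairable (star vars) η
    complete Aw with u , u≤ , acc ← to accepted⇔ Aw =
      M′ , substar-total vars X , substar-⊑ vars X ,
      from (form-⊨ w vars M′ zero tableau (Cl ∷ T ∷ []))
        (TableauCorrect.Complete.tableau-holds verifier w (valuation w vars M′ zero) T Cl u u≤ acc X⇔)
      where
      Truthful : ℕ → ℕ → Component → Set
      -- A constant valuation fills the module parameter, as the real one is about to be defined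
      -- from this predicate.
      Truthful t p k = TableauCorrect.Truth verifier w (λ _ → ⊤) T Cl (run t (init w u)) p k
      Truthful? : ∀ t p k → Dec (Truthful t p k)
      Truthful? t p k = TableauCorrect.Truth? verifier w (λ _ → ⊤) T Cl (run t (init w u)) p k
      X : ℕ → Bool
      -- This inverts `idx`: the lowest digit, to base K, is the component, the next, to base P, the
      -- cell, and the rest is the time.
      X i = does (Truthful? (i / K / P) (i / K % P) (Co.element (fromℕ< (m%n<n i K))))
      M′ : Kripke (suc vars) (suc vars)
      M′ = substar vars X
      element-code : ∀ {i} k (i<K : i < K) → i ≡ code k → Co.element (fromℕ< i<K) ≡ k
      element-code k i<K refl = trans (cong Co.element (fromℕ<-toℕ (Co.index k) i<K)) (Co.strictlyInverseʳ k)
      X-idx : ∀ t p k → p < P → X (idx T t p k) ≡ does (Truthful? t p k)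
      X-idx t p k p<P
        rewrite element-code k (m%n<n (idx T t p k) K) (proj₁ (digits K (p + P * t) (toℕ<n (Co.index k))))
              | proj₂ (digits K (p + P * t) (toℕ<n (Co.index k)))
              | proj₁ (digits P t p<P) | proj₂ (digits P t p<P) = refl
      X⇔ : ∀ t p k → t ≤ T → p < P → valuation w vars M′ zero (idx T t p k) ⇔
           TableauCorrect.Truth verifier w (valuation w vars M′ zero) T Cl (run t (init w u)) p k
      -- The two instances of `Truth`, with different valuations as parameters, reduce to the same
      -- type once the kind of component is known.
      X⇔ t p (inj₁ c) t≤T p<P = ⇔-trans (substar-valuation vars X (index< (inj₁ c) t≤T p<P))
        (⇔-trans (≡⇒⇔ (cong (_≡ true) (X-idx t p (inj₁ c) p<P))) (does-true (Truthful? t p (inj₁ c))))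
      X⇔ t p (inj₂ q) t≤T p<P = ⇔-trans (substar-valuation vars X (index< (inj₂ q) t≤T p<P))
        (⇔-trans (≡⇒⇔ (cong (_≡ true) (X-idx t p (inj₂ q) p<P))) (does-true (Truthful? t p (inj₂ q))))

  reduces : A ≤ₚ ModelRepair
  reduces = record
    { reduction  = λ w → evalO (words₁ w) program []
    ; computable = polyTime program
    ; correct    = λ w → mk⇔
        (λ Aw → starInstance (vars w) (η w) , sym (program-eval w) , complete w Aw)
        (λ (I , code≡ , r) → sound w (repairable-code I (starInstance (vars w) (η w))
          (trans code≡ (program-eval w)) r))
    }

theorem1 : NPComplete ModelRepair
theorem1 = modelRepair-inNP , λ A np → Reduction.reduces np
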